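{- Let $\lambda\in\mathbf{k}$. The Rota–Baxter species $(\mathrm{ADF},\diamond,\bullet,R)$ of weight $\lambda$, together with the morphism of species $i:O\to\mathrm{ADF}$, is the free Rota–Baxter species of weight $\lambda$ on $O$: for every Rota–Baxter species $(Q,m,1_Q,R')$ of weight $\lambda$ and every morphism of species $g:O\to Q$, there is a unique morphism of Rota–Baxter species $\overline{g}:\mathrm{ADF}\to Q$ such that $g=\overline{g}\circ i$.
   Context: $\mathbf{k}$ is a field of characteristic zero. A species is a functor from finite sets with bijections to $\mathbf{k}$-vector spaces; a morphism of species is a natural transformation. A twisted algebra is a species $P$ with natural maps $m_{X,Y}:P[X]\otimes P[Y]\to P[X\sqcup Y]$ (for disjoint finite sets) that are associative and have a unit $1_P\in P[\emptyset]$. A Rota–Baxter species of weight $\lambda$ is a twisted algebra $(P,m,1_P)$ with a morphism of species $R:P\to P$ such that $m_{X,Y}(R_X(x)\otimes R_Y(y))=R_{X\sqcup Y}\big(m_{X,Y}(R_X(x)\otimes y+x\otimes R_Y(y)+\lambda x\otimes y)\big)$ for all $x\in P[X]$, $y\in P[Y]$. A morphism of Rota–Baxter species $f:(P,m,1_P,R)\to(P',m',1_{P'},R')$ is a morphism of species with $f\circ m=m'\circ(f\otimes f)$, $f(1_P)=1_{P'}$, $f\circ R=R'\circ f$. Angularly decorated forests: a planar rooted forest $T_1\cdots T_n$ with $\ell$ leaves has $\ell-1$ angles (gaps between consecutive leaves left to right, inside a tree or between adjacent trees), written $T_1x_1T_2\cdots x_{n-1}T_n$; $\bullet$ is the one-vertex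 tree. For a finite set $X$, $\mathrm{ADF}[X]$ is the vector space with basis the forests with exactly $|X|$ angles decorated bijectively by $X$; $\mathrm{ADF}[\sigma]$ relabels decorations along a bijection $\sigma$. $B^+$ adds a new root joined to the roots of all trees, keeping decorations; every tree other than $\bullet$ is $B^+$ of a unique forest. Depth of a tree = maximal root-to-leaf path length; of a forest = max over its trees. The product $\diamond$ of weight $\lambda$ is defined bilinearly by induction on the sum of depths: for trees, $\bullet\diamond\bullet=\bullet$, $T\diamond\bullet=T$, $\bullet\diamond T'=T'$, $B^+(A)\diamond B^+(A')=B^+(B^+(A)\diamond A')+B^+(A\diamond B^+(A'))+\lambda B^+(A\diamond A')$; for forests $F=T_1x_1\cdots x_mT_{m+1}$, $G=T'_1y_1\cdots y_nT'_{n+1}$, $F\diamond G=T_1x_1\cdots x_m(T_{m+1}\diamond T'_1)y_1T'_2\cdots y_nT'_{n+1}$. The twisted algebra structure on $\mathrm{ADF}$ is $m_{X,Y}(F\otimes G)=F\diamond G$ with unit $\bullet$, and $R_X(F)=B^+(F)$. The species $O$ has $O[\{x\}]=\mathbf{k}\,\bullet x\bullet$ (the forest of two one-vertex trees separated by an angle decorated by $x$) for singletons, $O[X]=0$ otherwise, with $O[\sigma](\bullet x\bullet)=\bullet\sigma(x)\bullet$; $i:O\to\mathrm{ADF}$ is the natural inclusion on singletons and $0$ otherwise. -}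

module Defs where

open import Level using (Level; _⊔_; 0ℓ) renaming (suc to lsuc)
open import Data.Nat using (ℕ; zero; suc) renaming (_+_ to _+ℕ_)
open import Data.Fin using (Fin)
import Data.Fin as F
open import Data.Fin.Properties using (+↔⊎)
open import Data.Empty.Polymorphic using (⊥)
open import Data.Sum using (_⊎_; inj₁; inj₂)
open import Data.Product using (Σ; _×_; _,_)
open import Data.List using (List; []; _∷_; _++_; map; concatMap)
open import Data.List.Relation.Unary.Unique.Propositional using (Unique)
open import Data.List.Membership.Propositional using (_∈_)
open import Function.Bundles using (Inverse; _↔_; mk↔ₛ′)
open import Function.Construct.Composition using (_↔-∘_)
open import Function.Construct.Identity using (↔-id)
open import Function.Construct.Symmetry using (↔-sym)
open import Relation.Binary.PropositionalEquality using (_≡_; refl; cong; trans; sym)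
open import Relation.Binary.Core using (Rel)
open import Relation.Binary.Definitions using (DecidableEquality)
open import Relation.Nullary using (¬_; yes; no)
open import Algebra.Bundles using (CommutativeRing)
open import Algebra.Core using (Op₁; Op₂)
open import Algebra.Module.Structures using (IsLeftModule)
open import Data.Sum.Algebra using (⊎-cong; ⊎-assoc; ⊎-identityˡ; ⊎-identityʳ)

ι : ∀ {c ℓ} (R : CommutativeRing c ℓ) → ℕ → CommutativeRing.Carrier R
ι R zero = CommutativeRing.0# R
ι R (suc n) = CommutativeRing._+_ R (CommutativeRing.1# R) (ι R n)

record Field (c ℓ : Level) : Set (lsuc (c ⊔ ℓ)) where
  field
    commutativeRing : CommutativeRing c ℓ
  open CommutativeRing commutativeRing public
  field
    0≉1 : ¬ (0# ≈ 1#)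
    inverse-exists : ∀ x → ¬ (x ≈ 0#) → Σ Carrier (λ y → (x * y) ≈ 1#)
    characteristic-zero : ∀ n → ¬ (ι commutativeRing (suc n) ≈ 0#)

record FinSet : Set₁ where
  constructor mkFinSet
  field
    Elt  : Set
    size : ℕ
    enum : Elt ↔ Fin size
open FinSet public

_⊎ˢ_ : FinSet → FinSet → FinSet
X ⊎ˢ Y = mkFinSet (Elt X ⊎ Elt Y) (size X +ℕ size Y)
                  (↔-sym +↔⊎ ↔-∘ ⊎-cong (enum X) (enum Y))

∅ˢ : FinSet
∅ˢ = mkFinSet ⊥ 0 (mk↔ₛ′ (λ ()) (λ ()) (λ ()) (λ ()))

record _≅_ (X Y : FinSet) : Set where
  constructor bij
  field
    iso : Elt X ↔ Elt Y
  app : Elt X → Elt Y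
  app = Inverse.to iso
open _≅_ public

idᵇ : ∀ X → X ≅ X
idᵇ X = bij (↔-id (Elt X))

_∘ᵇ_ : ∀ {X Y Z} → Y ≅ Z → X ≅ Y → X ≅ Z
τ ∘ᵇ σ = bij (iso τ ↔-∘ iso σ)

_⊎ᵇ_ : ∀ {X X' Y Y'} → X ≅ X' → Y ≅ Y' → (X ⊎ˢ Y) ≅ (X' ⊎ˢ Y')
σ ⊎ᵇ τ = bij (⊎-cong (iso σ) (iso τ))

assocᵇ : ∀ X Y Z → ((X ⊎ˢ Y) ⊎ˢ Z) ≅ (X ⊎ˢ (Y ⊎ˢ Z))
assocᵇ X Y Z = bij (⊎-assoc 0ℓ (Elt X) (Elt Y) (Elt Z))

unitˡᵇ : ∀ X → (∅ˢ ⊎ˢ X) ≅ X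
unitˡᵇ X = bij (⊎-identityˡ 0ℓ (Elt X))

unitʳᵇ : ∀ X → (X ⊎ˢ ∅ˢ) ≅ X
unitʳᵇ X = bij (⊎-identityʳ 0ℓ (Elt X))

_≟ᴱ_ : ∀ {X} → DecidableEquality (Elt X)
_≟ᴱ_ {X} x y with Inverse.to (enum X) x F.≟ Inverse.to (enum X) y
... | yes p = yes (trans (sym (Inverse.strictlyInverseʳ (enum X) x))
                   (trans (cong (Inverse.from (enum X)) p) (Inverse.strictlyInverseʳ (enum X) y)))
... | no ¬p = no (λ q → ¬p (cong (Inverse.to (enum X)) q))

module _ {c ℓ : Level} (K : Field c ℓ) where

  private
    module K = Field K

  record RawSpecies (m ℓm : Level) : Set (lsuc (m ⊔ ℓm) ⊔ c) where
    infix  4 _≈_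
    infixl 6 _+_
    infixr 7 _·_
    field
      Obj     : FinSet → Set m
      _≈_     : ∀ {X} → Rel (Obj X) ℓm
      _+_     : ∀ {X} → Op₂ (Obj X)
      0ᴹ      : ∀ {X} → Obj X
      -_      : ∀ {X} → Op₁ (Obj X)
      _·_     : ∀ {X} → K.Carrier → Obj X → Obj X
      relabel : ∀ {X Y} → X ≅ Y → Obj X → Obj Y

  record IsSpecies {m ℓm} (P : RawSpecies m ℓm) : Set (lsuc (m ⊔ ℓm) ⊔ c ⊔ ℓ) where
    open RawSpecies P
    field
      isVectorSpace : ∀ X → IsLeftModule K.ring (_≈_ {X}) _+_ 0ᴹ -_ _·_
      relabel-cong  : ∀ {X Y} (σ τ : X ≅ Y) → (∀ a → app σ a ≡ app τ a) →
                      ∀ {x y : Obj X} → x ≈ y → relabel σ x ≈ relabel τ y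
      relabel-+     : ∀ {X Y} (σ : X ≅ Y) (x y : Obj X) → relabel σ (x + y) ≈ relabel σ x + relabel σ y
      relabel-·     : ∀ {X Y} (σ : X ≅ Y) (a : K.Carrier) (x : Obj X) → relabel σ (a · x) ≈ a · relabel σ x
      relabel-id    : ∀ {X} (x : Obj X) → relabel (idᵇ X) x ≈ x
      relabel-∘     : ∀ {X Y Z} (σ : X ≅ Y) (τ : Y ≅ Z) (x : Obj X) →
                      relabel (τ ∘ᵇ σ) x ≈ relabel τ (relabel σ x)

  record IsSpeciesMorphism {m ℓm m' ℓm'} (P : RawSpecies m ℓm) (Q : RawSpecies m' ℓm')
           (f : ∀ {X} → RawSpecies.Obj P X → RawSpecies.Obj Q X) : Set (lsuc 0ℓ ⊔ m ⊔ ℓm ⊔ m' ⊔ ℓm' ⊔ c) where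
    private
      module P = RawSpecies P
      module Q = RawSpecies Q
    field
      f-cong    : ∀ {X} {x y : P.Obj X} → x P.≈ y → f x Q.≈ f y
      f-+       : ∀ {X} (x y : P.Obj X) → f (x P.+ y) Q.≈ f x Q.+ f y
      f-·       : ∀ {X} (a : K.Carrier) (x : P.Obj X) → f (a P.· x) Q.≈ a Q.· f x
      f-natural : ∀ {X Y} (σ : X ≅ Y) (x : P.Obj X) → f (P.relabel σ x) Q.≈ Q.relabel σ (f x)

  -- The data of a Rota–Baxter species: a species with a product
  -- m_{X,Y} : P[X] ⊗ P[Y] → P[X ⊔ Y] (given as a map out of P[X] × P[Y],
  -- required to be bilinear), a unit 1_P ∈ P[∅], and an operator R.
  record RawRBSpecies (m ℓm : Level) : Set (lsuc (m ⊔ ℓm) ⊔ c) where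
    field
      species : RawSpecies m ℓm
    open RawSpecies species public
    field
      mul  : ∀ {X Y} → Obj X → Obj Y → Obj (X ⊎ˢ Y)
      unit : Obj ∅ˢ
      R    : ∀ {X} → Obj X → Obj X

  record IsRBSpecies {m ℓm} (w : K.Carrier) (P : RawRBSpecies m ℓm) : Set (lsuc (m ⊔ ℓm) ⊔ c ⊔ ℓ) where
    open RawRBSpecies P
    field
      isSpecies   : IsSpecies species
      mul-cong    : ∀ {X Y} {x x' : Obj X} {y y' : Obj Y} → x ≈ x' → y ≈ y' → mul x y ≈ mul x' y'
      mul-+ˡ      : ∀ {X Y} (x x' : Obj X) (y : Obj Y) → mul (x + x') y ≈ mul x y + mul x' y
      mul-+ʳ      : ∀ {X Y} (x : Obj X) (y y' : Obj Y) → mul x (y + y') ≈ mul x y + mul x y'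
      mul-·ˡ      : ∀ {X Y} (a : K.Carrier) (x : Obj X) (y : Obj Y) → mul (a · x) y ≈ a · mul x y
      mul-·ʳ      : ∀ {X Y} (a : K.Carrier) (x : Obj X) (y : Obj Y) → mul x (a · y) ≈ a · mul x y
      mul-natural : ∀ {X X' Y Y'} (σ : X ≅ X') (τ : Y ≅ Y') (x : Obj X) (y : Obj Y) →
                    relabel (σ ⊎ᵇ τ) (mul x y) ≈ mul (relabel σ x) (relabel τ y)
      mul-assoc   : ∀ {X Y Z} (x : Obj X) (y : Obj Y) (z : Obj Z) →
                    relabel (assocᵇ X Y Z) (mul (mul x y) z) ≈ mul x (mul y z)
      mul-unitˡ   : ∀ {X} (x : Obj X) → relabel (unitˡᵇ X) (mul unit x) ≈ x
      mul-unitʳ   : ∀ {X} (x : Obj X) → relabel (unitʳᵇ X) (mul x unit) ≈ x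
      R-cong      : ∀ {X} {x y : Obj X} → x ≈ y → R x ≈ R y
      R-+         : ∀ {X} (x y : Obj X) → R (x + y) ≈ R x + R y
      R-·         : ∀ {X} (a : K.Carrier) (x : Obj X) → R (a · x) ≈ a · R x
      R-natural   : ∀ {X Y} (σ : X ≅ Y) (x : Obj X) → relabel σ (R x) ≈ R (relabel σ x)
      rota-baxter : ∀ {X Y} (x : Obj X) (y : Obj Y) →
                    mul (R x) (R y) ≈ R (mul (R x) y + mul x (R y) + w · mul x y)

  record RBSpecies (w : K.Carrier) (m ℓm : Level) : Set (lsuc (m ⊔ ℓm) ⊔ c ⊔ ℓ) where
    field
      raw  : RawRBSpecies m ℓm
      isRB : IsRBSpecies w raw
    open RawRBSpecies raw public
    open IsRBSpecies isRB public

  record IsRBMorphism {m ℓm m' ℓm'} (P : RawRBSpecies m ℓm) (Q : RawRBSpecies m' ℓm')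
           (f : ∀ {X} → RawRBSpecies.Obj P X → RawRBSpecies.Obj Q X) : Set (lsuc 0ℓ ⊔ m ⊔ ℓm ⊔ m' ⊔ ℓm' ⊔ c) where
    private
      module P = RawRBSpecies P
      module Q = RawRBSpecies Q
    field
      isSpeciesMorphism : IsSpeciesMorphism P.species Q.species f
      f-mul  : ∀ {X Y} (x : P.Obj X) (y : P.Obj Y) → f (P.mul x y) Q.≈ Q.mul (f x) (f y)
      f-unit : f P.unit Q.≈ Q.unit
      f-R    : ∀ {X} (x : P.Obj X) → f (P.R x) Q.≈ Q.R (f x)

-- A forest T₁ x₁ T₂ ⋯ xₙ₋₁ Tₙ is a nonempty sequence of trees separated by
-- angle decorations; a tree is either the one-vertex tree • or B⁺ of a forest.

mutual
  data Tree (L : Set) : Set where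
    •  : Tree L
    B⁺ : Forest L → Tree L

  data Forest (L : Set) : Set where
    [_]   : Tree L → Forest L
    _⟨_⟩_ : Tree L → L → Forest L → Forest L

infixr 5 _⟨_⟩_

mutual
  labelsᵀ : ∀ {L} → Tree L → List L
  labelsᵀ • = []
  labelsᵀ (B⁺ F) = labelsᶠ F

  labelsᶠ : ∀ {L} → Forest L → List L
  labelsᶠ [ T ] = labelsᵀ T
  labelsᶠ (T ⟨ x ⟩ F) = labelsᵀ T ++ (x ∷ labelsᶠ F)

mutual
  mapᵀ : ∀ {L L'} → (L → L') → Tree L → Tree L'
  mapᵀ f • = •
  mapᵀ f (B⁺ F) = B⁺ (mapᶠ f F)

  mapᶠ : ∀ {L L'} → (L → L') → Forest L → Forest L'
  mapᶠ f [ T ] = [ mapᵀ f T ]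
  mapᶠ f (T ⟨ x ⟩ F) = mapᵀ f T ⟨ f x ⟩ mapᶠ f F

-- A forest decorated by X is a basis element of ADF[X] iff its angles are
-- decorated bijectively by X: the list of decorations has no repetition
-- and contains every element of X.
Bijective : ∀ {X} → Forest (Elt X) → Set
Bijective F = Unique (labelsᶠ F) × (∀ a → a ∈ labelsᶠ F)

module _ {L : Set} (_≟_ : DecidableEquality L) where
  mutual
    _≟ᵀ_ : DecidableEquality (Tree L)
    • ≟ᵀ • = yes refl
    • ≟ᵀ B⁺ _ = no (λ ())
    B⁺ _ ≟ᵀ • = no (λ ())
    B⁺ F ≟ᵀ B⁺ G with F ≟ᶠ G
    ... | yes refl = yes refl
    ... | no ¬p = no (λ { refl → ¬p refl })

    _≟ᶠ_ : DecidableEquality (Forest L)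
    [ T ] ≟ᶠ [ U ] with T ≟ᵀ U
    ... | yes refl = yes refl
    ... | no ¬p = no (λ { refl → ¬p refl })
    [ _ ] ≟ᶠ (_ ⟨ _ ⟩ _) = no (λ ())
    (_ ⟨ _ ⟩ _) ≟ᶠ [ _ ] = no (λ ())
    (T ⟨ x ⟩ F) ≟ᶠ (U ⟨ y ⟩ G) with T ≟ᵀ U | x ≟ y | F ≟ᶠ G
    ... | yes refl | yes refl | yes refl = yes refl
    ... | no ¬p | _ | _ = no (λ { refl → ¬p refl })
    ... | yes _ | no ¬p | _ = no (λ { refl → ¬p refl })
    ... | yes _ | yes _ | no ¬p = no (λ { refl → ¬p refl })

module ADF {c ℓ : Level} (K : Field c ℓ) (w : Field.Carrier K) where

  open Field K using () renaming (Carrier to k; _≈_ to _≈ₖ_; _+_ to _+ₖ_; _*_ to _*ₖ_;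
                                   -_ to -ₖ_; 0# to 0ₖ; 1# to 1ₖ)

  Lin : Set → Set c
  Lin A = List (k × A)

  onTerms : ∀ {A B : Set} → (A → B) → Lin A → Lin B
  onTerms f = map (λ { (a , t) → (a , f t) })

  scale : ∀ {A : Set} → k → Lin A → Lin A
  scale s = map (λ { (a , t) → (s *ₖ a , t) })

  module Product {L : Set} where
    mutual
      _⋄ᵀ_ : Tree L → Tree L → Lin (Tree L)
      • ⋄ᵀ T' = (1ₖ , T') ∷ []
      B⁺ A ⋄ᵀ • = (1ₖ , B⁺ A) ∷ []
      B⁺ A ⋄ᵀ B⁺ A' = onTerms B⁺ (tf (B⁺ A) A')
                   ++ onTerms B⁺ (ft A (B⁺ A'))
                   ++ scale w (onTerms B⁺ (ff A A'))

      tf : Tree L → Forest L → Lin (Forest L)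
      tf T [ T' ] = onTerms [_] (T ⋄ᵀ T')
      tf T (T' ⟨ y ⟩ G) = onTerms (λ U → U ⟨ y ⟩ G) (T ⋄ᵀ T')

      ft : Forest L → Tree L → Lin (Forest L)
      ft [ T ] T' = onTerms [_] (T ⋄ᵀ T')
      ft (T ⟨ x ⟩ F) T' = onTerms (λ H → T ⟨ x ⟩ H) (ft F T')

      ff : Forest L → Forest L → Lin (Forest L)
      ff [ T ] G = tf T G
      ff (T ⟨ x ⟩ F) G = onTerms (λ H → T ⟨ x ⟩ H) (ff F G)

  open Product public

  coeff : ∀ {X} → Lin (Forest (Elt X)) → Forest (Elt X) → k
  coeff [] F = 0ₖ
  coeff {X} ((a , G) ∷ u) F with _≟ᶠ_ (_≟ᴱ_ {X}) G F
  ... | yes _ = a +ₖ coeff {X} u F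
  ... | no _ = coeff {X} u F

  -- ADF[X]: the vector space with basis the forests whose angles are
  -- decorated bijectively by X.  It is presented as formal linear
  -- combinations of X-decorated forests, two combinations being equal iff
  -- they have the same coefficient at every bijectively decorated forest
  -- (i.e. the free vector space on all X-decorated forests modulo the span
  -- of the non-bijectively decorated ones, which is canonically the free
  -- vector space on the bijectively decorated ones).
  ADFspecies : RawSpecies K c ℓ
  ADFspecies = record
    { Obj     = λ X → Lin (Forest (Elt X))
    ; _≈_     = λ {X} u v → ∀ (F : Forest (Elt X)) → Bijective {X} F → coeff {X} u F ≈ₖ coeff {X} v F
    ; _+_     = _++_
    ; 0ᴹ      = []
    ; -_      = scale (-ₖ 1ₖ)
    ; _·_     = scale
    ; relabel = λ σ → onTerms (mapᶠ (app σ))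
    }

  mulADF : ∀ {X Y} → Lin (Forest (Elt X)) → Lin (Forest (Elt Y)) → Lin (Forest (Elt (X ⊎ˢ Y)))
  mulADF u v = concatMap (λ { (a , F) → concatMap (λ { (b , G) →
                 scale (a *ₖ b) (ff (mapᶠ inj₁ F) (mapᶠ inj₂ G)) }) v }) u

  ADF : RawRBSpecies K c ℓ
  ADF = record
    { species = ADFspecies
    ; mul     = λ {X} {Y} → mulADF {X} {Y}
    ; unit    = (1ₖ , [ • ]) ∷ []
    ; R       = onTerms (λ F → [ B⁺ F ])
    }

  •⟨_⟩• : ∀ {L : Set} → L → Forest L
  •⟨ x ⟩• = • ⟨ x ⟩ [ • ]

  -- The species O: O[X] = k (• x •) if X = {x}, O[X] = 0 otherwise.
  -- Presented as formal combinations of the forests • x • (x ∈ X), equal iff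
  -- their coefficients agree at each • x • that is a basis element of ADF[X]
  -- (which happens iff X = {x}).
  Ospecies : RawSpecies K c ℓ
  Ospecies = record
    { Obj     = λ X → Lin (Elt X)
    ; _≈_     = λ {X} u v → ∀ (x : Elt X) → Bijective {X} •⟨ x ⟩• →
                  coeff {X} (onTerms •⟨_⟩• u) •⟨ x ⟩• ≈ₖ coeff {X} (onTerms •⟨_⟩• v) •⟨ x ⟩•
    ; _+_     = _++_
    ; 0ᴹ      = []
    ; -_      = scale (-ₖ 1ₖ)
    ; _·_     = scale
    ; relabel = λ σ → onTerms (app σ)
    }

  i : ∀ {X} → Lin (Elt X) → Lin (Forest (Elt X))
  i = onTerms •⟨_⟩•

-- The Rota–Baxter axioms reduce to
-- identities of ⋄ on single forests; associativity is a simultaneous induction on three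
-- forests whose only real case, B⁺A ⋄ B⁺A′ ⋄ B⁺A″, expands both bracketings by the
-- defining recursion into the same seven weighted terms.
--
-- For universality, a bijectively decorated forest is its canonical forest (decorated by
-- its own angles) relabelled, and a canonical forest is built from the generator • x •,
-- the unit and R by the product: T x F = T ⋄ (• x • ⋄ F) and B⁺ F = R F. So a morphism
-- extending g is forced to be ḡ, which evaluates a forest in Q accordingly. Conversely ḡ
-- is multiplicative because the product of two forests can be computed while tracking
-- where each angle of each term comes from, and along that computation the evaluation
-- satisfies the same recursion as the product in Q, the B⁺ case being the Rota–Baxter
-- identity of Q.

module Submission where

open import Defs
open import Level using (Level; _⊔_; lift)
open import Data.Empty using (⊥-elim)
open import Data.Unit using (⊤; tt)
open import Data.Nat using (suc; _≤_; z≤n; s≤s)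
open import Data.Nat.Properties using (≤-trans; n≤1+n; ≤-refl)
import Data.Fin as Fin
open import Data.Fin.Properties using (all?)
open import Data.Product using (Σ; _×_; _,_; proj₁; proj₂)
open import Data.Sum using (_⊎_; inj₁; inj₂) renaming ([_,_] to case⊎)
open import Data.Sum.Properties using (inj₁-injective; inj₂-injective)
open import Data.List using (List; []; _∷_; _++_; map; concatMap; length)
open import Data.List.Properties using (++-assoc; map-++; map-∘; ++-identityʳ)
open import Data.List.Relation.Unary.All using (All; []; _∷_)
import Data.List.Relation.Unary.All as All
import Data.List.Relation.Unary.All.Properties as AllP
open import Data.List.Relation.Unary.Any using (here; there)
open import Data.List.Relation.Unary.AllPairs using ([]; _∷_)
open import Data.List.Relation.Unary.Unique.Propositional using (Unique)
import Data.List.Relation.Unary.Unique.Propositional.Properties as UP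
import Data.List.Relation.Unary.Unique.DecPropositional as UD
open import Data.List.Membership.Propositional using (_∈_)
open import Data.List.Membership.Propositional.Properties using (∈-map⁺; ∈-map⁻; ∈-++⁺ˡ; ∈-++⁺ʳ; ∈-++⁻)
import Data.List.Membership.DecPropositional as MD
open import Relation.Binary.PropositionalEquality as P using (_≡_; refl; cong; cong₂; trans; sym; subst)
open import Relation.Binary.Definitions using (DecidableEquality)
open import Relation.Binary.Bundles using (Setoid)
import Relation.Binary.Reasoning.Setoid as SR
open import Relation.Nullary using (¬_; yes; no; Dec)
open import Relation.Nullary.Decidable using (_×-dec_; map′)
open import Function.Bundles using (Inverse; mk↔ₛ′)
open import Function.Construct.Symmetry using (↔-sym)
open import Algebra.Module.Bundles using (LeftModule)
open import Algebra.Module.Structures using (IsLeftModule)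
import Algebra.Module.Construct.TensorUnit as TU
open import Data.Maybe using (nothing)
open import Tactic.RingSolver.Core.AlmostCommutativeRing using (fromCommutativeRing)
import Tactic.RingSolver.NonReflective as NR

module LinearCombination {c ℓ} (K : Field c ℓ) where

  open Field K renaming (Carrier to k; refl to ≈-refl; sym to ≈-sym; trans to ≈-trans)
  open ADF K 0# using (Lin; onTerms; scale)

  bind : ∀ {A B : Set} → Lin A → (A → Lin B) → Lin B
  bind u h = concatMap (λ { (a , t) → scale a (h t) }) u

  coef : ∀ {A : Set} → DecidableEquality A → Lin A → A → k
  coef eq [] t = 0#
  coef eq ((a , s) ∷ u) t with eq s t
  ... | yes _ = a + coef eq u t
  ... | no _ = coef eq u t

  removeAll : ∀ {A : Set} → DecidableEquality A → A → Lin A → Lin A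
  removeAll eq t [] = []
  removeAll eq t ((a , s) ∷ u) with eq s t
  ... | yes _ = removeAll eq t u
  ... | no _ = (a , s) ∷ removeAll eq t u

  removeAll-length : ∀ {A : Set} (eq : DecidableEquality A) t (u : Lin A) → length (removeAll eq t u) ≤ length u
  removeAll-length eq t [] = z≤n
  removeAll-length eq t ((a , s) ∷ u) with eq s t
  ... | yes _ = ≤-trans (removeAll-length eq t u) (n≤1+n _)
  ... | no _ = s≤s (removeAll-length eq t u)

  removeAll-head-length : ∀ {A : Set} (eq : DecidableEquality A) t a (u : Lin A) →
                          length (removeAll eq t ((a , t) ∷ u)) ≤ length u
  removeAll-head-length eq t a u with eq t t
  ... | yes _ = removeAll-length eq t u
  ... | no t≢t = ⊥-elim (t≢t refl)

  coef-removeAll-self : ∀ {A : Set} (eq : DecidableEquality A) t (u : Lin A) → coef eq (removeAll eq t u) t ≈ 0#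
  coef-removeAll-self eq t [] = ≈-refl
  coef-removeAll-self eq t ((a , s) ∷ u) with eq s t
  ... | yes _ = coef-removeAll-self eq t u
  ... | no s≢t with eq s t
  ...   | yes s≡t = ⊥-elim (s≢t s≡t)
  ...   | no _ = coef-removeAll-self eq t u

  coef-removeAll-other : ∀ {A : Set} (eq : DecidableEquality A) t r (u : Lin A) → ¬ (r ≡ t) →
                         coef eq (removeAll eq t u) r ≈ coef eq u r
  coef-removeAll-other eq t r [] r≢t = ≈-refl
  coef-removeAll-other eq t r ((a , s) ∷ u) r≢t with eq s t
  ... | yes refl with eq s r
  ...   | yes refl = ⊥-elim (r≢t refl)
  ...   | no _ = coef-removeAll-other eq t r u r≢t
  coef-removeAll-other eq t r ((a , s) ∷ u) r≢t | no _ with eq s r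
  ...   | yes _ = +-congˡ (coef-removeAll-other eq t r u r≢t)
  ...   | no _ = coef-removeAll-other eq t r u r≢t

  module Sum {m ℓm} (M : LeftModule ring m ℓm) where
    open LeftModule M
    open SR ≈ᴹ-setoid

    ∑ : ∀ {A : Set} → (A → Carrierᴹ) → Lin A → Carrierᴹ
    ∑ f [] = 0ᴹ
    ∑ f ((a , t) ∷ u) = a *ₗ f t +ᴹ ∑ f u

    ∑-removeAll : ∀ {A : Set} (eq : DecidableEquality A) (f : A → Carrierᴹ) t (u : Lin A) →
                  ∑ f u ≈ᴹ (coef eq u t *ₗ f t) +ᴹ ∑ f (removeAll eq t u)
    ∑-removeAll eq f t [] = ≈ᴹ-sym (≈ᴹ-trans (+ᴹ-congʳ (*ₗ-zeroˡ (f t))) (+ᴹ-identityˡ 0ᴹ))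
    ∑-removeAll eq f t ((a , s) ∷ u) with eq s t
    ... | yes refl = begin
          a *ₗ f s +ᴹ ∑ f u ≈⟨ +ᴹ-congˡ (∑-removeAll eq f s u) ⟩
          a *ₗ f s +ᴹ (coef eq u s *ₗ f s +ᴹ ∑ f (removeAll eq s u)) ≈⟨ ≈ᴹ-sym (+ᴹ-assoc _ _ _) ⟩
          (a *ₗ f s +ᴹ coef eq u s *ₗ f s) +ᴹ ∑ f (removeAll eq s u) ≈⟨ +ᴹ-congʳ (≈ᴹ-sym (*ₗ-distribʳ (f s) a _)) ⟩
          (a + coef eq u s) *ₗ f s +ᴹ ∑ f (removeAll eq s u) ∎
    ... | no _ = begin
          a *ₗ f s +ᴹ ∑ f u ≈⟨ +ᴹ-congˡ (∑-removeAll eq f t u) ⟩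
          a *ₗ f s +ᴹ (coef eq u t *ₗ f t +ᴹ ∑ f (removeAll eq t u)) ≈⟨ ≈ᴹ-sym (+ᴹ-assoc _ _ _) ⟩
          (a *ₗ f s +ᴹ coef eq u t *ₗ f t) +ᴹ ∑ f (removeAll eq t u) ≈⟨ +ᴹ-congʳ (+ᴹ-comm _ _) ⟩
          (coef eq u t *ₗ f t +ᴹ a *ₗ f s) +ᴹ ∑ f (removeAll eq t u) ≈⟨ +ᴹ-assoc _ _ _ ⟩
          coef eq u t *ₗ f t +ᴹ (a *ₗ f s +ᴹ ∑ f (removeAll eq t u)) ∎

    *ₗ-vanishing : ∀ (a : k) {x : Carrierᴹ} → a ≈ 0# ⊎ x ≈ᴹ 0ᴹ → a *ₗ x ≈ᴹ 0ᴹ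
    *ₗ-vanishing a (inj₁ a≈0) = ≈ᴹ-trans (*ₗ-cong a≈0 ≈ᴹ-refl) (*ₗ-zeroˡ _)
    *ₗ-vanishing a (inj₂ x≈0) = ≈ᴹ-trans (*ₗ-cong ≈-refl x≈0) (*ₗ-zeroʳ _)

    -- The induction removes all occurrences of the head term at once, so it
    -- is on a bound for the length of the combination.
    ∑-vanishing-bounded : ∀ {A : Set} (eq : DecidableEquality A) (f : A → Carrierᴹ) n (u : Lin A) → length u ≤ n →
                          (∀ t → coef eq u t ≈ 0# ⊎ f t ≈ᴹ 0ᴹ) → ∑ f u ≈ᴹ 0ᴹ
    ∑-vanishing-bounded eq f n [] _ h = ≈ᴹ-refl
    ∑-vanishing-bounded eq f (suc n) ((a , t) ∷ u) (s≤s u≤n) h = begin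
        ∑ f ((a , t) ∷ u) ≈⟨ ∑-removeAll eq f t ((a , t) ∷ u) ⟩
        coef eq ((a , t) ∷ u) t *ₗ f t +ᴹ ∑ f (removeAll eq t ((a , t) ∷ u))
           ≈⟨ +ᴹ-cong (*ₗ-vanishing _ (h t))
                      (∑-vanishing-bounded eq f n (removeAll eq t ((a , t) ∷ u)) (≤-trans (removeAll-head-length eq t a u) u≤n) h′) ⟩
        0ᴹ +ᴹ 0ᴹ ≈⟨ +ᴹ-identityˡ 0ᴹ ⟩
        0ᴹ ∎
      where
        h′ : ∀ s → coef eq (removeAll eq t ((a , t) ∷ u)) s ≈ 0# ⊎ f s ≈ᴹ 0ᴹ
        h′ s with eq s t
        ... | yes refl = inj₁ (coef-removeAll-self eq s ((a , s) ∷ u))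
        ... | no s≢t with h s
        ...   | inj₁ p = inj₁ (≈-trans (coef-removeAll-other eq t s ((a , t) ∷ u) s≢t) p)
        ...   | inj₂ p = inj₂ p

    ∑-resp-coef-bounded : ∀ {A : Set} (eq : DecidableEquality A) (f : A → Carrierᴹ) n (u v : Lin A) → length u ≤ n →
                          (∀ t → coef eq u t ≈ coef eq v t ⊎ f t ≈ᴹ 0ᴹ) → ∑ f u ≈ᴹ ∑ f v
    ∑-resp-coef-bounded eq f n [] v _ h = ≈ᴹ-sym (∑-vanishing-bounded eq f (length v) v ≤-refl h′)
      where
        h′ : ∀ s → coef eq v s ≈ 0# ⊎ f s ≈ᴹ 0ᴹ
        h′ s with h s
        ... | inj₁ p = inj₁ (≈-sym p)
        ... | inj₂ p = inj₂ p
    ∑-resp-coef-bounded eq f (suc n) ((a , t) ∷ u) v (s≤s u≤n) h = begin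
        ∑ f ((a , t) ∷ u) ≈⟨ ∑-removeAll eq f t ((a , t) ∷ u) ⟩
        coef eq ((a , t) ∷ u) t *ₗ f t +ᴹ ∑ f (removeAll eq t ((a , t) ∷ u))
           ≈⟨ +ᴹ-cong head (∑-resp-coef-bounded eq f n (removeAll eq t ((a , t) ∷ u)) (removeAll eq t v) (≤-trans (removeAll-head-length eq t a u) u≤n) h′) ⟩
        coef eq v t *ₗ f t +ᴹ ∑ f (removeAll eq t v) ≈⟨ ≈ᴹ-sym (∑-removeAll eq f t v) ⟩
        ∑ f v ∎
      where
        head : coef eq ((a , t) ∷ u) t *ₗ f t ≈ᴹ coef eq v t *ₗ f t
        head with h t
        ... | inj₁ p = *ₗ-cong p ≈ᴹ-refl
        ... | inj₂ p = ≈ᴹ-trans (*ₗ-vanishing _ (inj₂ p)) (≈ᴹ-sym (*ₗ-vanishing _ (inj₂ p)))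
        h′ : ∀ s → coef eq (removeAll eq t ((a , t) ∷ u)) s ≈ coef eq (removeAll eq t v) s ⊎ f s ≈ᴹ 0ᴹ
        h′ s with eq s t
        ... | yes refl = inj₁ (≈-trans (coef-removeAll-self eq s ((a , s) ∷ u)) (≈-sym (coef-removeAll-self eq s v)))
        ... | no s≢t with h s
        ...   | inj₁ p = inj₁ (≈-trans (coef-removeAll-other eq t s ((a , t) ∷ u) s≢t)
                                (≈-trans p (≈-sym (coef-removeAll-other eq t s v s≢t))))
        ...   | inj₂ p = inj₂ p

    ∑-resp-coef : ∀ {A : Set} (eq : DecidableEquality A) (f : A → Carrierᴹ) (u v : Lin A) →
                  (∀ t → coef eq u t ≈ coef eq v t ⊎ f t ≈ᴹ 0ᴹ) → ∑ f u ≈ᴹ ∑ f v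
    ∑-resp-coef eq f u v = ∑-resp-coef-bounded eq f (length u) u v ≤-refl

    ∑-++ : ∀ {A : Set} (f : A → Carrierᴹ) (u v : Lin A) → ∑ f (u ++ v) ≈ᴹ ∑ f u +ᴹ ∑ f v
    ∑-++ f [] v = ≈ᴹ-sym (+ᴹ-identityˡ _)
    ∑-++ f ((a , t) ∷ u) v = ≈ᴹ-trans (+ᴹ-congˡ (∑-++ f u v)) (≈ᴹ-sym (+ᴹ-assoc _ _ _))

    ∑-scale : ∀ {A : Set} (f : A → Carrierᴹ) s (u : Lin A) → ∑ f (scale s u) ≈ᴹ s *ₗ ∑ f u
    ∑-scale f s [] = ≈ᴹ-sym (*ₗ-zeroʳ s)
    ∑-scale f s ((a , t) ∷ u) = ≈ᴹ-trans (+ᴹ-cong (*ₗ-assoc s a (f t)) (∑-scale f s u)) (≈ᴹ-sym (*ₗ-distribˡ s _ _))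

    ∑-onTerms : ∀ {A B : Set} (f : B → Carrierᴹ) (g : A → B) (u : Lin A) → ∑ f (onTerms g u) ≡ ∑ (λ x → f (g x)) u
    ∑-onTerms f g [] = refl
    ∑-onTerms f g ((a , t) ∷ u) = cong (a *ₗ f (g t) +ᴹ_) (∑-onTerms f g u)

    ∑-bind : ∀ {A B : Set} (f : B → Carrierᴹ) (u : Lin A) (h : A → Lin B) → ∑ f (bind u h) ≈ᴹ ∑ (λ s → ∑ f (h s)) u
    ∑-bind f [] h = ≈ᴹ-refl
    ∑-bind f ((a , t) ∷ u) h = ≈ᴹ-trans (∑-++ f (scale a (h t)) (bind u h)) (+ᴹ-cong (∑-scale f a (h t)) (∑-bind f u h))

    ∑-cong : ∀ {A : Set} {f g : A → Carrierᴹ} (u : Lin A) → (∀ t → f t ≈ᴹ g t) → ∑ f u ≈ᴹ ∑ g u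
    ∑-cong [] e = ≈ᴹ-refl
    ∑-cong ((a , t) ∷ u) e = +ᴹ-cong (*ₗ-cong ≈-refl (e t)) (∑-cong u e)

    ∑-cong-All : ∀ {A : Set} {f g : A → Carrierᴹ} (u : Lin A) → All (λ e → f (proj₂ e) ≈ᴹ g (proj₂ e)) u → ∑ f u ≈ᴹ ∑ g u
    ∑-cong-All [] [] = ≈ᴹ-refl
    ∑-cong-All ((a , t) ∷ u) (p ∷ ps) = +ᴹ-cong (*ₗ-cong ≈-refl p) (∑-cong-All u ps)

    ∑-+ᴹ : ∀ {A : Set} (f g : A → Carrierᴹ) (u : Lin A) → ∑ (λ t → f t +ᴹ g t) u ≈ᴹ ∑ f u +ᴹ ∑ g u
    ∑-+ᴹ f g [] = ≈ᴹ-sym (+ᴹ-identityˡ _)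
    ∑-+ᴹ f g ((a , t) ∷ u) = begin
      a *ₗ (f t +ᴹ g t) +ᴹ ∑ (λ t → f t +ᴹ g t) u ≈⟨ +ᴹ-cong (*ₗ-distribˡ a _ _) (∑-+ᴹ f g u) ⟩
      (a *ₗ f t +ᴹ a *ₗ g t) +ᴹ (∑ f u +ᴹ ∑ g u) ≈⟨ +ᴹ-assoc _ _ _ ⟩
      a *ₗ f t +ᴹ (a *ₗ g t +ᴹ (∑ f u +ᴹ ∑ g u)) ≈⟨ +ᴹ-congˡ (≈ᴹ-sym (+ᴹ-assoc _ _ _)) ⟩
      a *ₗ f t +ᴹ ((a *ₗ g t +ᴹ ∑ f u) +ᴹ ∑ g u) ≈⟨ +ᴹ-congˡ (+ᴹ-congʳ (+ᴹ-comm _ _)) ⟩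
      a *ₗ f t +ᴹ ((∑ f u +ᴹ a *ₗ g t) +ᴹ ∑ g u) ≈⟨ +ᴹ-congˡ (+ᴹ-assoc _ _ _) ⟩
      a *ₗ f t +ᴹ (∑ f u +ᴹ (a *ₗ g t +ᴹ ∑ g u)) ≈⟨ ≈ᴹ-sym (+ᴹ-assoc _ _ _) ⟩
      (a *ₗ f t +ᴹ ∑ f u) +ᴹ (a *ₗ g t +ᴹ ∑ g u) ∎

    ∑-*ₗ : ∀ {A : Set} (f : A → Carrierᴹ) s (u : Lin A) → ∑ (λ t → s *ₗ f t) u ≈ᴹ s *ₗ ∑ f u
    ∑-*ₗ f s [] = ≈ᴹ-sym (*ₗ-zeroʳ s)
    ∑-*ₗ f s ((a , t) ∷ u) = begin
      a *ₗ (s *ₗ f t) +ᴹ ∑ (λ t → s *ₗ f t) u ≈⟨ +ᴹ-cong (≈ᴹ-sym (*ₗ-assoc a s (f t))) (∑-*ₗ f s u) ⟩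
      (a * s) *ₗ f t +ᴹ s *ₗ ∑ f u ≈⟨ +ᴹ-congʳ (*ₗ-cong (*-comm a s) ≈ᴹ-refl) ⟩
      (s * a) *ₗ f t +ᴹ s *ₗ ∑ f u ≈⟨ +ᴹ-congʳ (*ₗ-assoc s a (f t)) ⟩
      s *ₗ (a *ₗ f t) +ᴹ s *ₗ ∑ f u ≈⟨ ≈ᴹ-sym (*ₗ-distribˡ s _ _) ⟩
      s *ₗ ∑ f ((a , t) ∷ u) ∎

    ∑-0ᴹ : ∀ {A : Set} (u : Lin A) → ∑ (λ _ → 0ᴹ) u ≈ᴹ 0ᴹ
    ∑-0ᴹ [] = ≈ᴹ-refl
    ∑-0ᴹ ((a , t) ∷ u) = ≈ᴹ-trans (+ᴹ-cong (*ₗ-zeroʳ a) (∑-0ᴹ u)) (+ᴹ-identityˡ 0ᴹ)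

    ∑-singleton : ∀ {A : Set} (f : A → Carrierᴹ) t → ∑ f ((1# , t) ∷ []) ≈ᴹ f t
    ∑-singleton f t = ≈ᴹ-trans (+ᴹ-identityʳ _) (*ₗ-identityˡ (f t))

    ∑-swap : ∀ {A B : Set} (u : Lin A) (v : Lin B) (g : A → B → Carrierᴹ) →
             ∑ (λ s → ∑ (g s) v) u ≈ᴹ ∑ (λ t → ∑ (λ s → g s t) u) v
    ∑-swap [] v g = ≈ᴹ-sym (∑-0ᴹ v)
    ∑-swap ((a , s) ∷ u) v g = ≈ᴹ-trans (+ᴹ-cong (≈ᴹ-sym (∑-*ₗ (g s) a v)) (∑-swap u v g)) (≈ᴹ-sym (∑-+ᴹ _ _ v))

  module Scalar = Sum (TU.leftModule {R = ring})

  δ : ∀ {A : Set} → DecidableEquality A → A → A → k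
  δ eq t s with eq s t
  ... | yes _ = 1#
  ... | no _ = 0#

  open SR setoid

  coef-as-∑ : ∀ {A : Set} (eq : DecidableEquality A) (u : Lin A) t → coef eq u t ≈ Scalar.∑ (δ eq t) u
  coef-as-∑ eq [] t = ≈-refl
  coef-as-∑ eq ((a , s) ∷ u) t with eq s t
  ... | yes _ = +-cong (≈-sym (*-identityʳ a)) (coef-as-∑ eq u t)
  ... | no _ = ≈-sym (≈-trans (+-congʳ (zeroʳ a)) (≈-trans (+-identityˡ _) (≈-sym (coef-as-∑ eq u t))))

  record CoefEq {A : Set} (eq : DecidableEquality A) (u v : Lin A) : Set ℓ where
    constructor coefwise
    field _at_ : ∀ t → coef eq u t ≈ coef eq v t
  open CoefEq public

  module _ {A : Set} (eq : DecidableEquality A) where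
    coef-++ : ∀ (u v : Lin A) t → coef eq (u ++ v) t ≈ coef eq u t + coef eq v t
    coef-++ u v t = ≈-trans (coef-as-∑ eq (u ++ v) t)
                      (≈-trans (Scalar.∑-++ (δ eq t) u v) (≈-sym (+-cong (coef-as-∑ eq u t) (coef-as-∑ eq v t))))

    coef-scale : ∀ s (u : Lin A) t → coef eq (scale s u) t ≈ s * coef eq u t
    coef-scale s u t = ≈-trans (coef-as-∑ eq (scale s u) t)
                         (≈-trans (Scalar.∑-scale (δ eq t) s u) (*-congˡ (≈-sym (coef-as-∑ eq u t))))

    coef-singleton-other : ∀ (s t : A) → ¬ (s ≡ t) → coef eq ((1# , s) ∷ []) t ≈ 0#
    coef-singleton-other s t s≢t with eq s t
    ... | yes s≡t = ⊥-elim (s≢t s≡t)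
    ... | no _ = ≈-refl

    coef-singleton-cong : ∀ {a b : k} (s t : A) → a ≈ b → coef eq ((a , s) ∷ []) t ≈ coef eq ((b , s) ∷ []) t
    coef-singleton-cong s t a≈b with eq s t
    ... | yes _ = +-congʳ a≈b
    ... | no _ = ≈-refl

    CoefEq-setoid : Setoid c ℓ
    CoefEq-setoid = record
      { Carrier = Lin A
      ; _≈_ = CoefEq eq
      ; isEquivalence = record
        { refl = coefwise λ t → ≈-refl
        ; sym = λ e → coefwise λ t → ≈-sym (e at t)
        ; trans = λ e e′ → coefwise λ t → ≈-trans (e at t) (e′ at t) } }

    open Setoid CoefEq-setoid public using ()
      renaming (refl to CoefEq-refl; sym to CoefEq-sym; trans to CoefEq-trans; reflexive to ≡⇒CoefEq)

    ++-cong : ∀ {u u′ v v′ : Lin A} → CoefEq eq u u′ → CoefEq eq v v′ → CoefEq eq (u ++ v) (u′ ++ v′)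
    ++-cong {u} {u′} {v} {v′} e e′ = coefwise λ t →
      ≈-trans (coef-++ u v t) (≈-trans (+-cong (e at t) (e′ at t)) (≈-sym (coef-++ u′ v′ t)))

    scale-cong : ∀ s {u v : Lin A} → CoefEq eq u v → CoefEq eq (scale s u) (scale s v)
    scale-cong s {u} {v} e = coefwise λ t →
      ≈-trans (coef-scale s u t) (≈-trans (*-congˡ (e at t)) (≈-sym (coef-scale s v t)))

  concatMap-as-bind : ∀ {A B : Set} (eqB : DecidableEquality B) {f : k × A → Lin B} {h : A → Lin B} →
                      (∀ a t → CoefEq eqB (f (a , t)) (scale a (h t))) → ∀ u → CoefEq eqB (concatMap f u) (bind u h)
  concatMap-as-bind eqB e [] = CoefEq-refl eqB
  concatMap-as-bind eqB e ((a , t) ∷ u) = ++-cong eqB (e a t) (concatMap-as-bind eqB e u)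

  scale-* : ∀ {A : Set} (eq : DecidableEquality A) a b (u : Lin A) → CoefEq eq (scale (a * b) u) (scale b (scale a u))
  scale-* eq a b u = coefwise λ t → begin
    coef eq (scale (a * b) u) t ≈⟨ coef-scale eq (a * b) u t ⟩
    (a * b) * coef eq u t ≈⟨ *-congʳ (*-comm a b) ⟩
    (b * a) * coef eq u t ≈⟨ *-assoc b a _ ⟩
    b * (a * coef eq u t) ≈˘⟨ *-congˡ (coef-scale eq a u t) ⟩
    b * coef eq (scale a u) t ≈˘⟨ coef-scale eq b (scale a u) t ⟩
    coef eq (scale b (scale a u)) t ∎

  module _ {A B : Set} (eqA : DecidableEquality A) (eqB : DecidableEquality B) where
    coef-bind : ∀ (u : Lin A) (h : A → Lin B) t → coef eqB (bind u h) t ≈ Scalar.∑ (λ s → coef eqB (h s) t) u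
    coef-bind u h t = ≈-trans (coef-as-∑ eqB (bind u h) t)
                        (≈-trans (Scalar.∑-bind (δ eqB t) u h) (Scalar.∑-cong u (λ s → ≈-sym (coef-as-∑ eqB (h s) t))))

    bind-congˡ : ∀ (u v : Lin A) (h : A → Lin B) → CoefEq eqA u v → CoefEq eqB (bind u h) (bind v h)
    bind-congˡ u v h e = coefwise λ t →
      ≈-trans (coef-bind u h t) (≈-trans (Scalar.∑-resp-coef eqA _ u v (λ s → inj₁ (e at s))) (≈-sym (coef-bind v h t)))

    bind-congʳ : ∀ (u : Lin A) {h h′ : A → Lin B} → (∀ s → CoefEq eqB (h s) (h′ s)) → CoefEq eqB (bind u h) (bind u h′)
    bind-congʳ u {h} {h′} e = coefwise λ t →
      ≈-trans (coef-bind u h t) (≈-trans (Scalar.∑-cong u (λ s → e s at t)) (≈-sym (coef-bind u h′ t)))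

    Decodable : (A → B) → Set
    Decodable f = ∀ b → (Σ A (λ a → f a ≡ b × (∀ t → f t ≡ b → t ≡ a))) ⊎ (∀ t → ¬ (f t ≡ b))

    coef-onTerms-preimage : ∀ (f : A → B) b a → f a ≡ b → (∀ t → f t ≡ b → t ≡ a) → (u : Lin A) →
                            coef eqB (onTerms f u) b ≈ coef eqA u a
    coef-onTerms-preimage f b a fa≡b inj [] = ≈-refl
    coef-onTerms-preimage f b a fa≡b inj ((x , s) ∷ u) with eqB (f s) b | eqA s a
    ... | yes _ | yes _ = +-congˡ (coef-onTerms-preimage f b a fa≡b inj u)
    ... | yes p | no s≢a = ⊥-elim (s≢a (inj s p))
    ... | no fs≢b | yes refl = ⊥-elim (fs≢b fa≡b)
    ... | no _ | no _ = coef-onTerms-preimage f b a fa≡b inj u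

    coef-onTerms-outside : ∀ (f : A → B) b → (∀ t → ¬ (f t ≡ b)) → (u : Lin A) → coef eqB (onTerms f u) b ≈ 0#
    coef-onTerms-outside f b n [] = ≈-refl
    coef-onTerms-outside f b n ((x , s) ∷ u) with eqB (f s) b
    ... | yes p = ⊥-elim (n s p)
    ... | no _ = coef-onTerms-outside f b n u

    onTerms-cong : ∀ (f : A → B) → Decodable f → ∀ {u v : Lin A} → CoefEq eqA u v → CoefEq eqB (onTerms f u) (onTerms f v)
    onTerms-cong f d {u} {v} e = coefwise pointwise
      where
        pointwise : ∀ b → coef eqB (onTerms f u) b ≈ coef eqB (onTerms f v) b
        pointwise b with d b
        ... | inj₁ (a , fa≡b , inj) = ≈-trans (coef-onTerms-preimage f b a fa≡b inj u)
                                        (≈-trans (e at a) (≈-sym (coef-onTerms-preimage f b a fa≡b inj v)))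
        ... | inj₂ n = ≈-trans (coef-onTerms-outside f b n u) (≈-sym (coef-onTerms-outside f b n v))

    onTerms-as-bind : ∀ (f : A → B) (u : Lin A) → CoefEq eqB (onTerms f u) (bind u (λ t → (1# , f t) ∷ []))
    onTerms-as-bind f u = coefwise (pointwise u)
      where
        pointwise : ∀ u b → coef eqB (onTerms f u) b ≈ coef eqB (bind u (λ t → (1# , f t) ∷ [])) b
        pointwise [] b = ≈-refl
        pointwise ((x , s) ∷ u) b with eqB (f s) b
        ... | yes _ = +-cong (≈-sym (*-identityʳ x)) (pointwise u b)
        ... | no _ = pointwise u b

    bind-onTerms : ∀ {C : Set} (f : A → B) (u : Lin A) (h : B → Lin C) → bind (onTerms f u) h ≡ bind u (λ t → h (f t))
    bind-onTerms f [] h = refl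
    bind-onTerms f ((x , s) ∷ u) h = cong (scale x (h (f s)) ++_) (bind-onTerms f u h)

    bind-++ʳ : ∀ (u : Lin A) (h h′ : A → Lin B) → CoefEq eqB (bind u (λ t → h t ++ h′ t)) (bind u h ++ bind u h′)
    bind-++ʳ u h h′ = coefwise λ b → begin
      coef eqB (bind u (λ t → h t ++ h′ t)) b ≈⟨ coef-bind u _ b ⟩
      Scalar.∑ (λ s → coef eqB (h s ++ h′ s) b) u ≈⟨ Scalar.∑-cong u (λ s → coef-++ eqB (h s) (h′ s) b) ⟩
      Scalar.∑ (λ s → coef eqB (h s) b + coef eqB (h′ s) b) u ≈⟨ Scalar.∑-+ᴹ _ _ u ⟩
      Scalar.∑ (λ s → coef eqB (h s) b) u + Scalar.∑ (λ s → coef eqB (h′ s) b) u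
         ≈⟨ +-cong (≈-sym (coef-bind u h b)) (≈-sym (coef-bind u h′ b)) ⟩
      coef eqB (bind u h) b + coef eqB (bind u h′) b ≈⟨ ≈-sym (coef-++ eqB (bind u h) (bind u h′) b) ⟩
      coef eqB (bind u h ++ bind u h′) b ∎

    bind-scaleʳ : ∀ (u : Lin A) s (h : A → Lin B) → CoefEq eqB (bind u (λ t → scale s (h t))) (scale s (bind u h))
    bind-scaleʳ u s h = coefwise λ b → begin
      coef eqB (bind u (λ t → scale s (h t))) b ≈⟨ coef-bind u _ b ⟩
      Scalar.∑ (λ t → coef eqB (scale s (h t)) b) u ≈⟨ Scalar.∑-cong u (λ t → coef-scale eqB s (h t) b) ⟩
      Scalar.∑ (λ t → s * coef eqB (h t) b) u ≈⟨ Scalar.∑-*ₗ _ s u ⟩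
      s * Scalar.∑ (λ t → coef eqB (h t) b) u ≈⟨ *-congˡ (≈-sym (coef-bind u h b)) ⟩
      s * coef eqB (bind u h) b ≈⟨ ≈-sym (coef-scale eqB s (bind u h) b) ⟩
      coef eqB (scale s (bind u h)) b ∎

    bind-scaleˡ : ∀ (u : Lin A) s (h : A → Lin B) → CoefEq eqB (bind (scale s u) h) (scale s (bind u h))
    bind-scaleˡ u s h = coefwise λ b → begin
      coef eqB (bind (scale s u) h) b ≈⟨ coef-bind (scale s u) h b ⟩
      Scalar.∑ (λ t → coef eqB (h t) b) (scale s u) ≈⟨ Scalar.∑-scale _ s u ⟩
      s * Scalar.∑ (λ t → coef eqB (h t) b) u ≈⟨ *-congˡ (≈-sym (coef-bind u h b)) ⟩
      s * coef eqB (bind u h) b ≈⟨ ≈-sym (coef-scale eqB s (bind u h) b) ⟩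
      coef eqB (scale s (bind u h)) b ∎

    bind-unitˡ : ∀ (t : A) (h : A → Lin B) → CoefEq eqB (bind ((1# , t) ∷ []) h) (h t)
    bind-unitˡ t h = coefwise λ b → ≈-trans (coef-bind ((1# , t) ∷ []) h b) (Scalar.∑-singleton (λ s → coef eqB (h s) b) t)

  bind-unitʳ : ∀ {A : Set} (eq : DecidableEquality A) (u : Lin A) → CoefEq eq (bind u (λ t → (1# , t) ∷ [])) u
  bind-unitʳ eq u = coefwise λ a →
    ≈-trans (coef-bind eq eq u (λ t → (1# , t) ∷ []) a) (≈-trans (Scalar.∑-cong u singleton-δ) (≈-sym (coef-as-∑ eq u a)))
    where
      singleton-δ : ∀ {a} s → coef eq ((1# , s) ∷ []) a ≈ δ eq a s
      singleton-δ {a} s with eq s a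
      ... | yes _ = +-identityʳ 1#
      ... | no _ = ≈-refl

  module _ {A B C : Set} (eqA : DecidableEquality A) (eqB : DecidableEquality B) (eqC : DecidableEquality C) where
    bind-assoc : ∀ (u : Lin A) (h : A → Lin B) (h′ : B → Lin C) →
                 CoefEq eqC (bind (bind u h) h′) (bind u (λ t → bind (h t) h′))
    bind-assoc u h h′ = coefwise λ c → begin
      coef eqC (bind (bind u h) h′) c ≈⟨ coef-bind eqB eqC (bind u h) h′ c ⟩
      Scalar.∑ (λ s → coef eqC (h′ s) c) (bind u h) ≈⟨ Scalar.∑-bind _ u h ⟩
      Scalar.∑ (λ t → Scalar.∑ (λ s → coef eqC (h′ s) c) (h t)) u
        ≈⟨ Scalar.∑-cong u (λ t → ≈-sym (coef-bind eqB eqC (h t) h′ c)) ⟩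
      Scalar.∑ (λ t → coef eqC (bind (h t) h′) c) u ≈⟨ ≈-sym (coef-bind eqA eqC u _ c) ⟩
      coef eqC (bind u (λ t → bind (h t) h′)) c ∎

    bind-swap : ∀ (u : Lin A) (v : Lin B) (g : A → B → Lin C) →
                CoefEq eqC (bind u (λ s → bind v (λ t → g s t))) (bind v (λ t → bind u (λ s → g s t)))
    bind-swap u v g = coefwise λ c → begin
      coef eqC (bind u (λ s → bind v (λ t → g s t))) c ≈⟨ coef-bind eqA eqC u _ c ⟩
      Scalar.∑ (λ s → coef eqC (bind v (λ t → g s t)) c) u ≈⟨ Scalar.∑-cong u (λ s → coef-bind eqB eqC v _ c) ⟩
      Scalar.∑ (λ s → Scalar.∑ (λ t → coef eqC (g s t) c) v) u ≈⟨ Scalar.∑-swap u v _ ⟩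
      Scalar.∑ (λ t → Scalar.∑ (λ s → coef eqC (g s t) c) u) v ≈⟨ Scalar.∑-cong v (λ t → ≈-sym (coef-bind eqA eqC u _ c)) ⟩
      Scalar.∑ (λ t → coef eqC (bind u (λ s → g s t)) c) v ≈⟨ ≈-sym (coef-bind eqB eqC v _ c) ⟩
      coef eqC (bind v (λ t → bind u (λ s → g s t))) c ∎

  onTerms-scale : ∀ {A B : Set} (f : A → B) s (u : Lin A) → onTerms f (scale s u) ≡ scale s (onTerms f u)
  onTerms-scale f s [] = refl
  onTerms-scale f s ((x , t) ∷ u) = cong ((s * x , f t) ∷_) (onTerms-scale f s u)

  onTerms-++ : ∀ {A B : Set} (f : A → B) (u v : Lin A) → onTerms f (u ++ v) ≡ onTerms f u ++ onTerms f v
  onTerms-++ f [] v = refl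
  onTerms-++ f ((x , t) ∷ u) v = cong ((x , f t) ∷_) (onTerms-++ f u v)

  onTerms-bind : ∀ {A B C : Set} (g : B → C) (u : Lin A) (h : A → Lin B) →
                 onTerms g (bind u h) ≡ bind u (λ t → onTerms g (h t))
  onTerms-bind g [] h = refl
  onTerms-bind g ((x , t) ∷ u) h = trans (onTerms-++ g (scale x (h t)) (bind u h))
                                     (cong₂ _++_ (onTerms-scale g x (h t)) (onTerms-bind g u h))

  onTerms-∘ : ∀ {A B C : Set} (g : B → C) (f : A → B) (u : Lin A) → onTerms g (onTerms f u) ≡ onTerms (λ t → g (f t)) u
  onTerms-∘ g f [] = refl
  onTerms-∘ g f ((x , t) ∷ u) = cong ((x , g (f t)) ∷_) (onTerms-∘ g f u)

  onTerms-cong-≡ : ∀ {A B : Set} {g f : A → B} (u : Lin A) → (∀ t → g t ≡ f t) → onTerms g u ≡ onTerms f u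
  onTerms-cong-≡ [] e = refl
  onTerms-cong-≡ ((x , t) ∷ u) e = cong₂ (λ a b → (x , a) ∷ b) (e t) (onTerms-cong-≡ u e)

  onTerms-square : ∀ {A B C D : Set} {f : A → B} {g : B → D} {g′ : A → C} {f′ : C → D} →
                   (∀ t → g (f t) ≡ f′ (g′ t)) → ∀ u → onTerms g (onTerms f u) ≡ onTerms f′ (onTerms g′ u)
  onTerms-square {f = f} {g} {g′} {f′} e u = trans (onTerms-∘ g f u) (trans (onTerms-cong-≡ u e) (sym (onTerms-∘ f′ g′ u)))

  onTerms-id : ∀ {A : Set} (u : Lin A) → onTerms (λ x → x) u ≡ u
  onTerms-id [] = refl
  onTerms-id ((a , t) ∷ u) = cong ((a , t) ∷_) (onTerms-id u)

  bind-++ˡ : ∀ {A B : Set} (u v : Lin A) (h : A → Lin B) → bind (u ++ v) h ≡ bind u h ++ bind v h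
  bind-++ˡ [] v h = refl
  bind-++ˡ ((x , t) ∷ u) v h = trans (cong (scale x (h t) ++_) (bind-++ˡ u v h))
                                 (sym (++-assoc (scale x (h t)) (bind u h) (bind v h)))

  bind-cong-≡ : ∀ {A B : Set} (u : Lin A) {h h′ : A → Lin B} → (∀ t → h t ≡ h′ t) → bind u h ≡ bind u h′
  bind-cong-≡ [] e = refl
  bind-cong-≡ ((a , t) ∷ u) e = cong₂ (λ p q → scale a p ++ q) (e t) (bind-cong-≡ u e)

  AllTerms : ∀ {p} {A : Set} → (A → Set p) → Lin A → Set (c ⊔ p)
  AllTerms P = All (λ e → P (proj₂ e))

  AllTerms-map : ∀ {p q} {A : Set} {P : A → Set p} {Q : A → Set q} → (∀ {a} → P a → Q a) → ∀ {u} → AllTerms P u → AllTerms Q u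
  AllTerms-map h = All.map h

  AllTerms-onTerms : ∀ {p q} {A B : Set} {P : A → Set p} {Q : B → Set q} (f : A → B) → (∀ {a} → P a → Q (f a)) →
                     ∀ {u} → AllTerms P u → AllTerms Q (onTerms f u)
  AllTerms-onTerms f h ps = AllP.map⁺ (All.map h ps)

  AllTerms-onTerms⁻ : ∀ {q} {A B : Set} {Q : B → Set q} (f : A → B) {u : Lin A} → AllTerms Q (onTerms f u) → AllTerms (λ a → Q (f a)) u
  AllTerms-onTerms⁻ f = AllP.map⁻

  AllTerms-scale : ∀ {p} {A : Set} {P : A → Set p} s {u : Lin A} → AllTerms P u → AllTerms P (scale s u)
  AllTerms-scale s = AllP.map⁺

  AllTerms-bind : ∀ {p} {A B : Set} {P : B → Set p} (u : Lin A) (h : A → Lin B) → (∀ a → AllTerms P (h a)) → AllTerms P (bind u h)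
  AllTerms-bind [] h q = []
  AllTerms-bind ((x , a) ∷ u) h q = AllP.++⁺ (AllTerms-scale x (q a)) (AllTerms-bind u h q)

  coef-absent : ∀ {A : Set} (eq : DecidableEquality A) (u : Lin A) t → AllTerms (λ s → ¬ (s ≡ t)) u → coef eq u t ≈ 0#
  coef-absent eq [] t _ = ≈-refl
  coef-absent eq ((x , s) ∷ u) t (s≢t ∷ ps) with eq s t
  ... | yes s≡t = ⊥-elim (s≢t s≡t)
  ... | no _ = coef-absent eq u t ps

module ForestProduct {c ℓ} (K : Field c ℓ) (w : Field.Carrier K) {L : Set} (eq : DecidableEquality L) where

  open Field K renaming (Carrier to k; refl to ≈-refl; sym to ≈-sym; trans to ≈-trans)
  open ADF K w using (Lin; onTerms; scale; _⋄ᵀ_; tf; ft; ff)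
  open LinearCombination K

  eqT : DecidableEquality (Tree L)
  eqT = _≟ᵀ_ eq
  eqF : DecidableEquality (Forest L)
  eqF = _≟ᶠ_ eq

  B⁺-decodable : Decodable eqF eqT B⁺
  B⁺-decodable • = inj₂ (λ t ())
  B⁺-decodable (B⁺ A) = inj₁ (A , refl , λ { t refl → refl })

  [-]-decodable : Decodable eqT eqF [_]
  [-]-decodable [ T ] = inj₁ (T , refl , λ { t refl → refl })
  [-]-decodable (T ⟨ x ⟩ F) = inj₂ (λ t ())

  cons-decodable : ∀ T x → Decodable eqF eqF (T ⟨ x ⟩_)
  cons-decodable T x [ U ] = inj₂ (λ t ())
  cons-decodable T x (U ⟨ y ⟩ G) with eqT U T | eq y x
  ... | yes refl | yes refl = inj₁ (G , refl , λ { t refl → refl })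
  ... | no ¬p | _ = inj₂ (λ { t refl → ¬p refl })
  ... | yes _ | no ¬p = inj₂ (λ { t refl → ¬p refl })

  head-decodable : ∀ y G → Decodable eqT eqF (_⟨ y ⟩ G)
  head-decodable y G [ U ] = inj₂ (λ t ())
  head-decodable y G (U ⟨ y′ ⟩ G′) with eq y′ y | eqF G′ G
  ... | yes refl | yes refl = inj₁ (U , refl , λ { t refl → refl })
  ... | no ¬p | _ = inj₂ (λ { t refl → ¬p refl })
  ... | yes _ | no ¬p = inj₂ (λ { t refl → ¬p refl })

  [B⁺]-decodable : Decodable eqF eqF (λ C → [ B⁺ C ])
  [B⁺]-decodable [ • ] = inj₂ (λ t ())
  [B⁺]-decodable [ B⁺ A ] = inj₁ (A , refl , λ { t refl → refl })
  [B⁺]-decodable (T ⟨ x ⟩ F) = inj₂ (λ t ())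

  ft≡ff : ∀ (F : Forest L) (T : Tree L) → ft F T ≡ ff F [ T ]
  ft≡ff [ U ] T = refl
  ft≡ff (U ⟨ x ⟩ F) T = cong (onTerms (U ⟨ x ⟩_)) (ft≡ff F T)

  ⋄ᵀ-• : ∀ (U : Tree L) → U ⋄ᵀ • ≡ (1# , U) ∷ []
  ⋄ᵀ-• • = refl
  ⋄ᵀ-• (B⁺ A) = refl

  ffˡ : Lin (Forest L) → Forest L → Lin (Forest L)
  ffˡ u H = bind u (λ E → ff E H)
  ffʳ : Forest L → Lin (Forest L) → Lin (Forest L)
  ffʳ F v = bind v (λ E → ff F E)

  Assoc : Forest L → Forest L → Forest L → Set ℓ
  Assoc F G H = CoefEq eqF (ffˡ (ff F G) H) (ffʳ F (ff G H))

  Assocᵀ : Tree L → Tree L → Tree L → Set ℓ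
  Assocᵀ T T′ T″ = CoefEq eqT (bind (T ⋄ᵀ T′) (λ U → U ⋄ᵀ T″)) (bind (T′ ⋄ᵀ T″) (λ U → T ⋄ᵀ U))

  assoc-cons : ∀ (T : Tree L) x (F G H : Forest L) → Assoc F G H → Assoc (T ⟨ x ⟩ F) G H
  assoc-cons T x F G H ih = begin
      ffˡ (ff (T ⟨ x ⟩ F) G) H ≡⟨ bind-onTerms eqF eqF (T ⟨ x ⟩_) (ff F G) (λ E → ff E H) ⟩
      bind (ff F G) (λ E → onTerms (T ⟨ x ⟩_) (ff E H)) ≡⟨ sym (onTerms-bind (T ⟨ x ⟩_) (ff F G) (λ E → ff E H)) ⟩
      onTerms (T ⟨ x ⟩_) (ffˡ (ff F G) H) ≈⟨ onTerms-cong eqF eqF (T ⟨ x ⟩_) (cons-decodable T x) ih ⟩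
      onTerms (T ⟨ x ⟩_) (ffʳ F (ff G H)) ≡⟨ onTerms-bind (T ⟨ x ⟩_) (ff G H) (λ E → ff F E) ⟩
      ffʳ (T ⟨ x ⟩ F) (ff G H) ∎
    where open SR (CoefEq-setoid eqF)

  assoc-tree-cons : ∀ (T T′ : Tree L) y (G′ H : Forest L) → Assoc [ T ] (T′ ⟨ y ⟩ G′) H
  assoc-tree-cons T T′ y G′ H = begin
      ffˡ (ff [ T ] (T′ ⟨ y ⟩ G′)) H ≡⟨ bind-onTerms eqT eqF (_⟨ y ⟩ G′) (T ⋄ᵀ T′) (λ E → ff E H) ⟩
      bind (T ⋄ᵀ T′) (λ U → onTerms (U ⟨ y ⟩_) (ff G′ H))
         ≈⟨ bind-congʳ eqT eqF (T ⋄ᵀ T′) (λ U → onTerms-as-bind eqF eqF (U ⟨ y ⟩_) (ff G′ H)) ⟩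
      bind (T ⋄ᵀ T′) (λ U → bind (ff G′ H) (λ C → (1# , U ⟨ y ⟩ C) ∷ []))
         ≈⟨ bind-swap eqT eqF eqF (T ⋄ᵀ T′) (ff G′ H) (λ U C → (1# , U ⟨ y ⟩ C) ∷ []) ⟩
      bind (ff G′ H) (λ C → bind (T ⋄ᵀ T′) (λ U → (1# , U ⟨ y ⟩ C) ∷ []))
         ≈˘⟨ bind-congʳ eqF eqF (ff G′ H) (λ C → onTerms-as-bind eqT eqF (_⟨ y ⟩ C) (T ⋄ᵀ T′)) ⟩
      bind (ff G′ H) (λ C → onTerms (_⟨ y ⟩ C) (T ⋄ᵀ T′))
         ≡˘⟨ bind-onTerms eqF eqF (T′ ⟨ y ⟩_) (ff G′ H) (λ E → ff [ T ] E) ⟩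
      ffʳ [ T ] (ff (T′ ⟨ y ⟩ G′) H) ∎
    where open SR (CoefEq-setoid eqF)

  assocᵀ-in-context : ∀ (T T′ T″ : Tree L) (f : Tree L → Forest L) → Decodable eqT eqF f →
           Assocᵀ T T′ T″ →
           CoefEq eqF (bind (T ⋄ᵀ T′) (λ U → onTerms f (U ⋄ᵀ T″))) (bind (T′ ⋄ᵀ T″) (λ U → onTerms f (T ⋄ᵀ U)))
  assocᵀ-in-context T T′ T″ f d ih = begin
      bind (T ⋄ᵀ T′) (λ U → onTerms f (U ⋄ᵀ T″)) ≡˘⟨ onTerms-bind f (T ⋄ᵀ T′) (λ U → U ⋄ᵀ T″) ⟩
      onTerms f (bind (T ⋄ᵀ T′) (λ U → U ⋄ᵀ T″)) ≈⟨ onTerms-cong eqT eqF f d ih ⟩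
      onTerms f (bind (T′ ⋄ᵀ T″) (λ U → T ⋄ᵀ U)) ≡⟨ onTerms-bind f (T′ ⋄ᵀ T″) (λ U → T ⋄ᵀ U) ⟩
      bind (T′ ⋄ᵀ T″) (λ U → onTerms f (T ⋄ᵀ U)) ∎
    where open SR (CoefEq-setoid eqF)

  assoc-trees : ∀ (T T′ T″ : Tree L) → Assocᵀ T T′ T″ → Assoc [ T ] [ T′ ] [ T″ ]
  assoc-trees T T′ T″ ih = begin
      ffˡ (ff [ T ] [ T′ ]) [ T″ ] ≡⟨ bind-onTerms eqT eqF [_] (T ⋄ᵀ T′) (λ E → ff E [ T″ ]) ⟩
      bind (T ⋄ᵀ T′) (λ U → onTerms [_] (U ⋄ᵀ T″)) ≈⟨ assocᵀ-in-context T T′ T″ [_] [-]-decodable ih ⟩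
      bind (T′ ⋄ᵀ T″) (λ U → onTerms [_] (T ⋄ᵀ U)) ≡˘⟨ bind-onTerms eqT eqF [_] (T′ ⋄ᵀ T″) (λ E → ff [ T ] E) ⟩
      ffʳ [ T ] (ff [ T′ ] [ T″ ]) ∎
    where open SR (CoefEq-setoid eqF)

  assoc-trees-cons : ∀ (T T′ T″ : Tree L) z (H′ : Forest L) → Assocᵀ T T′ T″ → Assoc [ T ] [ T′ ] (T″ ⟨ z ⟩ H′)
  assoc-trees-cons T T′ T″ z H′ ih = begin
      ffˡ (ff [ T ] [ T′ ]) (T″ ⟨ z ⟩ H′) ≡⟨ bind-onTerms eqT eqF [_] (T ⋄ᵀ T′) (λ E → ff E (T″ ⟨ z ⟩ H′)) ⟩
      bind (T ⋄ᵀ T′) (λ U → onTerms (_⟨ z ⟩ H′) (U ⋄ᵀ T″)) ≈⟨ assocᵀ-in-context T T′ T″ (_⟨ z ⟩ H′) (head-decodable z H′) ih ⟩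
      bind (T′ ⋄ᵀ T″) (λ U → onTerms (_⟨ z ⟩ H′) (T ⋄ᵀ U))
         ≡˘⟨ bind-onTerms eqT eqF (_⟨ z ⟩ H′) (T′ ⋄ᵀ T″) (λ E → ff [ T ] E) ⟩
      ffʳ [ T ] (ff [ T′ ] (T″ ⟨ z ⟩ H′)) ∎
    where open SR (CoefEq-setoid eqF)

  assocᵀ-• : ∀ (T′ T″ : Tree L) → Assocᵀ • T′ T″
  assocᵀ-• T′ T″ = begin
      bind (• ⋄ᵀ T′) (λ U → U ⋄ᵀ T″) ≈⟨ bind-unitˡ eqT eqT T′ (λ U → U ⋄ᵀ T″) ⟩
      T′ ⋄ᵀ T″ ≈˘⟨ bind-unitʳ eqT (T′ ⋄ᵀ T″) ⟩
      bind (T′ ⋄ᵀ T″) (λ U → • ⋄ᵀ U) ∎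
    where open SR (CoefEq-setoid eqT)

  assocᵀ-B⁺-• : ∀ (A : Forest L) (T″ : Tree L) → Assocᵀ (B⁺ A) • T″
  assocᵀ-B⁺-• A T″ = begin
      bind (B⁺ A ⋄ᵀ •) (λ U → U ⋄ᵀ T″) ≈⟨ bind-unitˡ eqT eqT (B⁺ A) (λ U → U ⋄ᵀ T″) ⟩
      B⁺ A ⋄ᵀ T″ ≈˘⟨ bind-unitˡ eqT eqT T″ (λ U → B⁺ A ⋄ᵀ U) ⟩
      bind (• ⋄ᵀ T″) (λ U → B⁺ A ⋄ᵀ U) ∎
    where open SR (CoefEq-setoid eqT)

  assocᵀ-B⁺-B⁺-• : ∀ (A A′ : Forest L) → Assocᵀ (B⁺ A) (B⁺ A′) •
  assocᵀ-B⁺-B⁺-• A A′ = begin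
      bind (B⁺ A ⋄ᵀ B⁺ A′) (λ U → U ⋄ᵀ •) ≈⟨ bind-congʳ eqT eqT (B⁺ A ⋄ᵀ B⁺ A′) (λ U → ≡⇒CoefEq eqT (⋄ᵀ-• U)) ⟩
      bind (B⁺ A ⋄ᵀ B⁺ A′) (λ U → (1# , U) ∷ []) ≈⟨ bind-unitʳ eqT (B⁺ A ⋄ᵀ B⁺ A′) ⟩
      B⁺ A ⋄ᵀ B⁺ A′ ≈˘⟨ bind-unitˡ eqT eqT (B⁺ A′) (λ U → B⁺ A ⋄ᵀ U) ⟩
      bind (B⁺ A′ ⋄ᵀ •) (λ U → B⁺ A ⋄ᵀ U) ∎
    where open SR (CoefEq-setoid eqT)

  rbTerms : ∀ {A : Set} → Lin A → Lin A → Lin A → Lin A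
  rbTerms X Y Z = X ++ (Y ++ scale w Z)

  coef-rbTerms : ∀ {A : Set} (eqA : DecidableEquality A) (X Y Z : Lin A) t →
         coef eqA (rbTerms X Y Z) t ≈ coef eqA X t + (coef eqA Y t + w * coef eqA Z t)
  coef-rbTerms eqA X Y Z t = ≈-trans (coef-++ eqA X _ t) (+-congˡ (≈-trans (coef-++ eqA Y _ t) (+-congˡ (coef-scale eqA w Z t))))

  rbTerms-cong : ∀ {A : Set} (eqA : DecidableEquality A) {X X′ Y Y′ Z Z′ : Lin A} →
            CoefEq eqA X X′ → CoefEq eqA Y Y′ → CoefEq eqA Z Z′ → CoefEq eqA (rbTerms X Y Z) (rbTerms X′ Y′ Z′)
  rbTerms-cong eqA e1 e2 e3 = ++-cong eqA e1 (++-cong eqA e2 (scale-cong eqA w e3))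

  module _ {A B : Set} (eqA : DecidableEquality A) (eqB : DecidableEquality B) where
    bind-rbTermsˡ : ∀ (X Y Z : Lin A) (h : A → Lin B) → CoefEq eqB (bind (rbTerms X Y Z) h) (rbTerms (bind X h) (bind Y h) (bind Z h))
    bind-rbTermsˡ X Y Z h = begin
      bind (X ++ (Y ++ scale w Z)) h ≡⟨ bind-++ˡ X _ h ⟩
      bind X h ++ bind (Y ++ scale w Z) h ≡⟨ cong (bind X h ++_) (bind-++ˡ Y _ h) ⟩
      bind X h ++ (bind Y h ++ bind (scale w Z) h)
        ≈⟨ ++-cong eqB {bind X h} (CoefEq-refl eqB) (++-cong eqB {bind Y h} (CoefEq-refl eqB) (bind-scaleˡ eqA eqB Z w h)) ⟩
      rbTerms (bind X h) (bind Y h) (bind Z h) ∎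
      where open SR (CoefEq-setoid eqB)

    bind-rbTermsʳ : ∀ (u : Lin A) (h1 h2 h3 : A → Lin B) →
               CoefEq eqB (bind u (λ C → rbTerms (h1 C) (h2 C) (h3 C))) (rbTerms (bind u h1) (bind u h2) (bind u h3))
    bind-rbTermsʳ u h1 h2 h3 = begin
      bind u (λ C → h1 C ++ (h2 C ++ scale w (h3 C))) ≈⟨ bind-++ʳ eqA eqB u h1 _ ⟩
      bind u h1 ++ bind u (λ C → h2 C ++ scale w (h3 C))
        ≈⟨ ++-cong eqB {bind u h1} (CoefEq-refl eqB) (bind-++ʳ eqA eqB u h2 _) ⟩
      bind u h1 ++ (bind u h2 ++ bind u (λ C → scale w (h3 C)))
        ≈⟨ ++-cong eqB {bind u h1} (CoefEq-refl eqB) (++-cong eqB {bind u h2} (CoefEq-refl eqB) (bind-scaleʳ eqA eqB u w h3)) ⟩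
      rbTerms (bind u h1) (bind u h2) (bind u h3) ∎
      where open SR (CoefEq-setoid eqB)

  rbExpansion : Forest L → Forest L → Lin (Forest L)
  rbExpansion A A′ = rbTerms (ff [ B⁺ A ] A′) (ff A [ B⁺ A′ ]) (ff A A′)

  B⁺⋄ᵀB⁺ : ∀ (A A′ : Forest L) → B⁺ A ⋄ᵀ B⁺ A′ ≡ onTerms B⁺ (rbExpansion A A′)
  B⁺⋄ᵀB⁺ A A′ = sym (trans (onTerms-++ B⁺ (ff [ B⁺ A ] A′) _)
                 (cong (onTerms B⁺ (ff [ B⁺ A ] A′) ++_)
                   (trans (onTerms-++ B⁺ (ff A [ B⁺ A′ ]) _)
                     (cong₂ _++_ (cong (onTerms B⁺) (sym (ft≡ff A (B⁺ A′))))
                        (onTerms-scale B⁺ w (ff A A′))))))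

  [B⁺]⋄[B⁺] : ∀ (A A′ : Forest L) → ff [ B⁺ A ] [ B⁺ A′ ] ≡ onTerms (λ C → [ B⁺ C ]) (rbExpansion A A′)
  [B⁺]⋄[B⁺] A A′ = trans (cong (onTerms [_]) (B⁺⋄ᵀB⁺ A A′)) (onTerms-∘ [_] B⁺ (rbExpansion A A′))

  module Solver = NR (fromCommutativeRing commutativeRing (λ _ → nothing))

  rbTerms-regroup : ∀ {A : Set} (eqA : DecidableEquality A) (a₁ a₂ a₃ a₄ a₅ a₆ a₇ : Lin A) →
                    CoefEq eqA (rbTerms a₁ (rbTerms a₂ a₃ a₄) (rbTerms a₅ a₆ a₇)) (rbTerms (rbTerms a₁ a₂ a₅) a₃ (rbTerms a₆ a₄ a₇))
  rbTerms-regroup eqA a₁ a₂ a₃ a₄ a₅ a₆ a₇ = coefwise λ t → begin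
      coef eqA (rbTerms a₁ (rbTerms a₂ a₃ a₄) (rbTerms a₅ a₆ a₇)) t
        ≈⟨ ≈-trans (coef-rbTerms eqA a₁ (rbTerms a₂ a₃ a₄) (rbTerms a₅ a₆ a₇) t) (+-congˡ (+-cong (coef-rbTerms eqA a₂ a₃ a₄ t) (*-congˡ (coef-rbTerms eqA a₅ a₆ a₇ t)))) ⟩
      γ a₁ t + ((γ a₂ t + (γ a₃ t + w * γ a₄ t)) + w * (γ a₅ t + (γ a₆ t + w * γ a₇ t)))
        ≈⟨ scalars w (γ a₁ t) (γ a₂ t) (γ a₃ t) (γ a₄ t) (γ a₅ t) (γ a₆ t) (γ a₇ t) ⟩
      (γ a₁ t + (γ a₂ t + w * γ a₅ t)) + (γ a₃ t + w * (γ a₆ t + (γ a₄ t + w * γ a₇ t)))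
        ≈˘⟨ ≈-trans (coef-rbTerms eqA (rbTerms a₁ a₂ a₅) a₃ (rbTerms a₆ a₄ a₇) t) (+-cong (coef-rbTerms eqA a₁ a₂ a₅ t) (+-congˡ (*-congˡ (coef-rbTerms eqA a₆ a₄ a₇ t)))) ⟩
      coef eqA (rbTerms (rbTerms a₁ a₂ a₅) a₃ (rbTerms a₆ a₄ a₇)) t ∎
    where
      open SR setoid
      γ = coef eqA
      open Solver using (_⊕_; _⊗_; _⊜_)
      scalars : ∀ (x b₁ b₂ b₃ b₄ b₅ b₆ b₇ : k) →
                b₁ + ((b₂ + (b₃ + x * b₄)) + x * (b₅ + (b₆ + x * b₇))) ≈ (b₁ + (b₂ + x * b₅)) + (b₃ + x * (b₆ + (b₄ + x * b₇)))
      scalars = Solver.solve 8 (λ x b₁ b₂ b₃ b₄ b₅ b₆ b₇ →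
        (b₁ ⊕ ((b₂ ⊕ (b₃ ⊕ (x ⊗ b₄))) ⊕ (x ⊗ (b₅ ⊕ (b₆ ⊕ (x ⊗ b₇))))))
          ⊜ ((b₁ ⊕ (b₂ ⊕ (x ⊗ b₅))) ⊕ (b₃ ⊕ (x ⊗ (b₆ ⊕ (b₄ ⊕ (x ⊗ b₇))))))) ≈-refl

  B⁺⋄ᵀB⁺⋄ᵀB⁺ˡ : ∀ (A A′ A″ : Forest L) →
                bind (B⁺ A ⋄ᵀ B⁺ A′) (λ U → U ⋄ᵀ B⁺ A″) ≡ onTerms B⁺ (bind (rbExpansion A A′) (λ C → rbExpansion C A″))
  B⁺⋄ᵀB⁺⋄ᵀB⁺ˡ A A′ A″ = begin
      bind (B⁺ A ⋄ᵀ B⁺ A′) (λ U → U ⋄ᵀ B⁺ A″) ≡⟨ cong (λ z → bind z (λ U → U ⋄ᵀ B⁺ A″)) (B⁺⋄ᵀB⁺ A A′) ⟩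
      bind (onTerms B⁺ (rbExpansion A A′)) (λ U → U ⋄ᵀ B⁺ A″) ≡⟨ bind-onTerms eqF eqT B⁺ (rbExpansion A A′) (λ U → U ⋄ᵀ B⁺ A″) ⟩
      bind (rbExpansion A A′) (λ C → B⁺ C ⋄ᵀ B⁺ A″) ≡⟨ bind-cong-≡ (rbExpansion A A′) (λ C → B⁺⋄ᵀB⁺ C A″) ⟩
      bind (rbExpansion A A′) (λ C → onTerms B⁺ (rbExpansion C A″)) ≡˘⟨ onTerms-bind B⁺ (rbExpansion A A′) (λ C → rbExpansion C A″) ⟩
      onTerms B⁺ (bind (rbExpansion A A′) (λ C → rbExpansion C A″)) ∎
    where open P.≡-Reasoning

  B⁺⋄ᵀB⁺⋄ᵀB⁺ʳ : ∀ (A A′ A″ : Forest L) →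
                bind (B⁺ A′ ⋄ᵀ B⁺ A″) (λ U → B⁺ A ⋄ᵀ U) ≡ onTerms B⁺ (bind (rbExpansion A′ A″) (λ C → rbExpansion A C))
  B⁺⋄ᵀB⁺⋄ᵀB⁺ʳ A A′ A″ = begin
      bind (B⁺ A′ ⋄ᵀ B⁺ A″) (λ U → B⁺ A ⋄ᵀ U) ≡⟨ cong (λ z → bind z (λ U → B⁺ A ⋄ᵀ U)) (B⁺⋄ᵀB⁺ A′ A″) ⟩
      bind (onTerms B⁺ (rbExpansion A′ A″)) (λ U → B⁺ A ⋄ᵀ U) ≡⟨ bind-onTerms eqF eqT B⁺ (rbExpansion A′ A″) (λ U → B⁺ A ⋄ᵀ U) ⟩
      bind (rbExpansion A′ A″) (λ C → B⁺ A ⋄ᵀ B⁺ C) ≡⟨ bind-cong-≡ (rbExpansion A′ A″) (λ C → B⁺⋄ᵀB⁺ A C) ⟩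
      bind (rbExpansion A′ A″) (λ C → onTerms B⁺ (rbExpansion A C)) ≡˘⟨ onTerms-bind B⁺ (rbExpansion A′ A″) (λ C → rbExpansion A C) ⟩
      onTerms B⁺ (bind (rbExpansion A′ A″) (λ C → rbExpansion A C)) ∎
    where open P.≡-Reasoning

  rbExpansion-bindˡ : ∀ (A A′ A″ : Forest L) →
    CoefEq eqF (bind (rbExpansion A A′) (λ C → rbExpansion C A″))
               (rbTerms (ffˡ (ff [ B⁺ A ] [ B⁺ A′ ]) A″)
                        (rbTerms (ffˡ (ff [ B⁺ A ] A′) [ B⁺ A″ ]) (ffˡ (ff A [ B⁺ A′ ]) [ B⁺ A″ ]) (ffˡ (ff A A′) [ B⁺ A″ ]))
                        (rbTerms (ffˡ (ff [ B⁺ A ] A′) A″) (ffˡ (ff A [ B⁺ A′ ]) A″) (ffˡ (ff A A′) A″)))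
  rbExpansion-bindˡ A A′ A″ = begin
      bind (rbExpansion A A′) (λ C → rbExpansion C A″)
        ≈⟨ bind-rbTermsʳ eqF eqF (rbExpansion A A′) (λ C → ff [ B⁺ C ] A″) (λ C → ff C [ B⁺ A″ ]) (λ C → ff C A″) ⟩
      rbTerms (bind (rbExpansion A A′) (λ C → ff [ B⁺ C ] A″)) (ffˡ (rbExpansion A A′) [ B⁺ A″ ]) (ffˡ (rbExpansion A A′) A″)
        ≈⟨ rbTerms-cong eqF (≡⇒CoefEq eqF grafted) (bind-rbTermsˡ eqF eqF (ff [ B⁺ A ] A′) (ff A [ B⁺ A′ ]) (ff A A′) (λ E → ff E [ B⁺ A″ ]))
                            (bind-rbTermsˡ eqF eqF (ff [ B⁺ A ] A′) (ff A [ B⁺ A′ ]) (ff A A′) (λ E → ff E A″)) ⟩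
      _ ∎
    where
      open SR (CoefEq-setoid eqF)
      grafted : bind (rbExpansion A A′) (λ C → ff [ B⁺ C ] A″) ≡ ffˡ (ff [ B⁺ A ] [ B⁺ A′ ]) A″
      grafted = trans (sym (bind-onTerms eqF eqF (λ C → [ B⁺ C ]) (rbExpansion A A′) (λ E → ff E A″)))
                      (cong (λ z → ffˡ z A″) (sym ([B⁺]⋄[B⁺] A A′)))

  rbExpansion-bindʳ : ∀ (A A′ A″ : Forest L) →
    CoefEq eqF (bind (rbExpansion A′ A″) (λ C → rbExpansion A C))
               (rbTerms (rbTerms (ffʳ [ B⁺ A ] (ff [ B⁺ A′ ] A″)) (ffʳ [ B⁺ A ] (ff A′ [ B⁺ A″ ])) (ffʳ [ B⁺ A ] (ff A′ A″)))
                        (ffʳ A (ff [ B⁺ A′ ] [ B⁺ A″ ]))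
                        (rbTerms (ffʳ A (ff [ B⁺ A′ ] A″)) (ffʳ A (ff A′ [ B⁺ A″ ])) (ffʳ A (ff A′ A″))))
  rbExpansion-bindʳ A A′ A″ = begin
      bind (rbExpansion A′ A″) (λ C → rbExpansion A C)
        ≈⟨ bind-rbTermsʳ eqF eqF (rbExpansion A′ A″) (λ C → ff [ B⁺ A ] C) (λ C → ff A [ B⁺ C ]) (λ C → ff A C) ⟩
      rbTerms (ffʳ [ B⁺ A ] (rbExpansion A′ A″)) (bind (rbExpansion A′ A″) (λ C → ff A [ B⁺ C ])) (ffʳ A (rbExpansion A′ A″))
        ≈⟨ rbTerms-cong eqF (bind-rbTermsˡ eqF eqF (ff [ B⁺ A′ ] A″) (ff A′ [ B⁺ A″ ]) (ff A′ A″) (λ E → ff [ B⁺ A ] E)) (≡⇒CoefEq eqF grafted)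
                            (bind-rbTermsˡ eqF eqF (ff [ B⁺ A′ ] A″) (ff A′ [ B⁺ A″ ]) (ff A′ A″) (λ E → ff A E)) ⟩
      _ ∎
    where
      open SR (CoefEq-setoid eqF)
      grafted : bind (rbExpansion A′ A″) (λ C → ff A [ B⁺ C ]) ≡ ffʳ A (ff [ B⁺ A′ ] [ B⁺ A″ ])
      grafted = trans (sym (bind-onTerms eqF eqF (λ C → [ B⁺ C ]) (rbExpansion A′ A″) (λ E → ff A E)))
                      (cong (ffʳ A) (sym ([B⁺]⋄[B⁺] A′ A″)))

  -- The seven hypotheses are associativity of the smaller triples met when
  -- both sides are expanded by the Rota–Baxter recursion of ⋄.
  assocᵀ-B⁺-B⁺-B⁺ : ∀ (A A′ A″ : Forest L) →
    Assoc [ B⁺ A ] [ B⁺ A′ ] A″ → Assoc [ B⁺ A ] A′ [ B⁺ A″ ] → Assoc A [ B⁺ A′ ] [ B⁺ A″ ] →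
    Assoc A A′ [ B⁺ A″ ] → Assoc [ B⁺ A ] A′ A″ → Assoc A [ B⁺ A′ ] A″ → Assoc A A′ A″ →
    Assocᵀ (B⁺ A) (B⁺ A′) (B⁺ A″)
  assocᵀ-B⁺-B⁺-B⁺ A A′ A″ ih₁ ih₂ ih₃ ih₄ ih₅ ih₆ ih₇ = begin
      bind (B⁺ A ⋄ᵀ B⁺ A′) (λ U → U ⋄ᵀ B⁺ A″) ≡⟨ B⁺⋄ᵀB⁺⋄ᵀB⁺ˡ A A′ A″ ⟩
      onTerms B⁺ (bind (rbExpansion A A′) (λ C → rbExpansion C A″)) ≈⟨ onTerms-cong eqF eqT B⁺ B⁺-decodable expansions ⟩
      onTerms B⁺ (bind (rbExpansion A′ A″) (λ C → rbExpansion A C)) ≡˘⟨ B⁺⋄ᵀB⁺⋄ᵀB⁺ʳ A A′ A″ ⟩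
      bind (B⁺ A′ ⋄ᵀ B⁺ A″) (λ U → B⁺ A ⋄ᵀ U) ∎
    where
      open SR (CoefEq-setoid eqT)
      expansions : CoefEq eqF (bind (rbExpansion A A′) (λ C → rbExpansion C A″)) (bind (rbExpansion A′ A″) (λ C → rbExpansion A C))
      expansions = CoefEq-trans eqF (rbExpansion-bindˡ A A′ A″)
                     (CoefEq-trans eqF (rbTerms-cong eqF ih₁ (rbTerms-cong eqF ih₂ ih₃ ih₄) (rbTerms-cong eqF ih₅ ih₆ ih₇))
                       (CoefEq-trans eqF (rbTerms-regroup eqF (ffʳ [ B⁺ A ] (ff [ B⁺ A′ ] A″)) (ffʳ [ B⁺ A ] (ff A′ [ B⁺ A″ ]))
                                                       (ffʳ A (ff [ B⁺ A′ ] [ B⁺ A″ ])) (ffʳ A (ff A′ [ B⁺ A″ ]))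
                                                       (ffʳ [ B⁺ A ] (ff A′ A″)) (ffʳ A (ff [ B⁺ A′ ] A″)) (ffʳ A (ff A′ A″)))
                         (CoefEq-sym eqF (rbExpansion-bindʳ A A′ A″))))

  -- The specialised copies of assoc make every recursive call structural.
  mutual
    assoc : ∀ (F G H : Forest L) → Assoc F G H
    assoc (T ⟨ x ⟩ F) G H = assoc-cons T x F G H (assoc F G H)
    assoc [ T ] G H = assoc-tree T G H

    assoc-tree : ∀ (T : Tree L) (G H : Forest L) → Assoc [ T ] G H
    assoc-tree T (T′ ⟨ y ⟩ G′) H = assoc-tree-cons T T′ y G′ H
    assoc-tree T [ T′ ] H = assoc-tree-tree T T′ H

    assoc-tree-tree : ∀ (T T′ : Tree L) (H : Forest L) → Assoc [ T ] [ T′ ] H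
    assoc-tree-tree T T′ [ T″ ] = assoc-trees T T′ T″ (assocᵀ T T′ T″)
    assoc-tree-tree T T′ (T″ ⟨ z ⟩ H′) = assoc-trees-cons T T′ T″ z H′ (assocᵀ T T′ T″)

    assoc-tree-forest-tree : ∀ (T : Tree L) (G : Forest L) (T″ : Tree L) → Assoc [ T ] G [ T″ ]
    assoc-tree-forest-tree T (T′ ⟨ y ⟩ G′) T″ = assoc-tree-cons T T′ y G′ [ T″ ]
    assoc-tree-forest-tree T [ T′ ] T″ = assoc-trees T T′ T″ (assocᵀ T T′ T″)

    assoc-forest-tree-tree : ∀ (F : Forest L) (T′ T″ : Tree L) → Assoc F [ T′ ] [ T″ ]
    assoc-forest-tree-tree (T ⟨ x ⟩ F) T′ T″ = assoc-cons T x F [ T′ ] [ T″ ] (assoc-forest-tree-tree F T′ T″)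
    assoc-forest-tree-tree [ T ] T′ T″ = assoc-trees T T′ T″ (assocᵀ T T′ T″)

    assoc-forest-forest-tree : ∀ (F G : Forest L) (T″ : Tree L) → Assoc F G [ T″ ]
    assoc-forest-forest-tree (T ⟨ x ⟩ F) G T″ = assoc-cons T x F G [ T″ ] (assoc-forest-forest-tree F G T″)
    assoc-forest-forest-tree [ T ] G T″ = assoc-tree-forest-tree T G T″

    assoc-forest-tree-forest : ∀ (F : Forest L) (T′ : Tree L) (H : Forest L) → Assoc F [ T′ ] H
    assoc-forest-tree-forest (T ⟨ x ⟩ F) T′ H = assoc-cons T x F [ T′ ] H (assoc-forest-tree-forest F T′ H)
    assoc-forest-tree-forest [ T ] T′ H = assoc-tree-tree T T′ H

    assocᵀ : ∀ (T T′ T″ : Tree L) → Assocᵀ T T′ T″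
    assocᵀ • T′ T″ = assocᵀ-• T′ T″
    assocᵀ (B⁺ A) • T″ = assocᵀ-B⁺-• A T″
    assocᵀ (B⁺ A) (B⁺ A′) • = assocᵀ-B⁺-B⁺-• A A′
    assocᵀ (B⁺ A) (B⁺ A′) (B⁺ A″) = assocᵀ-B⁺-B⁺-B⁺ A A′ A″
      (assoc-tree-tree (B⁺ A) (B⁺ A′) A″) (assoc-tree-forest-tree (B⁺ A) A′ (B⁺ A″)) (assoc-forest-tree-tree A (B⁺ A′) (B⁺ A″))
      (assoc-forest-forest-tree A A′ (B⁺ A″)) (assoc-tree (B⁺ A) A′ A″) (assoc-forest-tree-forest A (B⁺ A′) A″) (assoc A A′ A″)

module Decorations where

  mutual
    mapᵀ-cong : ∀ {L L′ : Set} {f g : L → L′} → (∀ x → f x ≡ g x) → ∀ T → mapᵀ f T ≡ mapᵀ g T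
    mapᵀ-cong e • = refl
    mapᵀ-cong e (B⁺ F) = cong B⁺ (mapᶠ-cong e F)

    mapᶠ-cong : ∀ {L L′ : Set} {f g : L → L′} → (∀ x → f x ≡ g x) → ∀ F → mapᶠ f F ≡ mapᶠ g F
    mapᶠ-cong e [ T ] = cong [_] (mapᵀ-cong e T)
    mapᶠ-cong e (T ⟨ x ⟩ F) = cong₂ (λ (U , y) G → U ⟨ y ⟩ G) (cong₂ _,_ (mapᵀ-cong e T) (e x)) (mapᶠ-cong e F)

  mutual
    mapᵀ-∘ : ∀ {L L′ L″ : Set} (f : L′ → L″) (g : L → L′) T → mapᵀ f (mapᵀ g T) ≡ mapᵀ (λ x → f (g x)) T
    mapᵀ-∘ f g • = refl
    mapᵀ-∘ f g (B⁺ F) = cong B⁺ (mapᶠ-∘ f g F)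

    mapᶠ-∘ : ∀ {L L′ L″ : Set} (f : L′ → L″) (g : L → L′) F → mapᶠ f (mapᶠ g F) ≡ mapᶠ (λ x → f (g x)) F
    mapᶠ-∘ f g [ T ] = cong [_] (mapᵀ-∘ f g T)
    mapᶠ-∘ f g (T ⟨ x ⟩ F) = cong₂ (λ a b → a ⟨ f (g x) ⟩ b) (mapᵀ-∘ f g T) (mapᶠ-∘ f g F)

  mutual
    mapᵀ-id : ∀ {L : Set} T → mapᵀ {L} (λ x → x) T ≡ T
    mapᵀ-id • = refl
    mapᵀ-id (B⁺ F) = cong B⁺ (mapᶠ-id F)

    mapᶠ-id : ∀ {L : Set} F → mapᶠ {L} (λ x → x) F ≡ F
    mapᶠ-id [ T ] = cong [_] (mapᵀ-id T)
    mapᶠ-id (T ⟨ x ⟩ F) = cong₂ (λ a b → a ⟨ x ⟩ b) (mapᵀ-id T) (mapᶠ-id F)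

  mapᶠ-inverse : ∀ {L L′ : Set} {f : L → L′} {g : L′ → L} → (∀ x → g (f x) ≡ x) → ∀ F → mapᶠ g (mapᶠ f F) ≡ F
  mapᶠ-inverse {f = f} {g} gf F = trans (mapᶠ-∘ g f F) (trans (mapᶠ-cong gf F) (mapᶠ-id F))

  mutual
    labelsᵀ-map : ∀ {L L′ : Set} (f : L → L′) T → labelsᵀ (mapᵀ f T) ≡ map f (labelsᵀ T)
    labelsᵀ-map f • = refl
    labelsᵀ-map f (B⁺ F) = labelsᶠ-map f F

    labelsᶠ-map : ∀ {L L′ : Set} (f : L → L′) F → labelsᶠ (mapᶠ f F) ≡ map f (labelsᶠ F)
    labelsᶠ-map f [ T ] = labelsᵀ-map f T
    labelsᶠ-map f (T ⟨ x ⟩ F) = trans (cong₂ (λ a b → a ++ (f x ∷ b)) (labelsᵀ-map f T) (labelsᶠ-map f F))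
                                      (sym (map-++ f (labelsᵀ T) (x ∷ labelsᶠ F)))

  symᵇ : ∀ {X Y} → X ≅ Y → Y ≅ X
  symᵇ σ = bij (↔-sym (iso σ))

  Enumerates : (X : FinSet) → List (Elt X) → Set
  Enumerates X ls = Unique ls × (∀ a → a ∈ ls)

  enumerates? : ∀ (X : FinSet) (ls : List (Elt X)) → Dec (Enumerates X ls)
  enumerates? X ls = UD.unique? (_≟ᴱ_ {X}) ls ×-dec
                     map′ (λ h a → subst (_∈ ls) (Inverse.strictlyInverseʳ (enum X) a) (h (Inverse.to (enum X) a)))
                          (λ h i → h (Inverse.from (enum X) i))
                          (all? (λ i → MD._∈?_ (_≟ᴱ_ {X}) (Inverse.from (enum X) i) ls))

  bijective? : ∀ {X : FinSet} (F : Forest (Elt X)) → Dec (Bijective {X} F)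
  bijective? {X} F = enumerates? X (labelsᶠ F)

  unique-++⁻ : ∀ {A : Set} (xs ys : List A) → Unique (xs ++ ys) → Unique xs × Unique ys
  unique-++⁻ [] ys u = [] , u
  unique-++⁻ (x ∷ xs) ys (p ∷ u) = (AllP.++⁻ˡ xs p ∷ proj₁ (unique-++⁻ xs ys u)) , proj₂ (unique-++⁻ xs ys u)

  inj₁-inj₂-disjoint : ∀ {A B : Set} (xs : List A) (ys : List B) → ∀ {v} → ¬ (v ∈ map inj₁ xs × v ∈ map inj₂ ys)
  inj₁-inj₂-disjoint xs ys (p , q) with ∈-map⁻ inj₁ p | ∈-map⁻ inj₂ q
  ... | (a , _ , refl) | (b , _ , ())

  enumerates-split : ∀ (X Y : FinSet) (xs : List (Elt X)) (ys : List (Elt Y)) →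
                     Enumerates (X ⊎ˢ Y) (map inj₁ xs ++ map inj₂ ys) → Enumerates X xs × Enumerates Y ys
  enumerates-split X Y xs ys (u , c) =
    (UP.map⁻ (proj₁ (unique-++⁻ (map inj₁ xs) _ u)) , λ a → left a (∈-++⁻ (map inj₁ xs) (c (inj₁ a)))) ,
    (UP.map⁻ (proj₂ (unique-++⁻ (map inj₁ xs) _ u)) , λ b → right b (∈-++⁻ (map inj₁ xs) (c (inj₂ b))))
    where
      left : ∀ a → (inj₁ a ∈ map inj₁ xs) ⊎ (inj₁ a ∈ map inj₂ ys) → a ∈ xs
      left a (inj₁ p) with ∈-map⁻ inj₁ p
      ... | (a′ , q , refl) = q
      left a (inj₂ p) with ∈-map⁻ inj₂ p
      ... | (_ , _ , ())
      right : ∀ b → (inj₂ b ∈ map inj₁ xs) ⊎ (inj₂ b ∈ map inj₂ ys) → b ∈ ys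
      right b (inj₁ p) with ∈-map⁻ inj₁ p
      ... | (_ , _ , ())
      right b (inj₂ p) with ∈-map⁻ inj₂ p
      ... | (b′ , q , refl) = q

  enumerates-join : ∀ (X Y : FinSet) (xs : List (Elt X)) (ys : List (Elt Y)) →
                    Enumerates X xs → Enumerates Y ys → Enumerates (X ⊎ˢ Y) (map inj₁ xs ++ map inj₂ ys)
  enumerates-join X Y xs ys (u , c) (u′ , c′) =
    UP.++⁺ (UP.map⁺ inj₁-injective u) (UP.map⁺ inj₂-injective u′) (inj₁-inj₂-disjoint xs ys) , every
    where
      every : ∀ a → a ∈ map inj₁ xs ++ map inj₂ ys
      every (inj₁ a) = ∈-++⁺ˡ (∈-map⁺ inj₁ (c a))
      every (inj₂ b) = ∈-++⁺ʳ (map inj₁ xs) (∈-map⁺ inj₂ (c′ b))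

  enumerates-map : ∀ {X Y : FinSet} (σ : X ≅ Y) ls → Enumerates X ls → Enumerates Y (map (app σ) ls)
  enumerates-map σ ls (u , c) =
    UP.map⁺ (λ {x} {y} e → trans (sym (from-to x)) (trans (cong from e) (from-to y))) u ,
    λ y → subst (_∈ map (app σ) ls) (Inverse.strictlyInverseˡ (iso σ) y) (∈-map⁺ (app σ) (c (from y)))
    where
      from = Inverse.from (iso σ)
      from-to = Inverse.strictlyInverseʳ (iso σ)

  bijective-relabel : ∀ {X Y} (σ : X ≅ Y) (F : Forest (Elt X)) → Bijective {X} F → Bijective {Y} (mapᶠ (app σ) F)
  bijective-relabel {Y = Y} σ F b = subst (Enumerates Y) (sym (labelsᶠ-map (app σ) F)) (enumerates-map σ (labelsᶠ F) b)

  bijective-relabel⁻ : ∀ {X Y} (σ : X ≅ Y) (F : Forest (Elt X)) → Bijective {Y} (mapᶠ (app σ) F) → Bijective {X} F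
  bijective-relabel⁻ {X} σ F b =
    subst (Bijective {X}) (mapᶠ-inverse (Inverse.strictlyInverseʳ (iso σ)) F) (bijective-relabel (symᵇ σ) (mapᶠ (app σ) F) b)

module ForestProductDecorations {c ℓ} (K : Field c ℓ) (w : Field.Carrier K) where

  open Field K using (1#)
  open ADF K w using (Lin; onTerms; scale; _⋄ᵀ_; tf; ft; ff)
  open LinearCombination K

  onTerms-rbTerms : ∀ {A B : Set} (g : A → B) (X Y Z : Lin A) →
                    onTerms g (X ++ Y ++ scale w Z) ≡ onTerms g X ++ onTerms g Y ++ scale w (onTerms g Z)
  onTerms-rbTerms g X Y Z = trans (onTerms-++ g X _) (cong (onTerms g X ++_) (trans (onTerms-++ g Y _)
                              (cong (onTerms g Y ++_) (onTerms-scale g w Z))))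

  mutual
    ⋄ᵀ-map : ∀ {L L′ : Set} (f : L → L′) (T T′ : Tree L) → mapᵀ f T ⋄ᵀ mapᵀ f T′ ≡ onTerms (mapᵀ f) (T ⋄ᵀ T′)
    ⋄ᵀ-map f • T′ = refl
    ⋄ᵀ-map f (B⁺ A) • = refl
    ⋄ᵀ-map f (B⁺ A) (B⁺ A′) = begin
        onTerms B⁺ (tf (B⁺ (mapᶠ f A)) (mapᶠ f A′)) ++ onTerms B⁺ (ft (mapᶠ f A) (B⁺ (mapᶠ f A′)))
          ++ scale w (onTerms B⁺ (ff (mapᶠ f A) (mapᶠ f A′)))
          ≡⟨ cong₂ _++_ (cong (onTerms B⁺) (tf-map f (B⁺ A) A′))
                        (cong₂ (λ a b → onTerms B⁺ a ++ scale w (onTerms B⁺ b)) (ft-map f A (B⁺ A′)) (ff-map f A A′)) ⟩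
        onTerms B⁺ (onTerms (mapᶠ f) X) ++ onTerms B⁺ (onTerms (mapᶠ f) Y) ++ scale w (onTerms B⁺ (onTerms (mapᶠ f) Z))
          ≡⟨ cong₂ _++_ (B⁺-natural X) (cong₂ (λ a b → a ++ scale w b) (B⁺-natural Y) (B⁺-natural Z)) ⟩
        onTerms (mapᵀ f) (onTerms B⁺ X) ++ onTerms (mapᵀ f) (onTerms B⁺ Y) ++ scale w (onTerms (mapᵀ f) (onTerms B⁺ Z))
          ≡˘⟨ onTerms-rbTerms (mapᵀ f) (onTerms B⁺ X) (onTerms B⁺ Y) (onTerms B⁺ Z) ⟩
        onTerms (mapᵀ f) (B⁺ A ⋄ᵀ B⁺ A′) ∎
      where
        open P.≡-Reasoning
        X = tf (B⁺ A) A′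
        Y = ft A (B⁺ A′)
        Z = ff A A′
        B⁺-natural : ∀ u → onTerms B⁺ (onTerms (mapᶠ f) u) ≡ onTerms (mapᵀ f) (onTerms B⁺ u)
        B⁺-natural = onTerms-square (λ _ → refl)

    tf-map : ∀ {L L′ : Set} (f : L → L′) (T : Tree L) (G : Forest L) → tf (mapᵀ f T) (mapᶠ f G) ≡ onTerms (mapᶠ f) (tf T G)
    tf-map f T [ T′ ] = trans (cong (onTerms [_]) (⋄ᵀ-map f T T′)) (onTerms-square (λ _ → refl) (T ⋄ᵀ T′))
    tf-map f T (T′ ⟨ y ⟩ G) = trans (cong (onTerms (_⟨ f y ⟩ mapᶠ f G)) (⋄ᵀ-map f T T′)) (onTerms-square (λ _ → refl) (T ⋄ᵀ T′))

    ft-map : ∀ {L L′ : Set} (f : L → L′) (F : Forest L) (T′ : Tree L) → ft (mapᶠ f F) (mapᵀ f T′) ≡ onTerms (mapᶠ f) (ft F T′)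
    ft-map f [ T ] T′ = trans (cong (onTerms [_]) (⋄ᵀ-map f T T′)) (onTerms-square (λ _ → refl) (T ⋄ᵀ T′))
    ft-map f (T ⟨ x ⟩ F) T′ = trans (cong (onTerms (mapᵀ f T ⟨ f x ⟩_)) (ft-map f F T′)) (onTerms-square (λ _ → refl) (ft F T′))

    ff-map : ∀ {L L′ : Set} (f : L → L′) (F G : Forest L) → ff (mapᶠ f F) (mapᶠ f G) ≡ onTerms (mapᶠ f) (ff F G)
    ff-map f [ T ] G = tf-map f T G
    ff-map f (T ⟨ x ⟩ F) G = trans (cong (onTerms (mapᵀ f T ⟨ f x ⟩_)) (ff-map f F G)) (onTerms-square (λ _ → refl) (ff F G))

  mutual
    labels-⋄ᵀ : ∀ {L : Set} (T T′ : Tree L) → AllTerms (λ U → labelsᵀ U ≡ labelsᵀ T ++ labelsᵀ T′) (T ⋄ᵀ T′)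
    labels-⋄ᵀ • T′ = refl ∷ []
    labels-⋄ᵀ (B⁺ A) • = sym (++-identityʳ (labelsᶠ A)) ∷ []
    labels-⋄ᵀ (B⁺ A) (B⁺ A′) = AllP.++⁺ (AllTerms-onTerms B⁺ (λ p → p) (labels-tf (B⁺ A) A′))
                                 (AllP.++⁺ (AllTerms-onTerms B⁺ (λ p → p) (labels-ft A (B⁺ A′)))
                                           (AllTerms-scale w (AllTerms-onTerms B⁺ (λ p → p) (labels-ff A A′))))

    labels-tf : ∀ {L : Set} (T : Tree L) (G : Forest L) → AllTerms (λ H → labelsᶠ H ≡ labelsᵀ T ++ labelsᶠ G) (tf T G)
    labels-tf T [ T′ ] = AllTerms-onTerms [_] (λ p → p) (labels-⋄ᵀ T T′)
    labels-tf T (T′ ⟨ y ⟩ G) = AllTerms-onTerms (_⟨ y ⟩ G)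
      (λ p → trans (cong (_++ (y ∷ labelsᶠ G)) p) (++-assoc (labelsᵀ T) (labelsᵀ T′) (y ∷ labelsᶠ G))) (labels-⋄ᵀ T T′)

    labels-ft : ∀ {L : Set} (F : Forest L) (T′ : Tree L) → AllTerms (λ H → labelsᶠ H ≡ labelsᶠ F ++ labelsᵀ T′) (ft F T′)
    labels-ft [ T ] T′ = AllTerms-onTerms [_] (λ p → p) (labels-⋄ᵀ T T′)
    labels-ft (T ⟨ x ⟩ F) T′ = AllTerms-onTerms (T ⟨ x ⟩_)
      (λ p → trans (cong (λ z → labelsᵀ T ++ (x ∷ z)) p) (sym (++-assoc (labelsᵀ T) (x ∷ labelsᶠ F) (labelsᵀ T′)))) (labels-ft F T′)

    labels-ff : ∀ {L : Set} (F G : Forest L) → AllTerms (λ H → labelsᶠ H ≡ labelsᶠ F ++ labelsᶠ G) (ff F G)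
    labels-ff [ T ] G = labels-tf T G
    labels-ff (T ⟨ x ⟩ F) G = AllTerms-onTerms (T ⟨ x ⟩_)
      (λ p → trans (cong (λ z → labelsᵀ T ++ (x ∷ z)) p) (sym (++-assoc (labelsᵀ T) (x ∷ labelsᶠ F) (labelsᶠ G)))) (labels-ff F G)

module CoefficientSpace {c ℓ} (K : Field c ℓ) where

  open Field K renaming (Carrier to k; refl to ≈-refl; sym to ≈-sym; trans to ≈-trans)
  open ADF K 0# using (Lin; scale)
  open import Algebra.Properties.Ring ring using (-1*x≈-x)

  module _ {A : Set} (coefficient : Lin A → A → k) (Pr : A → Set)
           (coefficient-++ : ∀ u v t → coefficient (u ++ v) t ≈ coefficient u t + coefficient v t)
           (coefficient-[] : ∀ t → coefficient [] t ≈ 0#)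
           (coefficient-scale : ∀ s u t → coefficient (scale s u) t ≈ s * coefficient u t) where
    AgreeOn : Lin A → Lin A → Set ℓ
    AgreeOn u v = ∀ t → Pr t → coefficient u t ≈ coefficient v t

    agreeOn-isLeftModule : IsLeftModule ring AgreeOn _++_ [] (scale (- 1#)) scale
    agreeOn-isLeftModule = record
      { isLeftSemimodule = record
        { +ᴹ-isCommutativeMonoid = record
          { isMonoid = record
            { isSemigroup = record
              { isMagma = record
                { isEquivalence = record { refl = λ t p → ≈-refl ; sym = λ e t p → ≈-sym (e t p) ; trans = λ e e′ t p → ≈-trans (e t p) (e′ t p) }
                ; ∙-cong = λ {u} {u′} {v} {v′} e e′ t p → ≈-trans (coefficient-++ u v t) (≈-trans (+-cong (e t p) (e′ t p)) (≈-sym (coefficient-++ u′ v′ t))) }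
              ; assoc = λ u v z t p → ≈-trans (coefficient-++ (u ++ v) z t) (≈-trans (+-congʳ (coefficient-++ u v t)) (≈-trans (+-assoc _ _ _)
                                        (≈-trans (+-congˡ (≈-sym (coefficient-++ v z t))) (≈-sym (coefficient-++ u (v ++ z) t))))) }
            ; identity = (λ u t p → ≈-refl) , (λ u t p → ≈-trans (coefficient-++ u [] t) (≈-trans (+-congˡ (coefficient-[] t)) (+-identityʳ _))) }
          ; comm = λ u v t p → ≈-trans (coefficient-++ u v t) (≈-trans (+-comm _ _) (≈-sym (coefficient-++ v u t))) }
        ; isPreleftSemimodule = record
          { *ₗ-cong = λ {s} {s′} {u} {v} e e′ t p → ≈-trans (coefficient-scale s u t) (≈-trans (*-cong e (e′ t p)) (≈-sym (coefficient-scale s′ v t)))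
          ; *ₗ-zeroˡ = λ u t p → ≈-trans (coefficient-scale 0# u t) (≈-trans (zeroˡ _) (≈-sym (coefficient-[] t)))
          ; *ₗ-distribʳ = λ u a b t p → ≈-trans (coefficient-scale (a + b) u t) (≈-trans (distribʳ _ a b)
                              (≈-sym (≈-trans (coefficient-++ (scale a u) (scale b u) t) (+-cong (coefficient-scale a u t) (coefficient-scale b u t)))))
          ; *ₗ-identityˡ = λ u t p → ≈-trans (coefficient-scale 1# u t) (*-identityˡ _)
          ; *ₗ-assoc = λ a b u t p → ≈-trans (coefficient-scale (a * b) u t) (≈-trans (*-assoc a b _)
                              (≈-sym (≈-trans (coefficient-scale a (scale b u) t) (*-congˡ (coefficient-scale b u t)))))
          ; *ₗ-zeroʳ = λ a t p → ≈-refl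
          ; *ₗ-distribˡ = λ a u v t p → ≈-trans (coefficient-scale a (u ++ v) t) (≈-trans (*-congˡ (coefficient-++ u v t)) (≈-trans (distribˡ a _ _)
                              (≈-sym (≈-trans (coefficient-++ (scale a u) (scale a v) t) (+-cong (coefficient-scale a u t) (coefficient-scale a v t))))))
          } }
      ; -ᴹ‿cong = λ {u} {v} e t p → ≈-trans (coefficient-scale (- 1#) u t) (≈-trans (*-congˡ (e t p)) (≈-sym (coefficient-scale (- 1#) v t)))
      ; -ᴹ‿inverse = (λ u t p → ≈-trans (coefficient-++ (scale (- 1#) u) u t) (≈-trans (+-congʳ (≈-trans (coefficient-scale (- 1#) u t) (-1*x≈-x _)))
                                  (≈-trans (-‿inverseˡ _) (≈-sym (coefficient-[] t)))))
                   , (λ u t p → ≈-trans (coefficient-++ u (scale (- 1#) u) t) (≈-trans (+-congˡ (≈-trans (coefficient-scale (- 1#) u t) (-1*x≈-x _)))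
                                  (≈-trans (-‿inverseʳ _) (≈-sym (coefficient-[] t)))))
      }

module ADFSpecies {c ℓ} (K : Field c ℓ) (w : Field.Carrier K) where

  open Field K renaming (Carrier to k; refl to ≈-refl; sym to ≈-sym; trans to ≈-trans)
  open ADF K w
  open LinearCombination K
  open Decorations
  open CoefficientSpace K

  eqF : (X : FinSet) → DecidableEquality (Forest (Elt X))
  eqF X = _≟ᶠ_ (_≟ᴱ_ {X})

  coeff≡coef : ∀ {X} (u : Lin (Forest (Elt X))) F → coeff {X} u F ≡ coef (eqF X) u F
  coeff≡coef [] F = refl
  coeff≡coef {X} ((a , G) ∷ u) F with _≟ᶠ_ (_≟ᴱ_ {X}) G F
  ... | yes _ = cong (a +_) (coeff≡coef u F)
  ... | no _ = coeff≡coef u F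

  record ADFEq (X : FinSet) (u v : Lin (Forest (Elt X))) : Set ℓ where
    constructor bijectivewise
    field atBijective : ∀ F → Bijective {X} F → coeff {X} u F ≈ coeff {X} v F
  open ADFEq public

  ADFEq-setoid : FinSet → Setoid c ℓ
  ADFEq-setoid X = record
    { Carrier = Lin (Forest (Elt X))
    ; _≈_ = ADFEq X
    ; isEquivalence = record
      { refl = bijectivewise λ F b → ≈-refl
      ; sym = λ e → bijectivewise λ F b → ≈-sym (atBijective e F b)
      ; trans = λ e e′ → bijectivewise λ F b → ≈-trans (atBijective e F b) (atBijective e′ F b) } }

  module _ {X : FinSet} where
    open Setoid (ADFEq-setoid X) public using ()
      renaming (sym to ADFEq-sym; trans to ADFEq-trans; reflexive to ≡⇒ADFEq)

  coef⇒ADFEq : ∀ {X} {u v : Lin (Forest (Elt X))} →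
               (∀ F → Bijective {X} F → coef (eqF X) u F ≈ coef (eqF X) v F) → ADFEq X u v
  coef⇒ADFEq {X} {u} {v} e = bijectivewise λ F b → P.subst₂ _≈_ (sym (coeff≡coef u F)) (sym (coeff≡coef v F)) (e F b)

  ADFEq⇒coef : ∀ {X} {u v : Lin (Forest (Elt X))} → ADFEq X u v →
               ∀ F → Bijective {X} F → coef (eqF X) u F ≈ coef (eqF X) v F
  ADFEq⇒coef {X} {u} {v} e F b = P.subst₂ _≈_ (coeff≡coef u F) (coeff≡coef v F) (atBijective e F b)

  CoefEq⇒ADFEq : ∀ {X} {u v : Lin (Forest (Elt X))} → CoefEq (eqF X) u v → ADFEq X u v
  CoefEq⇒ADFEq e = coef⇒ADFEq λ F _ → e at F

  isVectorSpaceADF : ∀ X → IsLeftModule ring (RawSpecies._≈_ ADFspecies {X}) _++_ [] (scale (- 1#)) scale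
  isVectorSpaceADF X = agreeOn-isLeftModule (coeff {X}) (Bijective {X}) coeff-++ (λ _ → ≈-refl) coeff-scale
    where
      coeff-++ : ∀ u v F → coeff {X} (u ++ v) F ≈ coeff {X} u F + coeff {X} v F
      coeff-++ u v F = P.subst₂ _≈_ (sym (coeff≡coef (u ++ v) F)) (cong₂ _+_ (sym (coeff≡coef u F)) (sym (coeff≡coef v F)))
                         (coef-++ (eqF X) u v F)
      coeff-scale : ∀ s u F → coeff {X} (scale s u) F ≈ s * coeff {X} u F
      coeff-scale s u F = P.subst₂ _≈_ (sym (coeff≡coef (scale s u) F)) (cong (s *_) (sym (coeff≡coef u F)))
                            (coef-scale (eqF X) s u F)

  relabel-ADFEq : ∀ {X Y} (σ : X ≅ Y) {u v : Lin (Forest (Elt X))} → ADFEq X u v →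
                  ADFEq Y (onTerms (mapᶠ (app σ)) u) (onTerms (mapᶠ (app σ)) v)
  relabel-ADFEq {X} {Y} σ {u} {v} e = coef⇒ADFEq λ H b →
    ≈-trans (coef-at-image u H)
      (≈-trans (ADFEq⇒coef e (mapᶠ (app σ⁻¹) H) (bijective-relabel σ⁻¹ H b)) (≈-sym (coef-at-image v H)))
    where
      σ⁻¹ = symᵇ σ
      coef-at-image : ∀ u H → coef (eqF Y) (onTerms (mapᶠ (app σ)) u) H ≈ coef (eqF X) u (mapᶠ (app σ⁻¹) H)
      coef-at-image u H = coef-onTerms-preimage (eqF X) (eqF Y) (mapᶠ (app σ)) H (mapᶠ (app σ⁻¹) H)
        (mapᶠ-inverse (Inverse.strictlyInverseˡ (iso σ)) H)
        (λ t p → trans (sym (mapᶠ-inverse (Inverse.strictlyInverseʳ (iso σ)) t)) (cong (mapᶠ (app σ⁻¹)) p)) u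

  isSpeciesADF : IsSpecies K ADFspecies
  isSpeciesADF = record
    { isVectorSpace = isVectorSpaceADF
    ; relabel-cong = λ σ τ e {x} {y} x≈y → atBijective
        (ADFEq-trans (relabel-ADFEq σ {x} {y} (bijectivewise x≈y)) (≡⇒ADFEq (onTerms-cong-≡ y (mapᶠ-cong e))))
    ; relabel-+ = λ σ x y → atBijective (≡⇒ADFEq (onTerms-++ (mapᶠ (app σ)) x y))
    ; relabel-· = λ σ a x → atBijective (≡⇒ADFEq (onTerms-scale (mapᶠ (app σ)) a x))
    ; relabel-id = λ x → atBijective (≡⇒ADFEq (trans (onTerms-cong-≡ x mapᶠ-id) (onTerms-id x)))
    ; relabel-∘ = λ σ τ x → atBijective (≡⇒ADFEq (sym (trans (onTerms-∘ (mapᶠ (app τ)) (mapᶠ (app σ)) x)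
                                                          (onTerms-cong-≡ x (mapᶠ-∘ (app τ) (app σ))))))
    }

  bind-ADFEq-congˡ : ∀ {X Y} {x x′ : Lin (Forest (Elt X))} (h : Forest (Elt X) → Lin (Forest (Elt Y))) →
                     (∀ F → ¬ Bijective {X} F → ∀ H → Bijective {Y} H → AllTerms (λ E → ¬ (E ≡ H)) (h F)) →
                     ADFEq X x x′ → ADFEq Y (bind x h) (bind x′ h)
  bind-ADFEq-congˡ {X} {Y} {x} {x′} h h-nonbasis e = coef⇒ADFEq λ H bH →
    ≈-trans (coef-bind (eqF X) (eqF Y) x h H)
      (≈-trans (Scalar.∑-resp-coef (eqF X) _ x x′ (λ F → agree F H bH)) (≈-sym (coef-bind (eqF X) (eqF Y) x′ h H)))
    where
      agree : ∀ F H → Bijective {Y} H → coef (eqF X) x F ≈ coef (eqF X) x′ F ⊎ coef (eqF Y) (h F) H ≈ 0#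
      agree F H bH with bijective? {X} F
      ... | yes b = inj₁ (ADFEq⇒coef e F b)
      ... | no nb = inj₂ (coef-absent (eqF Y) (h F) H (h-nonbasis F nb H bH))

  coeff-singleton-cong : ∀ {X} {a b : k} (F H : Forest (Elt X)) → a ≈ b → coeff {X} ((a , F) ∷ []) H ≈ coeff {X} ((b , F) ∷ []) H
  coeff-singleton-cong {X} F H a≈b = P.subst₂ _≈_ (sym (coeff≡coef ((_ , F) ∷ []) H)) (sym (coeff≡coef ((_ , F) ∷ []) H))
                                       (coef-singleton-cong (eqF X) F H a≈b)

module ADFProduct {c ℓ} (K : Field c ℓ) (w : Field.Carrier K) where

  open Field K renaming (Carrier to k; refl to ≈-refl; sym to ≈-sym; trans to ≈-trans)
  open ADF K w
  open LinearCombination K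
  open Decorations
  open ForestProductDecorations K w
  open ADFSpecies K w

  mulBasis : ∀ {X Y : FinSet} → Forest (Elt X) → Forest (Elt Y) → Lin (Forest (Elt (X ⊎ˢ Y)))
  mulBasis F G = ff (mapᶠ inj₁ F) (mapᶠ inj₂ G)

  mulBind : ∀ {X Y : FinSet} → Lin (Forest (Elt X)) → Lin (Forest (Elt Y)) → Lin (Forest (Elt (X ⊎ˢ Y)))
  mulBind {X} {Y} u v = bind u (λ F → bind v (λ G → mulBasis {X} {Y} F G))

  module _ {X Y : FinSet} where
    private
      eq = eqF (X ⊎ˢ Y)

    mulADF≈mulBind : ∀ (u : Lin (Forest (Elt X))) (v : Lin (Forest (Elt Y))) → CoefEq eq (mulADF {X} {Y} u v) (mulBind {X} {Y} u v)
    mulADF≈mulBind u v = concatMap-as-bind eq (λ a F →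
      CoefEq-trans eq (concatMap-as-bind eq (λ b G → scale-* eq a b (mulBasis {X} {Y} F G)) v)
                      (bind-scaleʳ (eqF Y) eq v a (mulBasis {X} {Y} F))) u

    labels-mulBasis : ∀ (F : Forest (Elt X)) (G : Forest (Elt Y)) →
                      AllTerms (λ E → labelsᶠ E ≡ map inj₁ (labelsᶠ F) ++ map inj₂ (labelsᶠ G)) (mulBasis {X} {Y} F G)
    labels-mulBasis F G = AllTerms-map (λ p → trans p (cong₂ _++_ (labelsᶠ-map inj₁ F) (labelsᶠ-map inj₂ G)))
                                       (labels-ff (mapᶠ inj₁ F) (mapᶠ inj₂ G))

    mulBasis-nonbijective : ∀ (F : Forest (Elt X)) (G : Forest (Elt Y)) → (¬ Bijective {X} F ⊎ ¬ Bijective {Y} G) →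
                            AllTerms (λ E → ¬ Bijective {X ⊎ˢ Y} E) (mulBasis {X} {Y} F G)
    mulBasis-nonbijective F G nb = AllTerms-map (λ labels-E bE →
      factors-bijective nb (enumerates-split X Y (labelsᶠ F) (labelsᶠ G) (subst (Enumerates (X ⊎ˢ Y)) labels-E bE)))
      (labels-mulBasis F G)
      where
        factors-bijective : (¬ Bijective {X} F ⊎ ¬ Bijective {Y} G) → ¬ (Bijective {X} F × Bijective {Y} G)
        factors-bijective (inj₁ nF) (bF , _) = nF bF
        factors-bijective (inj₂ nG) (_ , bG) = nG bG

    mulBasis-avoids : ∀ (F : Forest (Elt X)) (G : Forest (Elt Y)) → (¬ Bijective {X} F ⊎ ¬ Bijective {Y} G) →
                      ∀ H → Bijective {X ⊎ˢ Y} H → AllTerms (λ E → ¬ (E ≡ H)) (mulBasis {X} {Y} F G)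
    mulBasis-avoids F G nb H bH = AllTerms-map (λ nE E≡H → nE (subst (Bijective {X ⊎ˢ Y}) (sym E≡H) bH))
                                               (mulBasis-nonbijective F G nb)

    mulBind-congˡ : ∀ {x x′ : Lin (Forest (Elt X))} (y : Lin (Forest (Elt Y))) → ADFEq X x x′ →
                    ADFEq (X ⊎ˢ Y) (mulBind {X} {Y} x y) (mulBind {X} {Y} x′ y)
    mulBind-congˡ y = bind-ADFEq-congˡ (λ F → bind y (mulBasis {X} {Y} F))
      (λ F nF H bH → AllTerms-bind y (mulBasis {X} {Y} F) (λ G → mulBasis-avoids F G (inj₁ nF) H bH))

    mulBind-congʳ : ∀ (x : Lin (Forest (Elt X))) {y y′ : Lin (Forest (Elt Y))} → ADFEq Y y y′ →
                    ADFEq (X ⊎ˢ Y) (mulBind {X} {Y} x y) (mulBind {X} {Y} x y′)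
    mulBind-congʳ x {y} {y′} e = begin
      mulBind {X} {Y} x y ≈⟨ CoefEq⇒ADFEq (bind-swap (eqF X) (eqF Y) eq x y (mulBasis {X} {Y})) ⟩
      bind y (λ G → bind x (λ F → mulBasis {X} {Y} F G))
        ≈⟨ bind-ADFEq-congˡ (λ G → bind x (λ F → mulBasis {X} {Y} F G))
             (λ G nG H bH → AllTerms-bind x (λ F → mulBasis {X} {Y} F G) (λ F → mulBasis-avoids F G (inj₂ nG) H bH)) e ⟩
      bind y′ (λ G → bind x (λ F → mulBasis {X} {Y} F G)) ≈˘⟨ CoefEq⇒ADFEq (bind-swap (eqF X) (eqF Y) eq x y′ (mulBasis {X} {Y})) ⟩
      mulBind {X} {Y} x y′ ∎
      where open SR (ADFEq-setoid (X ⊎ˢ Y))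

    mulADF-cong : ∀ {x x′ : Lin (Forest (Elt X))} {y y′ : Lin (Forest (Elt Y))} → ADFEq X x x′ → ADFEq Y y y′ →
                  ADFEq (X ⊎ˢ Y) (mulADF {X} {Y} x y) (mulADF {X} {Y} x′ y′)
    mulADF-cong {x} {x′} {y} {y′} e e′ = begin
      mulADF {X} {Y} x y ≈⟨ CoefEq⇒ADFEq (mulADF≈mulBind x y) ⟩
      mulBind {X} {Y} x y ≈⟨ mulBind-congˡ y e ⟩
      mulBind {X} {Y} x′ y ≈⟨ mulBind-congʳ x′ e′ ⟩
      mulBind {X} {Y} x′ y′ ≈˘⟨ CoefEq⇒ADFEq (mulADF≈mulBind x′ y′) ⟩
      mulADF {X} {Y} x′ y′ ∎
      where open SR (ADFEq-setoid (X ⊎ˢ Y))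

    open SR (CoefEq-setoid eq)

    mulADF-++ˡ : ∀ (x x′ : Lin (Forest (Elt X))) (y : Lin (Forest (Elt Y))) →
                 CoefEq eq (mulADF {X} {Y} (x ++ x′) y) (mulADF {X} {Y} x y ++ mulADF {X} {Y} x′ y)
    mulADF-++ˡ x x′ y = begin
      mulADF {X} {Y} (x ++ x′) y ≈⟨ mulADF≈mulBind (x ++ x′) y ⟩
      mulBind {X} {Y} (x ++ x′) y ≡⟨ bind-++ˡ x x′ _ ⟩
      mulBind {X} {Y} x y ++ mulBind {X} {Y} x′ y ≈˘⟨ ++-cong eq (mulADF≈mulBind x y) (mulADF≈mulBind x′ y) ⟩
      mulADF {X} {Y} x y ++ mulADF {X} {Y} x′ y ∎

    mulADF-++ʳ : ∀ (x : Lin (Forest (Elt X))) (y y′ : Lin (Forest (Elt Y))) →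
                 CoefEq eq (mulADF {X} {Y} x (y ++ y′)) (mulADF {X} {Y} x y ++ mulADF {X} {Y} x y′)
    mulADF-++ʳ x y y′ = begin
      mulADF {X} {Y} x (y ++ y′) ≈⟨ mulADF≈mulBind x (y ++ y′) ⟩
      mulBind {X} {Y} x (y ++ y′) ≈⟨ bind-congʳ (eqF X) eq x (λ F → ≡⇒CoefEq eq (bind-++ˡ y y′ (mulBasis {X} {Y} F))) ⟩
      bind x (λ F → bind y (mulBasis {X} {Y} F) ++ bind y′ (mulBasis {X} {Y} F)) ≈⟨ bind-++ʳ (eqF X) eq x _ _ ⟩
      mulBind {X} {Y} x y ++ mulBind {X} {Y} x y′ ≈˘⟨ ++-cong eq (mulADF≈mulBind x y) (mulADF≈mulBind x y′) ⟩
      mulADF {X} {Y} x y ++ mulADF {X} {Y} x y′ ∎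

    mulADF-scaleˡ : ∀ a (x : Lin (Forest (Elt X))) (y : Lin (Forest (Elt Y))) →
                    CoefEq eq (mulADF {X} {Y} (scale a x) y) (scale a (mulADF {X} {Y} x y))
    mulADF-scaleˡ a x y = begin
      mulADF {X} {Y} (scale a x) y ≈⟨ mulADF≈mulBind (scale a x) y ⟩
      mulBind {X} {Y} (scale a x) y ≈⟨ bind-scaleˡ (eqF X) eq x a _ ⟩
      scale a (mulBind {X} {Y} x y) ≈˘⟨ scale-cong eq a (mulADF≈mulBind x y) ⟩
      scale a (mulADF {X} {Y} x y) ∎

    mulADF-scaleʳ : ∀ a (x : Lin (Forest (Elt X))) (y : Lin (Forest (Elt Y))) →
                    CoefEq eq (mulADF {X} {Y} x (scale a y)) (scale a (mulADF {X} {Y} x y))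
    mulADF-scaleʳ a x y = begin
      mulADF {X} {Y} x (scale a y) ≈⟨ mulADF≈mulBind x (scale a y) ⟩
      mulBind {X} {Y} x (scale a y) ≈⟨ bind-congʳ (eqF X) eq x (λ F → bind-scaleˡ (eqF Y) eq y a (mulBasis {X} {Y} F)) ⟩
      bind x (λ F → scale a (bind y (mulBasis {X} {Y} F))) ≈⟨ bind-scaleʳ (eqF X) eq x a _ ⟩
      scale a (mulBind {X} {Y} x y) ≈˘⟨ scale-cong eq a (mulADF≈mulBind x y) ⟩
      scale a (mulADF {X} {Y} x y) ∎

  relabel-mulBasis : ∀ {X X′ Y Y′} (σ : X ≅ X′) (τ : Y ≅ Y′) F G →
                     onTerms (mapᶠ (app (σ ⊎ᵇ τ))) (mulBasis {X} {Y} F G) ≡ mulBasis {X′} {Y′} (mapᶠ (app σ) F) (mapᶠ (app τ) G)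
  relabel-mulBasis σ τ F G = trans (sym (ff-map (app (σ ⊎ᵇ τ)) (mapᶠ inj₁ F) (mapᶠ inj₂ G)))
    (cong₂ ff (trans (mapᶠ-∘ (app (σ ⊎ᵇ τ)) inj₁ F) (sym (mapᶠ-∘ inj₁ (app σ) F)))
              (trans (mapᶠ-∘ (app (σ ⊎ᵇ τ)) inj₂ G) (sym (mapᶠ-∘ inj₂ (app τ) G))))

  relabel-mulBind : ∀ {X X′ Y Y′} (σ : X ≅ X′) (τ : Y ≅ Y′) (x : Lin (Forest (Elt X))) (y : Lin (Forest (Elt Y))) →
                    onTerms (mapᶠ (app (σ ⊎ᵇ τ))) (mulBind {X} {Y} x y)
                      ≡ mulBind {X′} {Y′} (onTerms (mapᶠ (app σ)) x) (onTerms (mapᶠ (app τ)) y)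
  relabel-mulBind {X} {X′} {Y} {Y′} σ τ x y = begin
    onTerms (mapᶠ (app (σ ⊎ᵇ τ))) (mulBind {X} {Y} x y)
      ≡⟨ onTerms-bind (mapᶠ (app (σ ⊎ᵇ τ))) x _ ⟩
    bind x (λ F → onTerms (mapᶠ (app (σ ⊎ᵇ τ))) (bind y (mulBasis {X} {Y} F)))
      ≡⟨ bind-cong-≡ x (λ F → onTerms-bind (mapᶠ (app (σ ⊎ᵇ τ))) y (mulBasis {X} {Y} F)) ⟩
    bind x (λ F → bind y (λ G → onTerms (mapᶠ (app (σ ⊎ᵇ τ))) (mulBasis {X} {Y} F G)))
      ≡⟨ bind-cong-≡ x (λ F → bind-cong-≡ y (relabel-mulBasis σ τ F)) ⟩
    bind x (λ F → bind y (λ G → mulBasis {X′} {Y′} (mapᶠ (app σ) F) (mapᶠ (app τ) G)))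
      ≡˘⟨ bind-cong-≡ x (λ F → bind-onTerms (eqF Y) (eqF Y′) (mapᶠ (app τ)) y (mulBasis {X′} {Y′} (mapᶠ (app σ) F))) ⟩
    bind x (λ F → bind (onTerms (mapᶠ (app τ)) y) (mulBasis {X′} {Y′} (mapᶠ (app σ) F)))
      ≡˘⟨ bind-onTerms (eqF X) (eqF X′) (mapᶠ (app σ)) x _ ⟩
    mulBind {X′} {Y′} (onTerms (mapᶠ (app σ)) x) (onTerms (mapᶠ (app τ)) y) ∎
    where open P.≡-Reasoning

  mulADF-natural : ∀ {X X′ Y Y′} (σ : X ≅ X′) (τ : Y ≅ Y′) (x : Lin (Forest (Elt X))) (y : Lin (Forest (Elt Y))) →
                   ADFEq (X′ ⊎ˢ Y′) (onTerms (mapᶠ (app (σ ⊎ᵇ τ))) (mulADF {X} {Y} x y))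
                                    (mulADF {X′} {Y′} (onTerms (mapᶠ (app σ)) x) (onTerms (mapᶠ (app τ)) y))
  mulADF-natural {X} {X′} {Y} {Y′} σ τ x y = begin
    onTerms (mapᶠ (app (σ ⊎ᵇ τ))) (mulADF {X} {Y} x y) ≈⟨ relabel-ADFEq (σ ⊎ᵇ τ) (CoefEq⇒ADFEq (mulADF≈mulBind {X} {Y} x y)) ⟩
    onTerms (mapᶠ (app (σ ⊎ᵇ τ))) (mulBind {X} {Y} x y) ≡⟨ relabel-mulBind σ τ x y ⟩
    mulBind {X′} {Y′} (onTerms (mapᶠ (app σ)) x) (onTerms (mapᶠ (app τ)) y) ≈˘⟨ CoefEq⇒ADFEq (mulADF≈mulBind {X′} {Y′} (onTerms (mapᶠ (app σ)) x) (onTerms (mapᶠ (app τ)) y)) ⟩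
    mulADF {X′} {Y′} (onTerms (mapᶠ (app σ)) x) (onTerms (mapᶠ (app τ)) y) ∎
    where open SR (ADFEq-setoid (X′ ⊎ˢ Y′))

  -- Both bracketings of a product of three basis forests are, after relabelling into
  -- X ⊔ (Y ⊔ Z), the two sides of associativity of ⋄ on forests decorated by X ⊔ (Y ⊔ Z).
  module _ {X Y Z : FinSet} where
    private
      W = X ⊎ˢ (Y ⊎ˢ Z)
      α = app (assocᵇ X Y Z)
      module ⋄W = ForestProduct K w (_≟ᴱ_ {W})
      in₁ : Forest (Elt X) → Forest (Elt W)
      in₁ = mapᶠ inj₁
      in₂ : Forest (Elt Y) → Forest (Elt W)
      in₂ = mapᶠ (λ b → inj₂ (inj₁ b))
      in₃ : Forest (Elt Z) → Forest (Elt W)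
      in₃ = mapᶠ (λ c → inj₂ (inj₂ c))

    mulBasis-bracketˡ : ∀ F G H → bind (mulBasis {X} {Y} F G) (λ E → onTerms (mapᶠ α) (mulBasis {X ⊎ˢ Y} {Z} E H))
                                    ≡ ⋄W.ffˡ (ff (in₁ F) (in₂ G)) (in₃ H)
    mulBasis-bracketˡ F G H = begin
      bind (mulBasis {X} {Y} F G) (λ E → onTerms (mapᶠ α) (mulBasis {X ⊎ˢ Y} {Z} E H))
        ≡⟨ bind-cong-≡ (mulBasis {X} {Y} F G) (λ E → trans (sym (ff-map α (mapᶠ inj₁ E) (mapᶠ inj₂ H)))
                                                           (cong₂ ff (mapᶠ-∘ α inj₁ E) (mapᶠ-∘ α inj₂ H))) ⟩
      bind (mulBasis {X} {Y} F G) (λ E → ff (mapᶠ (λ e → α (inj₁ e)) E) (in₃ H))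
        ≡˘⟨ bind-onTerms (eqF (X ⊎ˢ Y)) (eqF W) (mapᶠ (λ e → α (inj₁ e))) (mulBasis {X} {Y} F G) (λ E → ff E (in₃ H)) ⟩
      ⋄W.ffˡ (onTerms (mapᶠ (λ e → α (inj₁ e))) (mulBasis {X} {Y} F G)) (in₃ H)
        ≡⟨ cong (λ q → ⋄W.ffˡ q (in₃ H)) (trans (sym (ff-map (λ e → α (inj₁ e)) (mapᶠ inj₁ F) (mapᶠ inj₂ G)))
                                                (cong₂ ff (mapᶠ-∘ (λ e → α (inj₁ e)) inj₁ F) (mapᶠ-∘ (λ e → α (inj₁ e)) inj₂ G))) ⟩
      ⋄W.ffˡ (ff (in₁ F) (in₂ G)) (in₃ H) ∎
      where open P.≡-Reasoning

    mulBasis-bracketʳ : ∀ F G H → bind (mulBasis {Y} {Z} G H) (mulBasis {X} {Y ⊎ˢ Z} F) ≡ ⋄W.ffʳ (in₁ F) (ff (in₂ G) (in₃ H))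
    mulBasis-bracketʳ F G H =
      trans (sym (bind-onTerms (eqF (Y ⊎ˢ Z)) (eqF W) (mapᶠ inj₂) (mulBasis {Y} {Z} G H) (ff (in₁ F))))
            (cong (⋄W.ffʳ (in₁ F)) (trans (sym (ff-map inj₂ (mapᶠ inj₁ G) (mapᶠ inj₂ H)))
                                          (cong₂ ff (mapᶠ-∘ inj₂ inj₁ G) (mapᶠ-∘ inj₂ inj₂ H))))

    mulBasis-assoc : ∀ F G H → CoefEq (eqF W) (bind (mulBasis {X} {Y} F G) (λ E → onTerms (mapᶠ α) (mulBasis {X ⊎ˢ Y} {Z} E H)))
                                              (bind (mulBasis {Y} {Z} G H) (mulBasis {X} {Y ⊎ˢ Z} F))
    mulBasis-assoc F G H = begin
      bind (mulBasis {X} {Y} F G) (λ E → onTerms (mapᶠ α) (mulBasis {X ⊎ˢ Y} {Z} E H)) ≡⟨ mulBasis-bracketˡ F G H ⟩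
      ⋄W.ffˡ (ff (in₁ F) (in₂ G)) (in₃ H) ≈⟨ ⋄W.assoc (in₁ F) (in₂ G) (in₃ H) ⟩
      ⋄W.ffʳ (in₁ F) (ff (in₂ G) (in₃ H)) ≡˘⟨ mulBasis-bracketʳ F G H ⟩
      bind (mulBasis {Y} {Z} G H) (mulBasis {X} {Y ⊎ˢ Z} F) ∎
      where open SR (CoefEq-setoid (eqF W))

    mulBind-assoc : ∀ (x : Lin (Forest (Elt X))) (y : Lin (Forest (Elt Y))) (z : Lin (Forest (Elt Z))) →
                    CoefEq (eqF W) (onTerms (mapᶠ α) (mulBind {X ⊎ˢ Y} {Z} (mulBind {X} {Y} x y) z))
                                   (mulBind {X} {Y ⊎ˢ Z} x (mulBind {Y} {Z} y z))
    mulBind-assoc x y z = begin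
      onTerms (mapᶠ α) (mulBind {X ⊎ˢ Y} {Z} (mulBind {X} {Y} x y) z)
        ≡⟨ trans (onTerms-bind (mapᶠ α) (mulBind {X} {Y} x y) _) (bind-cong-≡ (mulBind {X} {Y} x y) (λ E → onTerms-bind (mapᶠ α) z _)) ⟩
      bind (mulBind {X} {Y} x y) (λ E → bind z (λ H → Φ E H))
        ≈⟨ CoefEq-trans (eqF W) (bind-assoc (eqF X) (eqF (X ⊎ˢ Y)) (eqF W) x _ _)
             (bind-congʳ (eqF X) (eqF W) x (λ F → bind-assoc (eqF Y) (eqF (X ⊎ˢ Y)) (eqF W) y _ _)) ⟩
      bind x (λ F → bind y (λ G → bind (mulBasis {X} {Y} F G) (λ E → bind z (λ H → Φ E H))))
        ≈⟨ bind-congʳ (eqF X) (eqF W) x (λ F → bind-congʳ (eqF Y) (eqF W) y (λ G →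
             bind-swap (eqF (X ⊎ˢ Y)) (eqF Z) (eqF W) (mulBasis {X} {Y} F G) z Φ)) ⟩
      bind x (λ F → bind y (λ G → bind z (λ H → bind (mulBasis {X} {Y} F G) (λ E → Φ E H))))
        ≈⟨ bind-congʳ (eqF X) (eqF W) x (λ F → bind-congʳ (eqF Y) (eqF W) y (λ G → bind-congʳ (eqF Z) (eqF W) z (λ H →
             mulBasis-assoc F G H))) ⟩
      bind x (λ F → bind y (λ G → bind z (λ H → bind (mulBasis {Y} {Z} G H) (mulBasis {X} {Y ⊎ˢ Z} F))))
        ≈˘⟨ bind-congʳ (eqF X) (eqF W) x (λ F → CoefEq-trans (eqF W) (bind-assoc (eqF Y) (eqF (Y ⊎ˢ Z)) (eqF W) y _ _)
              (bind-congʳ (eqF Y) (eqF W) y (λ G → bind-assoc (eqF Z) (eqF (Y ⊎ˢ Z)) (eqF W) z _ _))) ⟩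
      mulBind {X} {Y ⊎ˢ Z} x (mulBind {Y} {Z} y z) ∎
      where
        open SR (CoefEq-setoid (eqF W))
        Φ : Forest (Elt (X ⊎ˢ Y)) → Forest (Elt Z) → Lin (Forest (Elt W))
        Φ E H = onTerms (mapᶠ α) (mulBasis {X ⊎ˢ Y} {Z} E H)

    mulADF-assoc : ∀ (x : Lin (Forest (Elt X))) (y : Lin (Forest (Elt Y))) (z : Lin (Forest (Elt Z))) →
                   ADFEq W (onTerms (mapᶠ α) (mulADF {X ⊎ˢ Y} {Z} (mulADF {X} {Y} x y) z)) (mulADF {X} {Y ⊎ˢ Z} x (mulADF {Y} {Z} y z))
    mulADF-assoc x y z = begin
      onTerms (mapᶠ α) (mulADF {X ⊎ˢ Y} {Z} (mulADF {X} {Y} x y) z)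
        ≈⟨ relabel-ADFEq (assocᵇ X Y Z) (ADFEq-trans (CoefEq⇒ADFEq (mulADF≈mulBind {X ⊎ˢ Y} {Z} (mulADF {X} {Y} x y) z))
                                                     (mulBind-congˡ {X ⊎ˢ Y} {Z} z (CoefEq⇒ADFEq (mulADF≈mulBind {X} {Y} x y)))) ⟩
      onTerms (mapᶠ α) (mulBind {X ⊎ˢ Y} {Z} (mulBind {X} {Y} x y) z) ≈⟨ CoefEq⇒ADFEq (mulBind-assoc x y z) ⟩
      mulBind {X} {Y ⊎ˢ Z} x (mulBind {Y} {Z} y z)
        ≈˘⟨ ADFEq-trans (CoefEq⇒ADFEq (mulADF≈mulBind {X} {Y ⊎ˢ Z} x (mulADF {Y} {Z} y z))) (mulBind-congʳ {X} {Y ⊎ˢ Z} x (CoefEq⇒ADFEq (mulADF≈mulBind {Y} {Z} y z))) ⟩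
      mulADF {X} {Y ⊎ˢ Z} x (mulADF {Y} {Z} y z) ∎
      where open SR (ADFEq-setoid W)

module ADFRotaBaxter {c ℓ} (K : Field c ℓ) (w : Field.Carrier K) where

  open Field K renaming (Carrier to k; refl to ≈-refl; sym to ≈-sym; trans to ≈-trans)
  open ADF K w
  open LinearCombination K
  open Decorations
  open ADFSpecies K w
  open ADFProduct K w

  unitADF : Lin (Forest (Elt ∅ˢ))
  unitADF = (1# , [ • ]) ∷ []

  ft-• : ∀ {L : Set} (F : Forest L) → ft F • ≡ (1# , F) ∷ []
  ft-• [ • ] = refl
  ft-• [ B⁺ A ] = refl
  ft-• (T ⟨ x ⟩ F) = cong (onTerms (T ⟨ x ⟩_)) (ft-• F)

  mulBasis-unitˡ : ∀ {X} (G : Forest (Elt X)) → mulBasis {∅ˢ} {X} [ • ] G ≡ (1# , mapᶠ inj₂ G) ∷ []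
  mulBasis-unitˡ [ T ] = refl
  mulBasis-unitˡ (T ⟨ y ⟩ G) = refl

  mulBasis-unitʳ : ∀ {X} (F : Forest (Elt X)) → mulBasis {X} {∅ˢ} F [ • ] ≡ (1# , mapᶠ inj₁ F) ∷ []
  mulBasis-unitʳ {X} F = trans (sym (ForestProduct.ft≡ff K w (_≟ᴱ_ {X ⊎ˢ ∅ˢ}) (mapᶠ inj₁ F) •)) (ft-• (mapᶠ inj₁ F))

  relabel-singletons : ∀ {A B : Set} (f : A → B) (g : B → A) → (∀ a → g (f a) ≡ a) → (x : Lin A) →
                       onTerms g (bind x (λ a → (1# , f a) ∷ [])) ≡ bind x (λ a → (1# , a) ∷ [])
  relabel-singletons f g gf x = trans (onTerms-bind g x (λ a → (1# , f a) ∷ [])) (bind-cong-≡ x (λ a → cong (λ b → (1# , b) ∷ []) (gf a)))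

  mulADF-unitˡ : ∀ {X} (x : Lin (Forest (Elt X))) → ADFEq X (onTerms (mapᶠ (app (unitˡᵇ X))) (mulADF {∅ˢ} {X} unitADF x)) x
  mulADF-unitˡ {X} x = begin
    onTerms (mapᶠ λ₀) (mulADF {∅ˢ} {X} unitADF x)
      ≈⟨ relabel-ADFEq (unitˡᵇ X) (CoefEq⇒ADFEq (CoefEq-trans (eqF (∅ˢ ⊎ˢ X)) (mulADF≈mulBind {∅ˢ} {X} unitADF x)
           (bind-unitˡ (eqF ∅ˢ) (eqF (∅ˢ ⊎ˢ X)) [ • ] (λ F → bind x (mulBasis {∅ˢ} {X} F))))) ⟩
    onTerms (mapᶠ λ₀) (bind x (mulBasis {∅ˢ} {X} [ • ]))
      ≡⟨ cong (onTerms (mapᶠ λ₀)) (bind-cong-≡ x (mulBasis-unitˡ {X})) ⟩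
    onTerms (mapᶠ λ₀) (bind x (λ G → (1# , mapᶠ inj₂ G) ∷ [])) ≡⟨ relabel-singletons (mapᶠ inj₂) (mapᶠ λ₀) (mapᶠ-inverse (λ _ → refl)) x ⟩
    bind x (λ G → (1# , G) ∷ []) ≈⟨ CoefEq⇒ADFEq (bind-unitʳ (eqF X) x) ⟩
    x ∎
    where
      λ₀ = app (unitˡᵇ X)
      open SR (ADFEq-setoid X)

  mulADF-unitʳ : ∀ {X} (x : Lin (Forest (Elt X))) → ADFEq X (onTerms (mapᶠ (app (unitʳᵇ X))) (mulADF {X} {∅ˢ} x unitADF)) x
  mulADF-unitʳ {X} x = begin
    onTerms (mapᶠ ρ₀) (mulADF {X} {∅ˢ} x unitADF)
      ≈⟨ relabel-ADFEq (unitʳᵇ X) (CoefEq⇒ADFEq (CoefEq-trans (eqF (X ⊎ˢ ∅ˢ)) (mulADF≈mulBind {X} {∅ˢ} x unitADF)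
           (bind-congʳ (eqF X) (eqF (X ⊎ˢ ∅ˢ)) x (λ F → bind-unitˡ (eqF ∅ˢ) (eqF (X ⊎ˢ ∅ˢ)) [ • ] (mulBasis {X} {∅ˢ} F))))) ⟩
    onTerms (mapᶠ ρ₀) (bind x (λ F → mulBasis {X} {∅ˢ} F [ • ]))
      ≡⟨ cong (onTerms (mapᶠ ρ₀)) (bind-cong-≡ x (mulBasis-unitʳ {X})) ⟩
    onTerms (mapᶠ ρ₀) (bind x (λ F → (1# , mapᶠ inj₁ F) ∷ [])) ≡⟨ relabel-singletons (mapᶠ inj₁) (mapᶠ ρ₀) (mapᶠ-inverse (λ _ → refl)) x ⟩
    bind x (λ F → (1# , F) ∷ []) ≈⟨ CoefEq⇒ADFEq (bind-unitʳ (eqF X) x) ⟩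
    x ∎
    where
      ρ₀ = app (unitʳᵇ X)
      open SR (ADFEq-setoid X)

  graft : ∀ {L : Set} → Lin (Forest L) → Lin (Forest L)
  graft u = onTerms (λ F → [ B⁺ F ]) u

  graft-cong : ∀ {X} {x y : Lin (Forest (Elt X))} → ADFEq X x y → ADFEq X (graft x) (graft y)
  graft-cong {X} {x} {y} e = coef⇒ADFEq agree
    where
      agree : ∀ H → Bijective {X} H → coef (eqF X) (graft x) H ≈ coef (eqF X) (graft y) H
      agree H bH with ForestProduct.[B⁺]-decodable K w (_≟ᴱ_ {X}) H
      ... | inj₁ (A , p , inj) = ≈-trans (coef-onTerms-preimage (eqF X) (eqF X) _ H A p inj x)
                                   (≈-trans (ADFEq⇒coef e A (subst (Bijective {X}) (sym p) bH))
                                            (≈-sym (coef-onTerms-preimage (eqF X) (eqF X) _ H A p inj y)))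
      ... | inj₂ n = ≈-trans (coef-onTerms-outside (eqF X) (eqF X) _ H n x) (≈-sym (coef-onTerms-outside (eqF X) (eqF X) _ H n y))

  module _ {X Y : FinSet} where
    private
      module ⋄W = ForestProduct K w (_≟ᴱ_ {X ⊎ˢ Y})
      eqW = eqF (X ⊎ˢ Y)
      μ : Forest (Elt X) → Forest (Elt Y) → Lin (Forest (Elt (X ⊎ˢ Y)))
      μ = mulBasis {X} {Y}
      expansion : Forest (Elt X) → Forest (Elt Y) → Lin (Forest (Elt (X ⊎ˢ Y)))
      expansion A A′ = ⋄W.rbExpansion (mapᶠ inj₁ A) (mapᶠ inj₂ A′)

    mulBind-graft : ∀ (x : Lin (Forest (Elt X))) (y : Lin (Forest (Elt Y))) →
                    mulBind {X} {Y} (graft x) (graft y) ≡ graft (bind x (λ A → bind y (expansion A)))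
    mulBind-graft x y = begin
      mulBind {X} {Y} (graft x) (graft y)
        ≡⟨ bind-onTerms (eqF X) (eqF X) (λ F → [ B⁺ F ]) x (λ F → bind (graft y) (mulBasis {X} {Y} F)) ⟩
      bind x (λ A → bind (graft y) (mulBasis {X} {Y} [ B⁺ A ]))
        ≡⟨ bind-cong-≡ x (λ A → bind-onTerms (eqF Y) (eqF Y) (λ F → [ B⁺ F ]) y (mulBasis {X} {Y} [ B⁺ A ])) ⟩
      bind x (λ A → bind y (λ A′ → mulBasis {X} {Y} [ B⁺ A ] [ B⁺ A′ ]))
        ≡⟨ bind-cong-≡ x (λ A → bind-cong-≡ y (λ A′ → ⋄W.[B⁺]⋄[B⁺] (mapᶠ inj₁ A) (mapᶠ inj₂ A′))) ⟩
      bind x (λ A → bind y (λ A′ → graft (expansion A A′)))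
        ≡˘⟨ trans (onTerms-bind (λ F → [ B⁺ F ]) x _) (bind-cong-≡ x (λ A → onTerms-bind (λ F → [ B⁺ F ]) y (expansion A))) ⟩
      graft (bind x (λ A → bind y (expansion A))) ∎
      where open P.≡-Reasoning

    bind-expansion : ∀ (x : Lin (Forest (Elt X))) (y : Lin (Forest (Elt Y))) →
                     CoefEq eqW (bind x (λ A → bind y (expansion A)))
                                (⋄W.rbTerms (mulADF {X} {Y} (graft x) y) (mulADF {X} {Y} x (graft y)) (mulADF {X} {Y} x y))
    bind-expansion x y = begin
      bind x (λ A → bind y (expansion A))
        ≈⟨ bind-congʳ (eqF X) eqW x (λ A → ⋄W.bind-rbTermsʳ (eqF Y) eqW y (μ [ B⁺ A ]) (λ A′ → μ A [ B⁺ A′ ]) (μ A)) ⟩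
      bind x (λ A → ⋄W.rbTerms (bind y (μ [ B⁺ A ])) (bind y (λ A′ → μ A [ B⁺ A′ ])) (bind y (μ A)))
        ≈⟨ ⋄W.bind-rbTermsʳ (eqF X) eqW x _ _ _ ⟩
      ⋄W.rbTerms (bind x (λ A → bind y (μ [ B⁺ A ]))) (bind x (λ A → bind y (λ A′ → μ A [ B⁺ A′ ]))) (mulBind {X} {Y} x y)
        ≈˘⟨ ⋄W.rbTerms-cong eqW (CoefEq-trans eqW (mulADF≈mulBind {X} {Y} (graft x) y) (≡⇒CoefEq eqW grafted-left))
                                (CoefEq-trans eqW (mulADF≈mulBind {X} {Y} x (graft y)) (≡⇒CoefEq eqW grafted-right))
                                (mulADF≈mulBind {X} {Y} x y) ⟩
      ⋄W.rbTerms (mulADF {X} {Y} (graft x) y) (mulADF {X} {Y} x (graft y)) (mulADF {X} {Y} x y) ∎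
      where
        open SR (CoefEq-setoid eqW)
        grafted-left : mulBind {X} {Y} (graft x) y ≡ bind x (λ A → bind y (μ [ B⁺ A ]))
        grafted-left = bind-onTerms (eqF X) (eqF X) (λ F → [ B⁺ F ]) x (λ F → bind y (μ F))
        grafted-right : mulBind {X} {Y} x (graft y) ≡ bind x (λ A → bind y (λ A′ → μ A [ B⁺ A′ ]))
        grafted-right = bind-cong-≡ x (λ A → bind-onTerms (eqF Y) (eqF Y) (λ F → [ B⁺ F ]) y (μ A))

    graft-rota-baxter : ∀ (x : Lin (Forest (Elt X))) (y : Lin (Forest (Elt Y))) →
                        ADFEq (X ⊎ˢ Y) (mulADF {X} {Y} (graft x) (graft y))
                              (graft ((mulADF {X} {Y} (graft x) y ++ mulADF {X} {Y} x (graft y)) ++ scale w (mulADF {X} {Y} x y)))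
    graft-rota-baxter x y = CoefEq⇒ADFEq (begin
      mulADF {X} {Y} (graft x) (graft y) ≈⟨ mulADF≈mulBind {X} {Y} (graft x) (graft y) ⟩
      mulBind {X} {Y} (graft x) (graft y) ≡⟨ mulBind-graft x y ⟩
      graft (bind x (λ A → bind y (expansion A))) ≈⟨ onTerms-cong eqW eqW _ ⋄W.[B⁺]-decodable (bind-expansion x y) ⟩
      graft (⋄W.rbTerms (mulADF {X} {Y} (graft x) y) (mulADF {X} {Y} x (graft y)) (mulADF {X} {Y} x y))
        ≡˘⟨ cong graft (++-assoc (mulADF {X} {Y} (graft x) y) (mulADF {X} {Y} x (graft y)) _) ⟩
      graft ((mulADF {X} {Y} (graft x) y ++ mulADF {X} {Y} x (graft y)) ++ scale w (mulADF {X} {Y} x y)) ∎)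
      where open SR (CoefEq-setoid eqW)

  isRotaBaxterADF : IsRBSpecies K w ADF
  isRotaBaxterADF = record
    { isSpecies = isSpeciesADF
    ; mul-cong = λ {X} {Y} {x} {x′} {y} {y′} e e′ → atBijective (mulADF-cong {X} {Y} {x} {x′} {y} {y′} (bijectivewise e) (bijectivewise e′))
    ; mul-+ˡ = λ {X} {Y} x x′ y → atBijective (CoefEq⇒ADFEq (mulADF-++ˡ {X} {Y} x x′ y))
    ; mul-+ʳ = λ {X} {Y} x y y′ → atBijective (CoefEq⇒ADFEq (mulADF-++ʳ {X} {Y} x y y′))
    ; mul-·ˡ = λ {X} {Y} a x y → atBijective (CoefEq⇒ADFEq (mulADF-scaleˡ {X} {Y} a x y))
    ; mul-·ʳ = λ {X} {Y} a x y → atBijective (CoefEq⇒ADFEq (mulADF-scaleʳ {X} {Y} a x y))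
    ; mul-natural = λ {X} {X′} {Y} {Y′} σ τ x y → atBijective (mulADF-natural {X} {X′} {Y} {Y′} σ τ x y)
    ; mul-assoc = λ {X} {Y} {Z} x y z → atBijective (mulADF-assoc {X} {Y} {Z} x y z)
    ; mul-unitˡ = λ {X} x → atBijective (mulADF-unitˡ {X} x)
    ; mul-unitʳ = λ {X} x → atBijective (mulADF-unitʳ {X} x)
    ; R-cong = λ {X} {x} {y} e → atBijective (graft-cong {X} {x} {y} (bijectivewise e))
    ; R-+ = λ {X} x y → atBijective (≡⇒ADFEq {X} (onTerms-++ (λ F → [ B⁺ F ]) x y))
    ; R-· = λ {X} a x → atBijective (≡⇒ADFEq {X} (onTerms-scale (λ F → [ B⁺ F ]) a x))
    ; R-natural = λ {X} {Y} σ x → atBijective (≡⇒ADFEq {Y} (onTerms-square (λ _ → refl) x))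
    ; rota-baxter = λ {X} {Y} x y → atBijective (graft-rota-baxter {X} {Y} x y)
    }

module Positions where

  open Decorations

  1ˢ : FinSet
  1ˢ = mkFinSet ⊤ 1 (mk↔ₛ′ (λ _ → Fin.zero) (λ _ → tt) (λ { Fin.zero → refl ; (Fin.suc ()) }) (λ { tt → refl }))

  mutual
    Anglesᵀ : ∀ {L : Set} → Tree L → FinSet
    Anglesᵀ • = ∅ˢ
    Anglesᵀ (B⁺ F) = Anglesᶠ F

    Anglesᶠ : ∀ {L : Set} → Forest L → FinSet
    Anglesᶠ [ T ] = Anglesᵀ T
    Anglesᶠ (T ⟨ x ⟩ F) = Anglesᵀ T ⊎ˢ (1ˢ ⊎ˢ Anglesᶠ F)

  mutual
    decorationᵀ : ∀ {L : Set} (T : Tree L) → Elt (Anglesᵀ T) → L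
    decorationᵀ • (lift ())
    decorationᵀ (B⁺ F) p = decorationᶠ F p

    decorationᶠ : ∀ {L : Set} (F : Forest L) → Elt (Anglesᶠ F) → L
    decorationᶠ [ T ] p = decorationᵀ T p
    decorationᶠ (T ⟨ x ⟩ F) (inj₁ p) = decorationᵀ T p
    decorationᶠ (T ⟨ x ⟩ F) (inj₂ (inj₁ _)) = x
    decorationᶠ (T ⟨ x ⟩ F) (inj₂ (inj₂ q)) = decorationᶠ F q

  mutual
    canonicalᵀ : ∀ {L : Set} (T : Tree L) → Tree (Elt (Anglesᵀ T))
    canonicalᵀ • = •
    canonicalᵀ (B⁺ F) = B⁺ (canonicalᶠ F)

    canonicalᶠ : ∀ {L : Set} (F : Forest L) → Forest (Elt (Anglesᶠ F))
    canonicalᶠ [ T ] = [ canonicalᵀ T ]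
    canonicalᶠ (T ⟨ x ⟩ F) = mapᵀ inj₁ (canonicalᵀ T) ⟨ inj₂ (inj₁ tt) ⟩ mapᶠ (λ q → inj₂ (inj₂ q)) (canonicalᶠ F)

  mutual
    decorate-canonicalᵀ : ∀ {L : Set} (T : Tree L) → mapᵀ (decorationᵀ T) (canonicalᵀ T) ≡ T
    decorate-canonicalᵀ • = refl
    decorate-canonicalᵀ (B⁺ F) = cong B⁺ (decorate-canonicalᶠ F)

    decorate-canonicalᶠ : ∀ {L : Set} (F : Forest L) → mapᶠ (decorationᶠ F) (canonicalᶠ F) ≡ F
    decorate-canonicalᶠ [ T ] = cong [_] (decorate-canonicalᵀ T)
    decorate-canonicalᶠ (T ⟨ x ⟩ F) = cong₂ (λ a b → a ⟨ x ⟩ b)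
      (trans (mapᵀ-∘ (decorationᶠ (T ⟨ x ⟩ F)) inj₁ (canonicalᵀ T)) (decorate-canonicalᵀ T))
      (trans (mapᶠ-∘ (decorationᶠ (T ⟨ x ⟩ F)) (λ q → inj₂ (inj₂ q)) (canonicalᶠ F)) (decorate-canonicalᶠ F))

  enumerates-∅ : Enumerates ∅ˢ []
  enumerates-∅ = [] , λ { (lift ()) }

  enumerates-1 : Enumerates 1ˢ (tt ∷ [])
  enumerates-1 = ([] ∷ []) , λ { tt → here refl }

  mutual
    canonicalᵀ-bijective : ∀ {L : Set} (T : Tree L) → Enumerates (Anglesᵀ T) (labelsᵀ (canonicalᵀ T))
    canonicalᵀ-bijective • = enumerates-∅
    canonicalᵀ-bijective (B⁺ F) = canonicalᶠ-bijective F

    canonicalᶠ-bijective : ∀ {L : Set} (F : Forest L) → Enumerates (Anglesᶠ F) (labelsᶠ (canonicalᶠ F))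
    canonicalᶠ-bijective [ T ] = canonicalᵀ-bijective T
    canonicalᶠ-bijective (T ⟨ x ⟩ F) = subst (Enumerates (Anglesᶠ (T ⟨ x ⟩ F))) (sym e)
       (enumerates-join (Anglesᵀ T) (1ˢ ⊎ˢ Anglesᶠ F) (labelsᵀ (canonicalᵀ T)) (inj₁ tt ∷ map inj₂ (labelsᶠ (canonicalᶠ F))) (canonicalᵀ-bijective T)
                   (enumerates-join 1ˢ (Anglesᶠ F) (tt ∷ []) (labelsᶠ (canonicalᶠ F)) enumerates-1 (canonicalᶠ-bijective F)))
      where
        e : labelsᶠ (canonicalᶠ (T ⟨ x ⟩ F)) ≡ map inj₁ (labelsᵀ (canonicalᵀ T)) ++ map inj₂ (inj₁ tt ∷ map inj₂ (labelsᶠ (canonicalᶠ F)))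
        e = cong₂ (λ a b → a ++ (inj₂ (inj₁ tt) ∷ b)) (labelsᵀ-map inj₁ (canonicalᵀ T))
              (trans (labelsᶠ-map (λ q → inj₂ (inj₂ q)) (canonicalᶠ F)) (map-∘ (labelsᶠ (canonicalᶠ F))))


  unique-map-injective : ∀ {A B : Set} (f : A → B) (xs : List A) → Unique (map f xs) → ∀ {p q} → p ∈ xs → q ∈ xs → f p ≡ f q → p ≡ q
  unique-map-injective f (x ∷ xs) (h ∷ u) (here refl) (here refl) e = refl
  unique-map-injective f (x ∷ xs) (h ∷ u) (here refl) (there q∈) e = ⊥-elim (All.lookup h (∈-map⁺ f q∈) e)
  unique-map-injective f (x ∷ xs) (h ∷ u) (there p∈) (here refl) e = ⊥-elim (All.lookup h (∈-map⁺ f p∈) (sym e))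
  unique-map-injective f (x ∷ xs) (h ∷ u) (there p∈) (there q∈) e = unique-map-injective f xs u p∈ q∈ e

  labels-canonical : ∀ {L : Set} (F : Forest L) → labelsᶠ F ≡ map (decorationᶠ F) (labelsᶠ (canonicalᶠ F))
  labels-canonical F = trans (cong labelsᶠ (sym (decorate-canonicalᶠ F))) (labelsᶠ-map (decorationᶠ F) (canonicalᶠ F))

  module _ {X : FinSet} (F : Forest (Elt X)) (b : Bijective {X} F) where
    private
      angles = labelsᶠ (canonicalᶠ F)
      unique : Unique (map (decorationᶠ F) angles)
      unique = subst Unique (labels-canonical F) (proj₁ b)
      preimage : ∀ z → Σ (Elt (Anglesᶠ F)) (λ p → p ∈ angles × z ≡ decorationᶠ F p)
      preimage z = ∈-map⁻ (decorationᶠ F) (subst (z ∈_) (labels-canonical F) (proj₂ b z))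

    decorationIso : Anglesᶠ F ≅ X
    decorationIso = bij (mk↔ₛ′ (decorationᶠ F) (λ z → proj₁ (preimage z)) (λ z → sym (proj₂ (proj₂ (preimage z))))
      (λ p → unique-map-injective (decorationᶠ F) angles unique (proj₁ (proj₂ (preimage (decorationᶠ F p))))
               (proj₂ (canonicalᶠ-bijective F) p) (sym (proj₂ (proj₂ (preimage (decorationᶠ F p)))))))

  mutual
    anglesᵀ-map : ∀ {L L′ : Set} (f : L → L′) (T : Tree L) → Anglesᵀ (mapᵀ f T) ≅ Anglesᵀ T
    anglesᵀ-map f • = idᵇ ∅ˢ
    anglesᵀ-map f (B⁺ F) = anglesᶠ-map f F

    anglesᶠ-map : ∀ {L L′ : Set} (f : L → L′) (F : Forest L) → Anglesᶠ (mapᶠ f F) ≅ Anglesᶠ F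
    anglesᶠ-map f [ T ] = anglesᵀ-map f T
    anglesᶠ-map f (T ⟨ x ⟩ F) = anglesᵀ-map f T ⊎ᵇ (idᵇ 1ˢ ⊎ᵇ anglesᶠ-map f F)

  mutual
    decorationᵀ-map : ∀ {L L′ : Set} (f : L → L′) (T : Tree L) p → decorationᵀ (mapᵀ f T) p ≡ f (decorationᵀ T (app (anglesᵀ-map f T) p))
    decorationᵀ-map f • (lift ())
    decorationᵀ-map f (B⁺ F) p = decorationᶠ-map f F p

    decorationᶠ-map : ∀ {L L′ : Set} (f : L → L′) (F : Forest L) p → decorationᶠ (mapᶠ f F) p ≡ f (decorationᶠ F (app (anglesᶠ-map f F) p))
    decorationᶠ-map f [ T ] p = decorationᵀ-map f T p
    decorationᶠ-map f (T ⟨ x ⟩ F) (inj₁ p) = decorationᵀ-map f T p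
    decorationᶠ-map f (T ⟨ x ⟩ F) (inj₂ (inj₁ _)) = refl
    decorationᶠ-map f (T ⟨ x ⟩ F) (inj₂ (inj₂ q)) = decorationᶠ-map f F q

module CanonicalForests {c ℓ} (K : Field c ℓ) (w : Field.Carrier K) where

  open Field K using (1#)
  open ADF K w
  open LinearCombination K
  open Decorations
  open Positions
  open ADFSpecies K w
  open ADFProduct K w

  tf-• : ∀ {L : Set} (G : Forest L) → tf • G ≡ (1# , G) ∷ []
  tf-• [ T ] = refl
  tf-• (T ⟨ y ⟩ G) = refl

  singleton : ∀ {A : Set} → A → Lin A
  singleton F = (1# , F) ∷ []

  mulADF-singletons : ∀ {X Y} (F : Forest (Elt X)) (G : Forest (Elt Y)) →
                      CoefEq (eqF (X ⊎ˢ Y)) (mulADF {X} {Y} (singleton F) (singleton G)) (mulBasis {X} {Y} F G)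
  mulADF-singletons {X} {Y} F G =
    CoefEq-trans (eqF (X ⊎ˢ Y)) (mulADF≈mulBind {X} {Y} (singleton F) (singleton G))
      (CoefEq-trans (eqF (X ⊎ˢ Y)) (bind-unitˡ (eqF X) (eqF (X ⊎ˢ Y)) F (λ E → bind (singleton G) (mulBasis {X} {Y} E)))
                                   (bind-unitˡ (eqF Y) (eqF (X ⊎ˢ Y)) G (mulBasis {X} {Y} F)))

  canonical-cons : ∀ {L : Set} (T : Tree L) (x : L) (F : Forest L) →
                   ADFEq (Anglesᶠ (T ⟨ x ⟩ F))
                         (mulADF {Anglesᵀ T} {1ˢ ⊎ˢ Anglesᶠ F} (singleton [ canonicalᵀ T ])
                                 (mulADF {1ˢ} {Anglesᶠ F} (singleton •⟨ tt ⟩•) (singleton (canonicalᶠ F))))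
                         (singleton (canonicalᶠ (T ⟨ x ⟩ F)))
  canonical-cons T x F = CoefEq⇒ADFEq (begin
      mulADF {Anglesᵀ T} {V} (singleton [ canonicalᵀ T ]) v
        ≈⟨ CoefEq-trans eqW (mulADF≈mulBind {Anglesᵀ T} {V} (singleton [ canonicalᵀ T ]) v)
             (CoefEq-trans eqW (bind-unitˡ (eqF (Anglesᵀ T)) eqW [ canonicalᵀ T ] (λ E → bind v (mulBasis {Anglesᵀ T} {V} E)))
                               (bind-congˡ (eqF V) eqW v (singleton tail) (mulBasis {Anglesᵀ T} {V} [ canonicalᵀ T ]) tail-eq)) ⟩
      bind (singleton tail) (mulBasis {Anglesᵀ T} {V} [ canonicalᵀ T ])
        ≈⟨ bind-unitˡ (eqF V) eqW tail (mulBasis {Anglesᵀ T} {V} [ canonicalᵀ T ]) ⟩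
      mulBasis {Anglesᵀ T} {V} [ canonicalᵀ T ] tail
        ≡⟨ trans (cong (onTerms (_⟨ inj₂ (inj₁ tt) ⟩ mapᶠ inj₂ (mapᶠ inj₂ (canonicalᶠ F))))
                       (ForestProduct.⋄ᵀ-• K w (_≟ᴱ_ {W}) (mapᵀ inj₁ (canonicalᵀ T))))
                 (cong (λ z → singleton (mapᵀ inj₁ (canonicalᵀ T) ⟨ inj₂ (inj₁ tt) ⟩ z)) (mapᶠ-∘ inj₂ inj₂ (canonicalᶠ F))) ⟩
      singleton (canonicalᶠ (T ⟨ x ⟩ F)) ∎)
    where
      V = 1ˢ ⊎ˢ Anglesᶠ F
      W = Anglesᵀ T ⊎ˢ V
      eqW = eqF W
      tail : Forest (Elt V)
      tail = • ⟨ inj₁ tt ⟩ mapᶠ inj₂ (canonicalᶠ F)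
      v = mulADF {1ˢ} {Anglesᶠ F} (singleton •⟨ tt ⟩•) (singleton (canonicalᶠ F))
      tail-eq : CoefEq (eqF V) v (singleton tail)
      tail-eq = CoefEq-trans (eqF V) (mulADF-singletons {1ˢ} {Anglesᶠ F} •⟨ tt ⟩• (canonicalᶠ F))
                  (≡⇒CoefEq (eqF V) (cong (onTerms (• ⟨ inj₁ tt ⟩_)) (tf-• (mapᶠ inj₂ (canonicalᶠ F)))))
      open SR (CoefEq-setoid eqW)

module TrackedProduct {c ℓ} (K : Field c ℓ) (w : Field.Carrier K) {L : Set} where
  open Field K using (1#)
  open ADF K w using (Lin; onTerms; scale; _⋄ᵀ_; tf; ft; ff)
  open LinearCombination K
  open ForestProductDecorations K w
  open Decorations
  open Positions

  -- A tracked tree or forest over Z comes with a bijection from its angles onto Z.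
  -- The tracked product computes T ⋄ T′ while recording which angle of each term
  -- comes from which factor.
  Trackedᵀ : FinSet → Set
  Trackedᵀ Z = Σ (Tree L) (λ U → Anglesᵀ U ≅ Z)
  Trackedᶠ : FinSet → Set
  Trackedᶠ Z = Σ (Forest L) (λ H → Anglesᶠ H ≅ Z)

  trackB⁺ : ∀ {Z} → Trackedᶠ Z → Trackedᵀ Z
  trackB⁺ (H , θ) = (B⁺ H , θ)
  track[] : ∀ {Z} → Trackedᵀ Z → Trackedᶠ Z
  track[] (U , θ) = ([ U ] , θ)

  trackHead : ∀ X Y (y : L) (G : Forest L) → Trackedᵀ (X ⊎ˢ Y) → Trackedᶠ (X ⊎ˢ (Y ⊎ˢ (1ˢ ⊎ˢ Anglesᶠ G)))
  trackHead X Y y G (U , θ) = (U ⟨ y ⟩ G , (assocᵇ X Y (1ˢ ⊎ˢ Anglesᶠ G) ∘ᵇ (θ ⊎ᵇ idᵇ (1ˢ ⊎ˢ Anglesᶠ G))))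

  trackCons : ∀ Y Z (T : Tree L) (x : L) → Trackedᶠ (Y ⊎ˢ Z) → Trackedᶠ ((Anglesᵀ T ⊎ˢ (1ˢ ⊎ˢ Y)) ⊎ˢ Z)
  trackCons Y Z T x (H , θ) = (T ⟨ x ⟩ H , (symᵇ (assocᵇ (Anglesᵀ T) (1ˢ ⊎ˢ Y) Z) ∘ᵇ
                              (idᵇ (Anglesᵀ T) ⊎ᵇ (symᵇ (assocᵇ 1ˢ Y Z) ∘ᵇ (idᵇ 1ˢ ⊎ᵇ θ)))))

  mutual
    ⋄ᵀ-tracked : (T T′ : Tree L) → Lin (Trackedᵀ (Anglesᵀ T ⊎ˢ Anglesᵀ T′))
    ⋄ᵀ-tracked • T′ = (1# , (T′ , symᵇ (unitˡᵇ (Anglesᵀ T′)))) ∷ []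
    ⋄ᵀ-tracked (B⁺ A) • = (1# , (B⁺ A , symᵇ (unitʳᵇ (Anglesᶠ A)))) ∷ []
    ⋄ᵀ-tracked (B⁺ A) (B⁺ A′) = onTerms trackB⁺ (tf-tracked (B⁺ A) A′) ++ onTerms trackB⁺ (ft-tracked A (B⁺ A′)) ++ scale w (onTerms trackB⁺ (ff-tracked A A′))

    tf-tracked : (T : Tree L) (G : Forest L) → Lin (Trackedᶠ (Anglesᵀ T ⊎ˢ Anglesᶠ G))
    tf-tracked T [ T′ ] = onTerms track[] (⋄ᵀ-tracked T T′)
    tf-tracked T (T′ ⟨ y ⟩ G) = onTerms (trackHead (Anglesᵀ T) (Anglesᵀ T′) y G) (⋄ᵀ-tracked T T′)

    ft-tracked : (F : Forest L) (T′ : Tree L) → Lin (Trackedᶠ (Anglesᶠ F ⊎ˢ Anglesᵀ T′))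
    ft-tracked [ T ] T′ = onTerms track[] (⋄ᵀ-tracked T T′)
    ft-tracked (T ⟨ x ⟩ F) T′ = onTerms (trackCons (Anglesᶠ F) (Anglesᵀ T′) T x) (ft-tracked F T′)

    ff-tracked : (F G : Forest L) → Lin (Trackedᶠ (Anglesᶠ F ⊎ˢ Anglesᶠ G))
    ff-tracked [ T ] G = tf-tracked T G
    ff-tracked (T ⟨ x ⟩ F) G = onTerms (trackCons (Anglesᶠ F) (Anglesᶠ G) T x) (ff-tracked F G)

  mutual
    untrack-⋄ᵀ : ∀ (T T′ : Tree L) → onTerms proj₁ (⋄ᵀ-tracked T T′) ≡ T ⋄ᵀ T′
    untrack-⋄ᵀ • T′ = refl
    untrack-⋄ᵀ (B⁺ A) • = refl
    untrack-⋄ᵀ (B⁺ A) (B⁺ A′) = begin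
        onTerms proj₁ (onTerms trackB⁺ X ++ onTerms trackB⁺ Y ++ scale w (onTerms trackB⁺ Z))
          ≡⟨ onTerms-rbTerms proj₁ (onTerms trackB⁺ X) (onTerms trackB⁺ Y) (onTerms trackB⁺ Z) ⟩
        onTerms proj₁ (onTerms trackB⁺ X) ++ onTerms proj₁ (onTerms trackB⁺ Y) ++ scale w (onTerms proj₁ (onTerms trackB⁺ Z))
          ≡⟨ cong₂ _++_ (untrack-B⁺ X) (cong₂ (λ a b → a ++ scale w b) (untrack-B⁺ Y) (untrack-B⁺ Z)) ⟩
        onTerms B⁺ (onTerms proj₁ X) ++ onTerms B⁺ (onTerms proj₁ Y) ++ scale w (onTerms B⁺ (onTerms proj₁ Z))
          ≡⟨ cong₂ _++_ (cong (onTerms B⁺) (untrack-tf (B⁺ A) A′))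
                        (cong₂ (λ a b → onTerms B⁺ a ++ scale w (onTerms B⁺ b)) (untrack-ft A (B⁺ A′)) (untrack-ff A A′)) ⟩
        B⁺ A ⋄ᵀ B⁺ A′ ∎
      where
        open P.≡-Reasoning
        X = tf-tracked (B⁺ A) A′
        Y = ft-tracked A (B⁺ A′)
        Z = ff-tracked A A′
        untrack-B⁺ : ∀ {W} (u : Lin (Trackedᶠ W)) → onTerms proj₁ (onTerms trackB⁺ u) ≡ onTerms B⁺ (onTerms proj₁ u)
        untrack-B⁺ = onTerms-square (λ _ → refl)

    untrack-tf : ∀ (T : Tree L) (G : Forest L) → onTerms proj₁ (tf-tracked T G) ≡ tf T G
    untrack-tf T [ T′ ] = trans (onTerms-square (λ _ → refl) (⋄ᵀ-tracked T T′)) (cong (onTerms [_]) (untrack-⋄ᵀ T T′))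
    untrack-tf T (T′ ⟨ y ⟩ G) = trans (onTerms-square (λ _ → refl) (⋄ᵀ-tracked T T′)) (cong (onTerms (_⟨ y ⟩ G)) (untrack-⋄ᵀ T T′))

    untrack-ft : ∀ (F : Forest L) (T′ : Tree L) → onTerms proj₁ (ft-tracked F T′) ≡ ft F T′
    untrack-ft [ T ] T′ = trans (onTerms-square (λ _ → refl) (⋄ᵀ-tracked T T′)) (cong (onTerms [_]) (untrack-⋄ᵀ T T′))
    untrack-ft (T ⟨ x ⟩ F) T′ = trans (onTerms-square (λ _ → refl) (ft-tracked F T′)) (cong (onTerms (T ⟨ x ⟩_)) (untrack-ft F T′))

    untrack-ff : ∀ (F G : Forest L) → onTerms proj₁ (ff-tracked F G) ≡ ff F G
    untrack-ff [ T ] G = untrack-tf T G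
    untrack-ff (T ⟨ x ⟩ F) G = trans (onTerms-square (λ _ → refl) (ff-tracked F G)) (cong (onTerms (T ⟨ x ⟩_)) (untrack-ff F G))

  Respectsᵀ : ∀ (X Y : FinSet) → (Elt X → L) → (Elt Y → L) → Trackedᵀ (X ⊎ˢ Y) → Set
  Respectsᵀ X Y fX fY (U , θ) = ∀ p → decorationᵀ U p ≡ case⊎ fX fY (app θ p)
  Respectsᶠ : ∀ (X Y : FinSet) → (Elt X → L) → (Elt Y → L) → Trackedᶠ (X ⊎ˢ Y) → Set
  Respectsᶠ X Y fX fY (H , θ) = ∀ p → decorationᶠ H p ≡ case⊎ fX fY (app θ p)

  trackHead-respects : ∀ (T T′ : Tree L) y (G : Forest L) (e : Trackedᵀ (Anglesᵀ T ⊎ˢ Anglesᵀ T′)) → Respectsᵀ (Anglesᵀ T) (Anglesᵀ T′) (decorationᵀ T) (decorationᵀ T′) e →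
          Respectsᶠ (Anglesᵀ T) (Anglesᶠ (T′ ⟨ y ⟩ G)) (decorationᵀ T) (decorationᶠ (T′ ⟨ y ⟩ G)) (trackHead (Anglesᵀ T) (Anglesᵀ T′) y G e)
  trackHead-respects T T′ y G (U , θ) h (inj₁ q) with app θ q | h q
  ... | inj₁ a | e = e
  ... | inj₂ b | e = e
  trackHead-respects T T′ y G (U , θ) h (inj₂ (inj₁ _)) = refl
  trackHead-respects T T′ y G (U , θ) h (inj₂ (inj₂ s)) = refl

  trackCons-respects : ∀ {Z : FinSet} (T : Tree L) x (F : Forest L) (fZ : Elt Z → L) (e : Trackedᶠ (Anglesᶠ F ⊎ˢ Z)) → Respectsᶠ (Anglesᶠ F) Z (decorationᶠ F) fZ e →
          Respectsᶠ (Anglesᶠ (T ⟨ x ⟩ F)) Z (decorationᶠ (T ⟨ x ⟩ F)) fZ (trackCons (Anglesᶠ F) Z T x e)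
  trackCons-respects T x F fZ (H , θ) h (inj₁ a) = refl
  trackCons-respects T x F fZ (H , θ) h (inj₂ (inj₁ _)) = refl
  trackCons-respects T x F fZ (H , θ) h (inj₂ (inj₂ q)) with app θ q | h q
  ... | inj₁ f | e = e
  ... | inj₂ t | e = e

  mutual
    ⋄ᵀ-tracked-respects : ∀ (T T′ : Tree L) → AllTerms (Respectsᵀ (Anglesᵀ T) (Anglesᵀ T′) (decorationᵀ T) (decorationᵀ T′)) (⋄ᵀ-tracked T T′)
    ⋄ᵀ-tracked-respects • T′ = (λ p → refl) ∷ []
    ⋄ᵀ-tracked-respects (B⁺ A) • = (λ p → refl) ∷ []
    ⋄ᵀ-tracked-respects (B⁺ A) (B⁺ A′) = AllP.++⁺ (AllTerms-onTerms trackB⁺ (λ h → h) (tf-tracked-respects (B⁺ A) A′))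
                           (AllP.++⁺ (AllTerms-onTerms trackB⁺ (λ h → h) (ft-tracked-respects A (B⁺ A′)))
                                   (AllTerms-scale w (AllTerms-onTerms trackB⁺ (λ h → h) (ff-tracked-respects A A′))))

    tf-tracked-respects : ∀ (T : Tree L) (G : Forest L) → AllTerms (Respectsᶠ (Anglesᵀ T) (Anglesᶠ G) (decorationᵀ T) (decorationᶠ G)) (tf-tracked T G)
    tf-tracked-respects T [ T′ ] = AllTerms-onTerms track[] (λ h → h) (⋄ᵀ-tracked-respects T T′)
    tf-tracked-respects T (T′ ⟨ y ⟩ G) = AllTerms-onTerms (trackHead (Anglesᵀ T) (Anglesᵀ T′) y G) (λ {e} h → trackHead-respects T T′ y G e h) (⋄ᵀ-tracked-respects T T′)

    ft-tracked-respects : ∀ (F : Forest L) (T′ : Tree L) → AllTerms (Respectsᶠ (Anglesᶠ F) (Anglesᵀ T′) (decorationᶠ F) (decorationᵀ T′)) (ft-tracked F T′)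
    ft-tracked-respects [ T ] T′ = AllTerms-onTerms track[] (λ h → h) (⋄ᵀ-tracked-respects T T′)
    ft-tracked-respects (T ⟨ x ⟩ F) T′ = AllTerms-onTerms (trackCons (Anglesᶠ F) (Anglesᵀ T′) T x) (λ {e} h → trackCons-respects {Anglesᵀ T′} T x F (decorationᵀ T′) e h) (ft-tracked-respects F T′)

    ff-tracked-respects : ∀ (F G : Forest L) → AllTerms (Respectsᶠ (Anglesᶠ F) (Anglesᶠ G) (decorationᶠ F) (decorationᶠ G)) (ff-tracked F G)
    ff-tracked-respects [ T ] G = tf-tracked-respects T G
    ff-tracked-respects (T ⟨ x ⟩ F) G = AllTerms-onTerms (trackCons (Anglesᶠ F) (Anglesᶠ G) T x) (λ {e} h → trackCons-respects {Anglesᶠ G} T x F (decorationᶠ G) e h) (ff-tracked-respects F G)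

module RotaBaxterSpeciesProperties {c ℓ m ℓm} (K : Field c ℓ) (w : Field.Carrier K) (Q : RBSpecies K w m ℓm) where

  open Field K renaming (Carrier to k; refl to ≈-refl; sym to ≈-sym; trans to ≈-trans)
  open ADF K w using (Lin; scale)
  open LinearCombination K
  open Decorations
  module Q = RBSpecies Q
  module QS = IsSpecies Q.isSpecies

  vectorSpace : FinSet → LeftModule ring m ℓm
  vectorSpace X = record { Carrierᴹ = Q.Obj X ; _≈ᴹ_ = Q._≈_ ; _+ᴹ_ = Q._+_ ; _*ₗ_ = Q._·_ ; 0ᴹ = Q.0ᴹ ; -ᴹ_ = Q.-_
                ; isLeftModule = QS.isVectorSpace X }

  module V (X : FinSet) = LeftModule (vectorSpace X)

  ∑ᵠ : ∀ (X : FinSet) {A : Set} → (A → Q.Obj X) → Lin A → Q.Obj X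
  ∑ᵠ X = Sum.∑ (vectorSpace X)

  module ≈ᵠ-Reasoning (X : FinSet) = SR (V.≈ᴹ-setoid X)

  ≈ᵠ-refl : ∀ {X} {x : Q.Obj X} → Q._≈_ x x
  ≈ᵠ-refl {X} = V.≈ᴹ-refl X
  ≈ᵠ-sym : ∀ {X} {x y : Q.Obj X} → Q._≈_ x y → Q._≈_ y x
  ≈ᵠ-sym {X} = V.≈ᴹ-sym X
  ≈ᵠ-trans : ∀ {X} {x y z : Q.Obj X} → Q._≈_ x y → Q._≈_ y z → Q._≈_ x z
  ≈ᵠ-trans {X} = V.≈ᴹ-trans X

  ≈ᵠ-reflexive : ∀ {X} {x y : Q.Obj X} → x ≡ y → Q._≈_ x y
  ≈ᵠ-reflexive refl = ≈ᵠ-refl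

  module _ {X Y : FinSet} (f : Q.Obj X → Q.Obj Y)
           (f-cong : ∀ {x y} → Q._≈_ x y → Q._≈_ (f x) (f y))
           (f-+ : ∀ x y → Q._≈_ (f (Q._+_ x y)) (Q._+_ (f x) (f y)))
           (f-· : ∀ a x → Q._≈_ (f (Q._·_ a x)) (Q._·_ a (f x))) where
    linear-0 : Q._≈_ (f Q.0ᴹ) Q.0ᴹ
    linear-0 = ≈ᵠ-trans (f-cong (≈ᵠ-sym (V.*ₗ-zeroˡ X Q.0ᴹ))) (≈ᵠ-trans (f-· 0# Q.0ᴹ) (V.*ₗ-zeroˡ Y (f Q.0ᴹ)))

    linear-∑ : ∀ {A : Set} (h : A → Q.Obj X) (u : Lin A) → Q._≈_ (f (∑ᵠ X h u)) (∑ᵠ Y (λ t → f (h t)) u)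
    linear-∑ h [] = linear-0
    linear-∑ h ((a , t) ∷ u) = ≈ᵠ-trans (f-+ _ _) (V.+ᴹ-cong Y (f-· a (h t)) (linear-∑ h u))

  relabel-ext : ∀ {X Y} (σ τ : X ≅ Y) → (∀ a → app σ a ≡ app τ a) → ∀ x → Q._≈_ (Q.relabel σ x) (Q.relabel τ x)
  relabel-ext σ τ e x = QS.relabel-cong σ τ e ≈ᵠ-refl

  relabel-∑ : ∀ {X Y} (σ : X ≅ Y) {A : Set} (h : A → Q.Obj X) (u : Lin A) → Q._≈_ (Q.relabel σ (∑ᵠ X h u)) (∑ᵠ Y (λ t → Q.relabel σ (h t)) u)
  relabel-∑ σ = linear-∑ (Q.relabel σ) (QS.relabel-cong σ σ (λ _ → refl)) (QS.relabel-+ σ) (QS.relabel-· σ)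

  R-∑ : ∀ {X} {A : Set} (h : A → Q.Obj X) (u : Lin A) → Q._≈_ (Q.R (∑ᵠ X h u)) (∑ᵠ X (λ t → Q.R (h t)) u)
  R-∑ = linear-∑ Q.R Q.R-cong Q.R-+ Q.R-·

  mul-∑ˡ : ∀ {X Y} (y : Q.Obj Y) {A : Set} (h : A → Q.Obj X) (u : Lin A) →
           Q._≈_ (Q.mul (∑ᵠ X h u) y) (∑ᵠ (X ⊎ˢ Y) (λ t → Q.mul (h t) y) u)
  mul-∑ˡ y = linear-∑ (λ x → Q.mul x y) (λ e → Q.mul-cong e ≈ᵠ-refl) (λ x x′ → Q.mul-+ˡ x x′ y) (λ a x → Q.mul-·ˡ a x y)

  mul-∑ʳ : ∀ {X Y} (x : Q.Obj X) {A : Set} (h : A → Q.Obj Y) (u : Lin A) →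
           Q._≈_ (Q.mul x (∑ᵠ Y h u)) (∑ᵠ (X ⊎ˢ Y) (λ t → Q.mul x (h t)) u)
  mul-∑ʳ x = linear-∑ (λ y → Q.mul x y) (λ e → Q.mul-cong ≈ᵠ-refl e) (λ y y′ → Q.mul-+ʳ x y y′) (λ a y → Q.mul-·ʳ a x y)

  relabel-∘′ : ∀ {X Y Z} (σ : X ≅ Y) (τ : Y ≅ Z) x → Q._≈_ (Q.relabel τ (Q.relabel σ x)) (Q.relabel (τ ∘ᵇ σ) x)
  relabel-∘′ σ τ x = ≈ᵠ-sym (QS.relabel-∘ σ τ x)

  relabel-inverseˡ : ∀ {X Y} (σ : X ≅ Y) x → Q._≈_ (Q.relabel (symᵇ σ) (Q.relabel σ x)) x
  relabel-inverseˡ σ x = ≈ᵠ-trans (relabel-∘′ σ (symᵇ σ) x) (≈ᵠ-trans (relabel-ext (symᵇ σ ∘ᵇ σ) (idᵇ _) (Inverse.strictlyInverseʳ (iso σ)) x)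
                 (QS.relabel-id x))

  mul-assoc⁻ : ∀ {X Y Z} (x : Q.Obj X) (y : Q.Obj Y) (z : Q.Obj Z) →
           Q._≈_ (Q.mul (Q.mul x y) z) (Q.relabel (symᵇ (assocᵇ X Y Z)) (Q.mul x (Q.mul y z)))
  mul-assoc⁻ {X} {Y} {Z} x y z = ≈ᵠ-trans (≈ᵠ-sym (relabel-inverseˡ (assocᵇ X Y Z) (Q.mul (Q.mul x y) z)))
                                    (QS.relabel-cong _ _ (λ _ → refl) (Q.mul-assoc x y z))

  mul-unitˡ⁻ : ∀ {X} (x : Q.Obj X) → Q._≈_ (Q.mul Q.unit x) (Q.relabel (symᵇ (unitˡᵇ X)) x)
  mul-unitˡ⁻ {X} x = ≈ᵠ-trans (≈ᵠ-sym (relabel-inverseˡ (unitˡᵇ X) (Q.mul Q.unit x))) (QS.relabel-cong _ _ (λ _ → refl) (Q.mul-unitˡ x))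

  mul-unitʳ⁻ : ∀ {X} (x : Q.Obj X) → Q._≈_ (Q.mul x Q.unit) (Q.relabel (symᵇ (unitʳᵇ X)) x)
  mul-unitʳ⁻ {X} x = ≈ᵠ-trans (≈ᵠ-sym (relabel-inverseˡ (unitʳᵇ X) (Q.mul x Q.unit))) (QS.relabel-cong _ _ (λ _ → refl) (Q.mul-unitʳ x))

  relabel-0 : ∀ {X Y} (σ : X ≅ Y) → Q._≈_ (Q.relabel σ Q.0ᴹ) Q.0ᴹ
  relabel-0 σ = linear-0 (Q.relabel σ) (QS.relabel-cong σ σ (λ _ → refl)) (QS.relabel-+ σ) (QS.relabel-· σ)

  R-0 : ∀ {X} → Q._≈_ (Q.R {X} Q.0ᴹ) Q.0ᴹ
  R-0 = linear-0 Q.R Q.R-cong Q.R-+ Q.R-·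

  mul-0ˡ : ∀ {X Y} (y : Q.Obj Y) → Q._≈_ (Q.mul {X} {Y} Q.0ᴹ y) Q.0ᴹ
  mul-0ˡ y = linear-0 (λ x → Q.mul x y) (λ e → Q.mul-cong e ≈ᵠ-refl) (λ x x′ → Q.mul-+ˡ x x′ y) (λ a x → Q.mul-·ˡ a x y)

  mul-0ʳ : ∀ {X Y} (x : Q.Obj X) → Q._≈_ (Q.mul {X} {Y} x Q.0ᴹ) Q.0ᴹ
  mul-0ʳ x = linear-0 (λ y → Q.mul x y) (λ e → Q.mul-cong ≈ᵠ-refl e) (λ y y′ → Q.mul-+ʳ x y y′) (λ a y → Q.mul-·ʳ a x y)

  linear-[] : ∀ {X} {A : Set} (f : Lin A → Q.Obj X) → (∀ a u → Q._≈_ (f (scale a u)) (Q._·_ a (f u))) → Q._≈_ (f []) Q.0ᴹ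
  linear-[] {X} f f-scale = ≈ᵠ-trans (f-scale 0# []) (V.*ₗ-zeroˡ X _)

  -- The last hypothesis holds for any f that respects coefficientwise equality.
  linear-as-∑ : ∀ {X} {A : Set} (f : Lin A → Q.Obj X) →
                (∀ u v → Q._≈_ (f (u ++ v)) (Q._+_ (f u) (f v))) → (∀ a u → Q._≈_ (f (scale a u)) (Q._·_ a (f u))) →
                (∀ a t → Q._≈_ (f ((a , t) ∷ [])) (f ((a * 1# , t) ∷ []))) →
                ∀ u → Q._≈_ (f u) (∑ᵠ X (λ t → f ((1# , t) ∷ [])) u)
  linear-as-∑ f f-++ f-scale f-coef [] = linear-[] f f-scale
  linear-as-∑ {X} f f-++ f-scale f-coef ((a , t) ∷ u) =
    ≈ᵠ-trans (f-++ ((a , t) ∷ []) u)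
             (V.+ᴹ-cong X (≈ᵠ-trans (f-coef a t) (f-scale a ((1# , t) ∷ []))) (linear-as-∑ f f-++ f-scale f-coef u))

module Evaluation {c ℓ m ℓm} (K : Field c ℓ) (w : Field.Carrier K) (Q : RBSpecies K w m ℓm) (g₁ : RBSpecies.Obj Q Positions.1ˢ) where

  open Field K renaming (Carrier to k; refl to ≈-refl; sym to ≈-sym; trans to ≈-trans)
  open ADF K w
  open LinearCombination K
  open Decorations
  open Positions
  open TrackedProduct K w
  open RotaBaxterSpeciesProperties K w Q

  -- The value of a forest all of whose angles carry the generator: • is the unit, B⁺ is R,
  -- and T x F is T ⋄ (• x • ⋄ F).
  mutual
    evalᵀ : ∀ {L : Set} (T : Tree L) → Q.Obj (Anglesᵀ T)
    evalᵀ • = Q.unit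
    evalᵀ (B⁺ F) = Q.R (evalᶠ F)

    evalᶠ : ∀ {L : Set} (F : Forest L) → Q.Obj (Anglesᶠ F)
    evalᶠ [ T ] = evalᵀ T
    evalᶠ (T ⟨ x ⟩ F) = Q.mul (evalᵀ T) (Q.mul g₁ (evalᶠ F))

  mutual
    evalᵀ-map : ∀ {L L′ : Set} (f : L → L′) (T : Tree L) → Q._≈_ (Q.relabel (anglesᵀ-map f T) (evalᵀ (mapᵀ f T))) (evalᵀ T)
    evalᵀ-map f • = QS.relabel-id Q.unit
    evalᵀ-map f (B⁺ F) = ≈ᵠ-trans (Q.R-natural (anglesᶠ-map f F) (evalᶠ (mapᶠ f F))) (Q.R-cong (evalᶠ-map f F))

    evalᶠ-map : ∀ {L L′ : Set} (f : L → L′) (F : Forest L) → Q._≈_ (Q.relabel (anglesᶠ-map f F) (evalᶠ (mapᶠ f F))) (evalᶠ F)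
    evalᶠ-map f [ T ] = evalᵀ-map f T
    evalᶠ-map f (T ⟨ x ⟩ F) = ≈ᵠ-trans (Q.mul-natural (anglesᵀ-map f T) (idᵇ 1ˢ ⊎ᵇ anglesᶠ-map f F) (evalᵀ (mapᵀ f T)) (Q.mul g₁ (evalᶠ (mapᶠ f F))))
                          (Q.mul-cong (evalᵀ-map f T) (≈ᵠ-trans (Q.mul-natural (idᵇ 1ˢ) (anglesᶠ-map f F) g₁ (evalᶠ (mapᶠ f F)))
                                                  (Q.mul-cong (QS.relabel-id g₁) (evalᶠ-map f F))))

  -- Forests that are not bijectively decorated are zero in ADF[X].
  evalDec : ∀ {X} (F : Forest (Elt X)) → Dec (Bijective {X} F) → Q.Obj X
  evalDec F (yes b) = Q.relabel (decorationIso F b) (evalᶠ F)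
  evalDec F (no _) = Q.0ᴹ

  evalBasis : ∀ {X} → Forest (Elt X) → Q.Obj X
  evalBasis {X} F = evalDec {X} F (bijective? {X} F)

  ḡ : ∀ {X} → Lin (Forest (Elt X)) → Q.Obj X
  ḡ {X} u = ∑ᵠ X (evalBasis {X}) u

  ∑evalᵀ : ∀ {L : Set} {Z : FinSet} → Lin (Trackedᵀ {L} Z) → Q.Obj Z
  ∑evalᵀ {L} {Z} u = ∑ᵠ Z (λ e → Q.relabel (proj₂ e) (evalᵀ (proj₁ e))) u

  ∑evalᶠ : ∀ {L : Set} {Z : FinSet} → Lin (Trackedᶠ {L} Z) → Q.Obj Z
  ∑evalᶠ {L} {Z} u = ∑ᵠ Z (λ e → Q.relabel (proj₂ e) (evalᶠ (proj₁ e))) u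

  trackHead-eval : ∀ {L : Set} {X Y : FinSet} (y : L) (G : Forest L) (l : Lin (Trackedᵀ {L} (X ⊎ˢ Y))) (a : Q.Obj X) (b : Q.Obj Y) →
            Q._≈_ (∑evalᵀ l) (Q.mul a b) →
            Q._≈_ (∑evalᶠ (onTerms (trackHead X Y y G) l)) (Q.mul a (Q.mul b (Q.mul g₁ (evalᶠ G))))
  trackHead-eval {L} {X} {Y} y G l a b ih = begin
      ∑evalᶠ (onTerms (trackHead X Y y G) l) ≡⟨ Sum.∑-onTerms (vectorSpace W) _ (trackHead X Y y G) l ⟩
      ∑ᵠ W (λ e → Q.relabel (A ∘ᵇ (proj₂ e ⊎ᵇ idᵇ Z)) (Q.mul (evalᵀ (proj₁ e)) M)) l
        ≈⟨ Sum.∑-cong (vectorSpace W) l (λ e → ≈ᵠ-trans (≈ᵠ-sym (relabel-∘′ (proj₂ e ⊎ᵇ idᵇ Z) A _))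
              (QS.relabel-cong A A (λ _ → refl) (≈ᵠ-trans (Q.mul-natural (proj₂ e) (idᵇ Z) (evalᵀ (proj₁ e)) M)
                  (Q.mul-cong ≈ᵠ-refl (QS.relabel-id M))))) ⟩
      ∑ᵠ W (λ e → Q.relabel A (Q.mul (Q.relabel (proj₂ e) (evalᵀ (proj₁ e))) M)) l ≈˘⟨ relabel-∑ A _ l ⟩
      Q.relabel A (∑ᵠ ((X ⊎ˢ Y) ⊎ˢ Z) (λ e → Q.mul (Q.relabel (proj₂ e) (evalᵀ (proj₁ e))) M) l)
        ≈˘⟨ QS.relabel-cong A A (λ _ → refl) (mul-∑ˡ M _ l) ⟩
      Q.relabel A (Q.mul (∑evalᵀ l) M) ≈⟨ QS.relabel-cong A A (λ _ → refl) (Q.mul-cong ih ≈ᵠ-refl) ⟩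
      Q.relabel A (Q.mul (Q.mul a b) M) ≈⟨ Q.mul-assoc a b M ⟩
      Q.mul a (Q.mul b M) ∎
    where
      Z = 1ˢ ⊎ˢ Anglesᶠ G
      W = X ⊎ˢ (Y ⊎ˢ Z)
      A = assocᵇ X Y Z
      M = Q.mul g₁ (evalᶠ G)
      open ≈ᵠ-Reasoning W

  trackCons-eval : ∀ {L : Set} {Y Z : FinSet} (T : Tree L) (x : L) (l : Lin (Trackedᶠ {L} (Y ⊎ˢ Z))) (a : Q.Obj Y) (b : Q.Obj Z) →
            Q._≈_ (∑evalᶠ l) (Q.mul a b) →
            Q._≈_ (∑evalᶠ (onTerms (trackCons Y Z T x) l)) (Q.mul (Q.mul (evalᵀ T) (Q.mul g₁ a)) b)
  trackCons-eval {L} {Y} {Z} T x l a b ih = begin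
      ∑evalᶠ (onTerms (trackCons Y Z T x) l) ≡⟨ Sum.∑-onTerms (vectorSpace W) _ (trackCons Y Z T x) l ⟩
      ∑ᵠ W (λ e → Q.relabel (A1⁻ ∘ᵇ (idᵇ PT ⊎ᵇ (A2⁻ ∘ᵇ (idᵇ 1ˢ ⊎ᵇ proj₂ e)))) (Q.mul (evalᵀ T) (Q.mul g₁ (evalᶠ (proj₁ e))))) l
        ≈⟨ Sum.∑-cong (vectorSpace W) l (λ e → step e) ⟩
      ∑ᵠ W (λ e → Q.relabel A1⁻ (Q.mul (evalᵀ T) (Q.relabel A2⁻ (Q.mul g₁ (Q.relabel (proj₂ e) (evalᶠ (proj₁ e))))))) l
        ≈˘⟨ relabel-∑ A1⁻ _ l ⟩
      Q.relabel A1⁻ (∑ᵠ (PT ⊎ˢ ((1ˢ ⊎ˢ Y) ⊎ˢ Z)) (λ e → Q.mul (evalᵀ T) (Q.relabel A2⁻ (Q.mul g₁ (Q.relabel (proj₂ e) (evalᶠ (proj₁ e)))))) l)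
        ≈˘⟨ QS.relabel-cong A1⁻ A1⁻ (λ _ → refl) (mul-∑ʳ (evalᵀ T) _ l) ⟩
      Q.relabel A1⁻ (Q.mul (evalᵀ T) (∑ᵠ ((1ˢ ⊎ˢ Y) ⊎ˢ Z) (λ e → Q.relabel A2⁻ (Q.mul g₁ (Q.relabel (proj₂ e) (evalᶠ (proj₁ e))))) l))
        ≈˘⟨ QS.relabel-cong A1⁻ A1⁻ (λ _ → refl) (Q.mul-cong ≈ᵠ-refl (relabel-∑ A2⁻ _ l)) ⟩
      Q.relabel A1⁻ (Q.mul (evalᵀ T) (Q.relabel A2⁻ (∑ᵠ (1ˢ ⊎ˢ (Y ⊎ˢ Z)) (λ e → Q.mul g₁ (Q.relabel (proj₂ e) (evalᶠ (proj₁ e)))) l)))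
        ≈˘⟨ QS.relabel-cong A1⁻ A1⁻ (λ _ → refl) (Q.mul-cong ≈ᵠ-refl (QS.relabel-cong A2⁻ A2⁻ (λ _ → refl) (mul-∑ʳ g₁ _ l))) ⟩
      Q.relabel A1⁻ (Q.mul (evalᵀ T) (Q.relabel A2⁻ (Q.mul g₁ (∑evalᶠ l))))
        ≈⟨ QS.relabel-cong A1⁻ A1⁻ (λ _ → refl) (Q.mul-cong ≈ᵠ-refl (QS.relabel-cong A2⁻ A2⁻ (λ _ → refl) (Q.mul-cong ≈ᵠ-refl ih))) ⟩
      Q.relabel A1⁻ (Q.mul (evalᵀ T) (Q.relabel A2⁻ (Q.mul g₁ (Q.mul a b))))
        ≈˘⟨ QS.relabel-cong A1⁻ A1⁻ (λ _ → refl) (Q.mul-cong ≈ᵠ-refl (mul-assoc⁻ g₁ a b)) ⟩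
      Q.relabel A1⁻ (Q.mul (evalᵀ T) (Q.mul (Q.mul g₁ a) b)) ≈˘⟨ mul-assoc⁻ (evalᵀ T) (Q.mul g₁ a) b ⟩
      Q.mul (Q.mul (evalᵀ T) (Q.mul g₁ a)) b ∎
    where
      PT = Anglesᵀ T
      W = (PT ⊎ˢ (1ˢ ⊎ˢ Y)) ⊎ˢ Z
      A1⁻ = symᵇ (assocᵇ PT (1ˢ ⊎ˢ Y) Z)
      A2⁻ = symᵇ (assocᵇ 1ˢ Y Z)
      open ≈ᵠ-Reasoning W
      step : ∀ e → Q._≈_ (Q.relabel (A1⁻ ∘ᵇ (idᵇ PT ⊎ᵇ (A2⁻ ∘ᵇ (idᵇ 1ˢ ⊎ᵇ proj₂ e)))) (Q.mul (evalᵀ T) (Q.mul g₁ (evalᶠ (proj₁ e)))))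
                         (Q.relabel A1⁻ (Q.mul (evalᵀ T) (Q.relabel A2⁻ (Q.mul g₁ (Q.relabel (proj₂ e) (evalᶠ (proj₁ e)))))))
      step e = ≈ᵠ-trans (≈ᵠ-sym (relabel-∘′ _ A1⁻ _)) (QS.relabel-cong A1⁻ A1⁻ (λ _ → refl)
                 (≈ᵠ-trans (Q.mul-natural (idᵇ PT) _ (evalᵀ T) _) (Q.mul-cong (QS.relabel-id (evalᵀ T))
                   (≈ᵠ-trans (≈ᵠ-sym (relabel-∘′ _ A2⁻ _)) (QS.relabel-cong A2⁻ A2⁻ (λ _ → refl)
                     (≈ᵠ-trans (Q.mul-natural (idᵇ 1ˢ) (proj₂ e) g₁ (evalᶠ (proj₁ e))) (Q.mul-cong (QS.relabel-id g₁) ≈ᵠ-refl)))))))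

  trackB⁺-eval : ∀ {L : Set} {Z : FinSet} (l : Lin (Trackedᶠ {L} Z)) → Q._≈_ (∑evalᵀ (onTerms trackB⁺ l)) (Q.R (∑evalᶠ l))
  trackB⁺-eval {L} {Z} l = ≈ᵠ-trans (≈ᵠ-reflexive (Sum.∑-onTerms (vectorSpace Z) _ trackB⁺ l))
                   (≈ᵠ-trans (Sum.∑-cong (vectorSpace Z) l (λ e → Q.R-natural (proj₂ e) (evalᶠ (proj₁ e)))) (≈ᵠ-sym (R-∑ _ l)))

  mutual
    eval-⋄ᵀ-tracked : ∀ {L : Set} (T T′ : Tree L) → Q._≈_ (∑evalᵀ (⋄ᵀ-tracked T T′)) (Q.mul (evalᵀ T) (evalᵀ T′))
    eval-⋄ᵀ-tracked • T′ = ≈ᵠ-trans (Sum.∑-singleton (vectorSpace (∅ˢ ⊎ˢ Anglesᵀ T′)) (λ e → Q.relabel (proj₂ e) (evalᵀ (proj₁ e))) (T′ , symᵇ (unitˡᵇ (Anglesᵀ T′)))) (≈ᵠ-sym (mul-unitˡ⁻ (evalᵀ T′)))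
    eval-⋄ᵀ-tracked (B⁺ A) • = ≈ᵠ-trans (Sum.∑-singleton (vectorSpace (Anglesᶠ A ⊎ˢ ∅ˢ)) (λ e → Q.relabel (proj₂ e) (evalᵀ (proj₁ e))) (B⁺ A , symᵇ (unitʳᵇ (Anglesᶠ A)))) (≈ᵠ-sym (mul-unitʳ⁻ (Q.R (evalᶠ A))))
    eval-⋄ᵀ-tracked {L} (B⁺ A) (B⁺ A′) = begin
        ∑evalᵀ (onTerms trackB⁺ l1 ++ onTerms trackB⁺ l2 ++ scale w (onTerms trackB⁺ l3))
          ≈⟨ ≈ᵠ-trans (Sum.∑-++ (vectorSpace Z) _ (onTerms trackB⁺ l1) _) (V.+ᴹ-congˡ Z (≈ᵠ-trans (Sum.∑-++ (vectorSpace Z) _ (onTerms trackB⁺ l2) _)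
               (V.+ᴹ-congˡ Z (Sum.∑-scale (vectorSpace Z) _ w (onTerms trackB⁺ l3))))) ⟩
        Q._+_ (∑evalᵀ (onTerms trackB⁺ l1)) (Q._+_ (∑evalᵀ (onTerms trackB⁺ l2)) (Q._·_ w (∑evalᵀ (onTerms trackB⁺ l3))))
          ≈⟨ V.+ᴹ-cong Z (≈ᵠ-trans (trackB⁺-eval l1) (Q.R-cong (eval-tf-tracked (B⁺ A) A′)))
               (V.+ᴹ-cong Z (≈ᵠ-trans (trackB⁺-eval l2) (Q.R-cong (eval-ft-tracked A (B⁺ A′)))) (V.*ₗ-cong Z ≈-refl (≈ᵠ-trans (trackB⁺-eval l3) (Q.R-cong (eval-ff-tracked A A′))))) ⟩
        Q._+_ (Q.R a) (Q._+_ (Q.R b) (Q._·_ w (Q.R c′))) ≈˘⟨ V.+ᴹ-assoc Z _ _ _ ⟩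
        Q._+_ (Q._+_ (Q.R a) (Q.R b)) (Q._·_ w (Q.R c′))
          ≈˘⟨ ≈ᵠ-trans (Q.R-+ _ _) (V.+ᴹ-cong Z (Q.R-+ a b) (Q.R-· w c′)) ⟩
        Q.R (Q._+_ (Q._+_ a b) (Q._·_ w c′)) ≈˘⟨ Q.rota-baxter (evalᶠ A) (evalᶠ A′) ⟩
        Q.mul (Q.R (evalᶠ A)) (Q.R (evalᶠ A′)) ∎
      where
        Z = Anglesᶠ A ⊎ˢ Anglesᶠ A′
        l1 = tf-tracked (B⁺ A) A′
        l2 = ft-tracked A (B⁺ A′)
        l3 = ff-tracked A A′
        a = Q.mul (Q.R (evalᶠ A)) (evalᶠ A′)
        b = Q.mul (evalᶠ A) (Q.R (evalᶠ A′))
        c′ = Q.mul (evalᶠ A) (evalᶠ A′)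
        open ≈ᵠ-Reasoning Z

    eval-tf-tracked : ∀ {L : Set} (T : Tree L) (G : Forest L) → Q._≈_ (∑evalᶠ (tf-tracked T G)) (Q.mul (evalᵀ T) (evalᶠ G))
    eval-tf-tracked T [ T′ ] = ≈ᵠ-trans (≈ᵠ-reflexive (Sum.∑-onTerms (vectorSpace (Anglesᵀ T ⊎ˢ Anglesᵀ T′)) _ track[] (⋄ᵀ-tracked T T′))) (eval-⋄ᵀ-tracked T T′)
    eval-tf-tracked T (T′ ⟨ y ⟩ G) = trackHead-eval y G (⋄ᵀ-tracked T T′) (evalᵀ T) (evalᵀ T′) (eval-⋄ᵀ-tracked T T′)

    eval-ft-tracked : ∀ {L : Set} (F : Forest L) (T′ : Tree L) → Q._≈_ (∑evalᶠ (ft-tracked F T′)) (Q.mul (evalᶠ F) (evalᵀ T′))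
    eval-ft-tracked [ T ] T′ = ≈ᵠ-trans (≈ᵠ-reflexive (Sum.∑-onTerms (vectorSpace (Anglesᵀ T ⊎ˢ Anglesᵀ T′)) _ track[] (⋄ᵀ-tracked T T′))) (eval-⋄ᵀ-tracked T T′)
    eval-ft-tracked (T ⟨ x ⟩ F) T′ = trackCons-eval T x (ft-tracked F T′) (evalᶠ F) (evalᵀ T′) (eval-ft-tracked F T′)

    eval-ff-tracked : ∀ {L : Set} (F G : Forest L) → Q._≈_ (∑evalᶠ (ff-tracked F G)) (Q.mul (evalᶠ F) (evalᶠ G))
    eval-ff-tracked [ T ] G = eval-tf-tracked T G
    eval-ff-tracked (T ⟨ x ⟩ F) G = trackCons-eval T x (ff-tracked F G) (evalᶠ F) (evalᶠ G) (eval-ff-tracked F G)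

module ExtensionIsMorphism {c ℓ m ℓm} (K : Field c ℓ) (w : Field.Carrier K) (Q : RBSpecies K w m ℓm) (g₁ : RBSpecies.Obj Q Positions.1ˢ) where

  open Field K renaming (Carrier to k; refl to ≈-refl; sym to ≈-sym; trans to ≈-trans)
  open ADF K w
  open LinearCombination K
  open Decorations
  open Positions
  open ForestProductDecorations K w
  open ADFSpecies K w
  open ADFProduct K w
  open TrackedProduct K w
  open RotaBaxterSpeciesProperties K w Q
  open Evaluation K w Q g₁

  evalBasis-nonbijective : ∀ {X} (E : Forest (Elt X)) → ¬ Bijective {X} E → Q._≈_ (evalBasis {X} E) Q.0ᴹ
  evalBasis-nonbijective {X} E nE with bijective? {X} E
  ... | yes bE = ⊥-elim (nE bE)
  ... | no _ = ≈ᵠ-refl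

  ḡ-cong : ∀ {X} {u v : Lin (Forest (Elt X))} → ADFEq X u v → Q._≈_ (ḡ {X} u) (ḡ {X} v)
  ḡ-cong {X} {u} {v} e = Sum.∑-resp-coef (vectorSpace X) (eqF X) (evalBasis {X}) u v agree
    where
      agree : ∀ F → coef (eqF X) u F ≈ coef (eqF X) v F ⊎ Q._≈_ (evalBasis {X} F) Q.0ᴹ
      agree F with bijective? {X} F
      ... | yes b = inj₁ (ADFEq⇒coef e F b)
      ... | no _ = inj₂ ≈ᵠ-refl

  evalBasis-natural : ∀ {X Y} (σ : X ≅ Y) (F : Forest (Elt X)) → Q._≈_ (evalBasis {Y} (mapᶠ (app σ) F)) (Q.relabel σ (evalBasis {X} F))
  evalBasis-natural {X} {Y} σ F with bijective? {Y} (mapᶠ (app σ) F) | bijective? {X} F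
  ... | yes b′ | yes b = ≈ᵠ-sym (≈ᵠ-trans (QS.relabel-cong σ σ (λ _ → refl) (QS.relabel-cong Λ Λ (λ _ → refl) (≈ᵠ-sym (evalᶠ-map (app σ) F))))
                          (≈ᵠ-trans (QS.relabel-cong σ σ (λ _ → refl) (relabel-∘′ (anglesᶠ-map (app σ) F) Λ _))
                          (≈ᵠ-trans (relabel-∘′ (Λ ∘ᵇ anglesᶠ-map (app σ) F) σ _)
                                  (relabel-ext _ _ (λ p → sym (decorationᶠ-map (app σ) F p)) _))))
    where Λ = decorationIso F b
  ... | yes b′ | no nb = ⊥-elim (nb (bijective-relabel⁻ σ F b′))
  ... | no nb′ | yes b = ⊥-elim (nb′ (bijective-relabel σ F b))
  ... | no _ | no _ = ≈ᵠ-sym (relabel-0 σ)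

  ḡ-natural : ∀ {X Y} (σ : X ≅ Y) (u : Lin (Forest (Elt X))) → Q._≈_ (ḡ {Y} (onTerms (mapᶠ (app σ)) u)) (Q.relabel σ (ḡ {X} u))
  ḡ-natural {X} {Y} σ u = ≈ᵠ-trans (≈ᵠ-reflexive (Sum.∑-onTerms (vectorSpace Y) (evalBasis {Y}) (mapᶠ (app σ)) u))
                       (≈ᵠ-trans (Sum.∑-cong (vectorSpace Y) u (evalBasis-natural σ)) (≈ᵠ-sym (relabel-∑ σ (evalBasis {X}) u)))

  ḡ-unit : Q._≈_ (ḡ {∅ˢ} ((1# , [ • ]) ∷ [])) Q.unit
  ḡ-unit = ≈ᵠ-trans (Sum.∑-singleton (vectorSpace ∅ˢ) (evalBasis {∅ˢ}) [ • ]) (unit-value (bijective? {∅ˢ} [ • ]))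
    where
      unit-value : ∀ d → Q._≈_ (evalDec {∅ˢ} [ • ] d) Q.unit
      unit-value (yes b) = ≈ᵠ-trans (relabel-ext (decorationIso [ • ] b) (idᵇ ∅ˢ) (λ { (lift ()) }) Q.unit) (QS.relabel-id Q.unit)
      unit-value (no nb) = ⊥-elim (nb enumerates-∅)

  evalDec-R : ∀ {X} (F : Forest (Elt X)) (d : Dec (Bijective {X} F)) → Q._≈_ (evalDec {X} [ B⁺ F ] d) (Q.R (evalDec {X} F d))
  evalDec-R F (yes b) = ≈ᵠ-trans (relabel-ext (decorationIso [ B⁺ F ] b) (decorationIso F b) (λ _ → refl) _) (Q.R-natural (decorationIso F b) (evalᶠ F))
  evalDec-R F (no _) = ≈ᵠ-sym R-0

  ḡ-R : ∀ {X} (u : Lin (Forest (Elt X))) → Q._≈_ (ḡ {X} (onTerms (λ F → [ B⁺ F ]) u)) (Q.R (ḡ {X} u))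
  ḡ-R {X} u = ≈ᵠ-trans (≈ᵠ-reflexive (Sum.∑-onTerms (vectorSpace X) (evalBasis {X}) (λ F → [ B⁺ F ]) u))
               (≈ᵠ-trans (Sum.∑-cong (vectorSpace X) u (λ F → evalDec-R F (bijective? {X} F))) (≈ᵠ-sym (R-∑ (evalBasis {X}) u)))

  module _ {X Y : FinSet} where
    private
      W = X ⊎ˢ Y
      LW = Elt X ⊎ Elt Y

    evalBasis-tracked : ∀ (F : Forest (Elt X)) (G : Forest (Elt Y)) (b : Bijective {X} F) (b′ : Bijective {Y} G)
              (e : Trackedᶠ {LW} (Anglesᶠ (mapᶠ inj₁ F) ⊎ˢ Anglesᶠ (mapᶠ inj₂ G))) →
              Respectsᶠ (Anglesᶠ (mapᶠ inj₁ F)) (Anglesᶠ (mapᶠ inj₂ G)) (decorationᶠ (mapᶠ inj₁ F)) (decorationᶠ (mapᶠ inj₂ G)) e →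
              labelsᶠ (proj₁ e) ≡ labelsᶠ (mapᶠ inj₁ F) ++ labelsᶠ (mapᶠ inj₂ G) →
              Q._≈_ (evalBasis {W} (proj₁ e)) (Q.relabel (decorationIso {X} F b ⊎ᵇ decorationIso {Y} G b′) (Q.relabel (anglesᶠ-map inj₁ F ⊎ᵇ anglesᶠ-map inj₂ G) (Q.relabel (proj₂ e) (evalᶠ (proj₁ e)))))
    evalBasis-tracked F G b b′ (H , θ) hl hs with bijective? {W} H
    ... | no nb = ⊥-elim (nb (subst (Enumerates W) (sym (trans hs (cong₂ _++_ (labelsᶠ-map inj₁ F) (labelsᶠ-map inj₂ G))))
                                (enumerates-join X Y (labelsᶠ F) (labelsᶠ G) b b′)))
    ... | yes bH = ≈ᵠ-trans (relabel-ext (decorationIso {W} H bH) ((Λ ∘ᵇ M) ∘ᵇ θ) pt (evalᶠ H))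
                    (≈ᵠ-sym (≈ᵠ-trans (QS.relabel-cong Λ Λ (λ _ → refl) (relabel-∘′ θ M (evalᶠ H))) (relabel-∘′ (M ∘ᵇ θ) Λ (evalᶠ H))))
      where
        Λ = decorationIso {X} F b ⊎ᵇ decorationIso {Y} G b′
        M = anglesᶠ-map inj₁ F ⊎ᵇ anglesᶠ-map inj₂ G
        pt : ∀ p → decorationᶠ H p ≡ app ((Λ ∘ᵇ M) ∘ᵇ θ) p
        pt p with app θ p | hl p
        ... | inj₁ q | e = trans e (decorationᶠ-map inj₁ F q)
        ... | inj₂ q | e = trans e (decorationᶠ-map inj₂ G q)

    ḡ-mulBasis-bijective : ∀ (F : Forest (Elt X)) (G : Forest (Elt Y)) (b : Bijective {X} F) (b′ : Bijective {Y} G) →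
                           Q._≈_ (ḡ {W} (mulBasis {X} {Y} F G))
                                 (Q.mul (Q.relabel (decorationIso {X} F b) (evalᶠ F)) (Q.relabel (decorationIso {Y} G b′) (evalᶠ G)))
    ḡ-mulBasis-bijective F G b b′ = begin
        ḡ {W} (mulBasis {X} {Y} F G) ≡⟨ cong (ḡ {W}) (sym (untrack-ff F₁ G₂)) ⟩
        ḡ {W} (onTerms proj₁ terms) ≡⟨ Sum.∑-onTerms (vectorSpace W) (evalBasis {W}) proj₁ terms ⟩
        ∑ᵠ W (λ e → evalBasis {W} (proj₁ e)) terms
          ≈⟨ Sum.∑-cong-All (vectorSpace W) terms
               (All.zipWith (λ {e} (r , l) → evalBasis-tracked F G b b′ (proj₂ e) r l) (ff-tracked-respects F₁ G₂ , term-labels)) ⟩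
        ∑ᵠ W (λ e → Q.relabel Λ (Q.relabel M (Q.relabel (proj₂ e) (evalᶠ (proj₁ e))))) terms ≈˘⟨ relabel-∑ Λ _ terms ⟩
        Q.relabel Λ (∑ᵠ _ (λ e → Q.relabel M (Q.relabel (proj₂ e) (evalᶠ (proj₁ e)))) terms)
          ≈˘⟨ QS.relabel-cong Λ Λ (λ _ → refl) (relabel-∑ M _ terms) ⟩
        Q.relabel Λ (Q.relabel M (∑evalᶠ terms))
          ≈⟨ QS.relabel-cong Λ Λ (λ _ → refl) (QS.relabel-cong M M (λ _ → refl) (eval-ff-tracked F₁ G₂)) ⟩
        Q.relabel Λ (Q.relabel M (Q.mul (evalᶠ F₁) (evalᶠ G₂)))
          ≈⟨ QS.relabel-cong Λ Λ (λ _ → refl) (Q.mul-natural (anglesᶠ-map inj₁ F) (anglesᶠ-map inj₂ G) _ _) ⟩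
        Q.relabel Λ (Q.mul (Q.relabel (anglesᶠ-map inj₁ F) (evalᶠ F₁)) (Q.relabel (anglesᶠ-map inj₂ G) (evalᶠ G₂)))
          ≈⟨ QS.relabel-cong Λ Λ (λ _ → refl) (Q.mul-cong (evalᶠ-map inj₁ F) (evalᶠ-map inj₂ G)) ⟩
        Q.relabel Λ (Q.mul (evalᶠ F) (evalᶠ G)) ≈⟨ Q.mul-natural (decorationIso {X} F b) (decorationIso {Y} G b′) (evalᶠ F) (evalᶠ G) ⟩
        Q.mul (Q.relabel (decorationIso {X} F b) (evalᶠ F)) (Q.relabel (decorationIso {Y} G b′) (evalᶠ G)) ∎
      where
        open ≈ᵠ-Reasoning W
        F₁ = mapᶠ inj₁ F
        G₂ = mapᶠ inj₂ G
        terms = ff-tracked F₁ G₂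
        Λ = decorationIso {X} F b ⊎ᵇ decorationIso {Y} G b′
        M = anglesᶠ-map inj₁ F ⊎ᵇ anglesᶠ-map inj₂ G
        term-labels : AllTerms (λ e → labelsᶠ (proj₁ e) ≡ labelsᶠ F₁ ++ labelsᶠ G₂) terms
        term-labels = AllTerms-onTerms⁻ proj₁ (subst (AllTerms (λ E → labelsᶠ E ≡ labelsᶠ F₁ ++ labelsᶠ G₂)) (sym (untrack-ff F₁ G₂))
                                                     (labels-ff F₁ G₂))

    ḡ-mulBasis-nonbijective : ∀ (F : Forest (Elt X)) (G : Forest (Elt Y)) → (¬ Bijective {X} F ⊎ ¬ Bijective {Y} G) →
                              Q._≈_ (ḡ {W} (mulBasis {X} {Y} F G)) Q.0ᴹ
    ḡ-mulBasis-nonbijective F G nb = ≈ᵠ-trans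
      (Sum.∑-cong-All (vectorSpace W) (mulBasis {X} {Y} F G) (AllTerms-map (λ {E} → evalBasis-nonbijective {W} E) (mulBasis-nonbijective {X} {Y} F G nb)))
      (Sum.∑-0ᴹ (vectorSpace W) (mulBasis {X} {Y} F G))

    ḡ-mulBasis : ∀ (F : Forest (Elt X)) (G : Forest (Elt Y)) → Q._≈_ (ḡ {W} (mulBasis {X} {Y} F G)) (Q.mul (evalBasis {X} F) (evalBasis {Y} G))
    ḡ-mulBasis F G with bijective? {X} F | bijective? {Y} G
    ... | yes b | yes b′ = ḡ-mulBasis-bijective F G b b′
    ... | no nb | _ = ≈ᵠ-trans (ḡ-mulBasis-nonbijective F G (inj₁ nb)) (≈ᵠ-sym (mul-0ˡ _))
    ... | yes _ | no nb = ≈ᵠ-trans (ḡ-mulBasis-nonbijective F G (inj₂ nb)) (≈ᵠ-sym (mul-0ʳ _))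

    ḡ-mul : ∀ (x : Lin (Forest (Elt X))) (y : Lin (Forest (Elt Y))) →
            Q._≈_ (ḡ {W} (mulADF {X} {Y} x y)) (Q.mul (ḡ {X} x) (ḡ {Y} y))
    ḡ-mul x y = begin
        ḡ {W} (mulADF {X} {Y} x y) ≈⟨ ḡ-cong (CoefEq⇒ADFEq (mulADF≈mulBind {X} {Y} x y)) ⟩
        ḡ {W} (mulBind {X} {Y} x y) ≈⟨ Sum.∑-bind (vectorSpace W) (evalBasis {W}) x _ ⟩
        ∑ᵠ W (λ F → ḡ {W} (bind y (λ G → mulBasis {X} {Y} F G))) x ≈⟨ Sum.∑-cong (vectorSpace W) x (λ F → Sum.∑-bind (vectorSpace W) (evalBasis {W}) y _) ⟩
        ∑ᵠ W (λ F → ∑ᵠ W (λ G → ḡ {W} (mulBasis {X} {Y} F G)) y) x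
          ≈⟨ Sum.∑-cong (vectorSpace W) x (λ F → Sum.∑-cong (vectorSpace W) y (λ G → ḡ-mulBasis F G)) ⟩
        ∑ᵠ W (λ F → ∑ᵠ W (λ G → Q.mul (evalBasis {X} F) (evalBasis {Y} G)) y) x ≈˘⟨ Sum.∑-cong (vectorSpace W) x (λ F → mul-∑ʳ (evalBasis {X} F) (evalBasis {Y}) y) ⟩
        ∑ᵠ W (λ F → Q.mul (evalBasis {X} F) (ḡ {Y} y)) x ≈˘⟨ mul-∑ˡ (ḡ {Y} y) (evalBasis {X}) x ⟩
        Q.mul (ḡ {X} x) (ḡ {Y} y) ∎
      where open ≈ᵠ-Reasoning W

  ḡ-isRBMorphism : IsRBMorphism K ADF (RBSpecies.raw Q) (λ {X} → ḡ {X})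
  ḡ-isRBMorphism = record
    { isSpeciesMorphism = record
      { f-cong = λ {X} {x} {y} e → ḡ-cong {X} {x} {y} (bijectivewise e)
      ; f-+ = λ {X} x y → Sum.∑-++ (vectorSpace X) (evalBasis {X}) x y
      ; f-· = λ {X} a x → Sum.∑-scale (vectorSpace X) (evalBasis {X}) a x
      ; f-natural = λ {X} {Y} σ x → ḡ-natural σ x
      }
    ; f-mul = λ {X} {Y} x y → ḡ-mul {X} {Y} x y
    ; f-unit = ḡ-unit
    ; f-R = λ {X} x → ḡ-R {X} x
    }

module Universality {c ℓ m ℓm} (K : Field c ℓ) (w : Field.Carrier K) (Q : RBSpecies K w m ℓm)
                    (g : ∀ {X} → ADF.Lin K w (Elt X) → RBSpecies.Obj Q X)
                    (g-isMorphism : IsSpeciesMorphism K (ADF.Ospecies K w) (RBSpecies.species Q) g) where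

  open Field K renaming (Carrier to k; refl to ≈-refl; sym to ≈-sym; trans to ≈-trans)
  open ADF K w
  open LinearCombination K
  open Decorations
  open Positions
  open ADFSpecies K w
  open CanonicalForests K w
  open RotaBaxterSpeciesProperties K w Q
  module G = IsSpeciesMorphism g-isMorphism

  g₁ : Q.Obj 1ˢ
  g₁ = g {1ˢ} (singleton tt)

  open Evaluation K w Q g₁ public using (ḡ)
  open Evaluation K w Q g₁ using (evalᵀ; evalᶠ; evalBasis)
  open ExtensionIsMorphism K w Q g₁ public using (ḡ-isRBMorphism)

  g-as-∑ : ∀ {X} (x : Lin (Elt X)) → Q._≈_ (g {X} x) (∑ᵠ X (λ a → g {X} (singleton a)) x)
  g-as-∑ {X} = linear-as-∑ g G.f-+ G.f-· (λ a t → G.f-cong (λ z _ →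
    coeff-singleton-cong {X} •⟨ t ⟩• •⟨ z ⟩• (≈-sym (*-identityʳ a))))

  -- A generator • a • is a basis element of ADF[X] only when X = {a}; otherwise it vanishes in O[X].
  g-generator : ∀ {X} (a : Elt X) → Q._≈_ (g {X} (singleton a)) (evalBasis {X} •⟨ a ⟩•)
  g-generator {X} a with bijective? {X} •⟨ a ⟩•
  ... | yes b = begin
        g {X} (RawSpecies.relabel Ospecies σ (singleton tt)) ≈⟨ G.f-natural σ (singleton tt) ⟩
        Q.relabel σ g₁ ≈˘⟨ relabel-∘′ (U₁ ∘ᵇ U₂) Λ g₁ ⟩
        Q.relabel Λ (Q.relabel (U₁ ∘ᵇ U₂) g₁) ≈˘⟨ QS.relabel-cong Λ Λ (λ _ → refl) (relabel-∘′ U₂ U₁ g₁) ⟩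
        Q.relabel Λ (Q.relabel U₁ (Q.relabel U₂ g₁))
          ≈˘⟨ QS.relabel-cong Λ Λ (λ _ → refl) (QS.relabel-cong U₁ U₁ (λ _ → refl) (mul-unitʳ⁻ g₁)) ⟩
        Q.relabel Λ (Q.relabel U₁ (Q.mul g₁ Q.unit)) ≈˘⟨ QS.relabel-cong Λ Λ (λ _ → refl) (mul-unitˡ⁻ (Q.mul g₁ Q.unit)) ⟩
        Q.relabel Λ (Q.mul Q.unit (Q.mul g₁ Q.unit)) ∎
    where
      open ≈ᵠ-Reasoning X
      Λ = decorationIso {X} •⟨ a ⟩• b
      U₁ = symᵇ (unitˡᵇ (1ˢ ⊎ˢ ∅ˢ))
      U₂ = symᵇ (unitʳᵇ 1ˢ)
      σ = Λ ∘ᵇ (U₁ ∘ᵇ U₂)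
  ... | no nb = ≈ᵠ-trans (G.f-cong {X} {singleton a} {[]} (λ z bz → ⊥-elim (nb (subst (λ v → Bijective {X} •⟨ v ⟩•) (sym (only z bz)) bz))))
                         (linear-[] g G.f-·)
    where
      only : ∀ z → Bijective {X} •⟨ z ⟩• → a ≡ z
      only z bz with proj₂ bz a
      ... | here a≡z = a≡z

  g≈ḡ∘i : ∀ {X} (x : Lin (Elt X)) → Q._≈_ (g {X} x) (ḡ {X} (i {X} x))
  g≈ḡ∘i {X} x = ≈ᵠ-trans (g-as-∑ x) (≈ᵠ-trans (Sum.∑-cong (vectorSpace X) x g-generator)
                                               (≈ᵠ-sym (≈ᵠ-reflexive (Sum.∑-onTerms (vectorSpace X) (evalBasis {X}) •⟨_⟩• x))))

  module Uniqueness (h : ∀ {X} → Lin (Forest (Elt X)) → Q.Obj X) (h-isMorphism : IsRBMorphism K ADF (RBSpecies.raw Q) h)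
                    (g≈h∘i : ∀ {X} (x : Lin (Elt X)) → Q._≈_ (g {X} x) (h {X} (i {X} x))) where
    module H = IsRBMorphism h-isMorphism
    module HS = IsSpeciesMorphism H.isSpeciesMorphism

    -- Canonical forests are generated from • x • by the unit, R and the product, all of
    -- which h preserves; relabelling then reaches every basis forest.
    mutual
      h-canonicalᵀ : ∀ {L : Set} (T : Tree L) → Q._≈_ (h {Anglesᵀ T} (singleton [ canonicalᵀ T ])) (evalᵀ T)
      h-canonicalᵀ • = H.f-unit
      h-canonicalᵀ (B⁺ F) = ≈ᵠ-trans (H.f-R (singleton (canonicalᶠ F))) (Q.R-cong (h-canonicalᶠ F))

      h-canonicalᶠ : ∀ {L : Set} (F : Forest L) → Q._≈_ (h {Anglesᶠ F} (singleton (canonicalᶠ F))) (evalᶠ F)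
      h-canonicalᶠ [ T ] = h-canonicalᵀ T
      h-canonicalᶠ (T ⟨ x ⟩ F) = ≈ᵠ-trans (HS.f-cong (atBijective (ADFEq-sym (canonical-cons T x F))))
        (≈ᵠ-trans (H.f-mul (singleton [ canonicalᵀ T ]) _)
          (Q.mul-cong (h-canonicalᵀ T) (≈ᵠ-trans (H.f-mul (singleton •⟨ tt ⟩•) (singleton (canonicalᶠ F)))
            (Q.mul-cong (≈ᵠ-sym (g≈h∘i {1ˢ} (singleton tt))) (h-canonicalᶠ F)))))

    h-basis : ∀ {X} (F : Forest (Elt X)) → Q._≈_ (h {X} (singleton F)) (evalBasis {X} F)
    h-basis {X} F with bijective? {X} F
    ... | yes b = ≈ᵠ-trans (≈ᵠ-reflexive (cong (λ z → h {X} (singleton z)) (sym (decorate-canonicalᶠ F))))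
                    (≈ᵠ-trans (HS.f-natural (decorationIso {X} F b) (singleton (canonicalᶠ F)))
                              (QS.relabel-cong (decorationIso {X} F b) (decorationIso {X} F b) (λ _ → refl) (h-canonicalᶠ F)))
    ... | no nb = ≈ᵠ-trans (HS.f-cong {X} {singleton F} {[]} (λ H bH →
                      P.subst₂ _≈_ (sym (coeff≡coef {X} (singleton F) H)) refl
                        (coef-singleton-other (eqF X) F H (λ F≡H → nb (subst (Bijective {X}) (sym F≡H) bH)))))
                    (linear-[] h HS.f-·)

    h≈ḡ : ∀ {X} (u : Lin (Forest (Elt X))) → Q._≈_ (h {X} u) (ḡ {X} u)
    h≈ḡ {X} u = ≈ᵠ-trans (linear-as-∑ h HS.f-+ HS.f-· (λ a F → HS.f-cong (λ H _ → coeff-singleton-cong {X} F H (≈-sym (*-identityʳ a))))  u)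
                         (Sum.∑-cong (vectorSpace X) u h-basis)

theorem2p16 : ∀ {c ℓ m ℓm : Level} (K : Field c ℓ) (w : Field.Carrier K) →
  let open ADF K w in
  IsRBSpecies K w ADF
  × (∀ (Q : RBSpecies K w m ℓm)
       (g : ∀ {X} → RawSpecies.Obj Ospecies X → RBSpecies.Obj Q X) →
       IsSpeciesMorphism K Ospecies (RBSpecies.species Q) g →
       Σ (∀ {X} → RawRBSpecies.Obj ADF X → RBSpecies.Obj Q X) (λ ḡ →
         (IsRBMorphism K ADF (RBSpecies.raw Q) ḡ
          × (∀ {X} (x : RawSpecies.Obj Ospecies X) → RBSpecies._≈_ Q (g {X} x) (ḡ {X} (i {X} x))))
         × (∀ (h : ∀ {X} → RawRBSpecies.Obj ADF X → RBSpecies.Obj Q X) →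
              IsRBMorphism K ADF (RBSpecies.raw Q) h →
              (∀ {X} (x : RawSpecies.Obj Ospecies X) → RBSpecies._≈_ Q (g {X} x) (h {X} (i {X} x))) →
              ∀ {X} (u : RawRBSpecies.Obj ADF X) → RBSpecies._≈_ Q (h {X} u) (ḡ {X} u))))
theorem2p16 K w = ADFRotaBaxter.isRotaBaxterADF K w , λ Q g g-isMorphism →
  let open Universality K w Q g g-isMorphism in
  ḡ , (ḡ-isRBMorphism , g≈ḡ∘i) , λ h h-isMorphism g≈h∘i → Uniqueness.h≈ḡ h h-isMorphism g≈h∘i
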